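{- Let $p\neq 2$ be a prime number and let $n>0$ be an integer with $n\equiv 0,3 \pmod 4$. Then $$ 12\sum_{Q \in \mathcal{Q}_{p,-4n}/\Gamma_0(p)} \frac{2}{|\Gamma_0(p)_Q|} - 24\sum_{Q \in \mathcal{Q}_{p,-n}/\Gamma_0(p)} \frac{2}{|\Gamma_0(p)_Q|} = 4r_3(n) - 2\big(r_3(p^2 n) - p\, r_3(n)\big). $$
   Context: For a positive integer $N$ and an integer $D$, $\mathcal{Q}_{N,D}$ is the set of binary quadratic forms $ax^2+bxy+cy^2$ with $a,b,c\in\mathbb{Z}$, $N\mid a$ and $b^2-4ac=D$. The group $\Gamma_0(N)=\{\begin{pmatrix}a&b\\c&d\end{pmatrix}\in\mathrm{SL}_2(\mathbb{Z}) : c\equiv 0 \pmod N\}$ acts on $\mathcal{Q}_{N,D}$ by linear substitution of variables; the sums run over a set of representatives of the $\Gamma_0(p)$-orbits, and $\Gamma_0(p)_Q$ denotes the stabilizer of $Q$ in $\Gamma_0(p)$. The numbers $r_3(n)$ are defined by $\sum_{n\ge 0} r_3(n)q^n=\left(\sum_{k\in\mathbb{Z}}q^{k^2}\right)^3$, i.e. $r_3(n)$ is the number of $(x,y,z)\in\mathbb{Z}^3$ with $x^2+y^2+z^2=n$. -}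

module Defs where

open import Data.Nat as ℕ using (ℕ; zero; suc)
open import Data.Integer as ℤ using (ℤ; +_; _-_; _*_; _+_; -_)
open import Data.Integer.Divisibility using (_∣_)
open import Data.Rational as ℚ using (ℚ)
open import Data.Product using (_×_; _,_; ∃; Σ)
open import Data.List using (List; []; _∷_; length; lookup; map; filter; upTo; concatMap; sum)
open import Data.List.Membership.Propositional using (_∈_)
open import Data.List.Relation.Unary.Unique.Propositional using (Unique)
open import Data.Fin using (Fin)
open import Function.Bundles using (_⇔_)
open import Relation.Binary.PropositionalEquality using (_≡_)
import Data.Integer.Properties as ℤP

-- A binary quadratic form a x² + b x y + c y², stored as (a , b , c).
Form : Set
Form = ℤ × ℤ × ℤ

disc : Form → ℤ
disc (a , b , c) = b * b - + 4 * a * c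

InQ : ℕ → ℤ → Form → Set
InQ N D (a , b , c) = (+ N ∣ a) × disc (a , b , c) ≡ D

-- 2x2 integer matrix (α β ; γ δ), stored as (α , β , γ , δ)
Mat : Set
Mat = ℤ × ℤ × ℤ × ℤ

InΓ₀ : ℕ → Mat → Set
InΓ₀ N (α , β , γ , δ) = (α * δ - β * γ ≡ + 1) × (+ N ∣ γ)

-- linear substitution: (Q ∘ g)(x , y) = Q(α x + β y , γ x + δ y)
act : Form → Mat → Form
act (a , b , c) (α , β , γ , δ) =
  ( a * α * α + b * α * γ + c * γ * γ
  , + 2 * a * α * β + b * (α * δ + β * γ) + + 2 * c * γ * δ
  , a * β * β + b * β * δ + c * δ * δ )

Equiv : ℕ → Form → Form → Set
Equiv N Q Q' = Σ Mat λ g → InΓ₀ N g × act Q g ≡ Q'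

IsStabList : ℕ → Form → List Mat → Set
IsStabList N Q S = Unique S × (∀ g → (g ∈ S) ⇔ (InΓ₀ N g × act Q g ≡ Q))

IsRepSystem : ℕ → ℤ → List (Form × List Mat) → Set
IsRepSystem N D L =
  (∀ i → InQ N D (Data.Product.proj₁ (lookup L i)))
  × (∀ Q → InQ N D Q → ∃ λ i → Equiv N Q (Data.Product.proj₁ (lookup L i)))
  × (∀ i j → Equiv N (Data.Product.proj₁ (lookup L i)) (Data.Product.proj₁ (lookup L j)) → i ≡ j)
  × (∀ i → IsStabList N (Data.Product.proj₁ (lookup L i)) (Data.Product.proj₂ (lookup L i)))

-- 1/k as a rational (k ≥ 1 in all uses; stabilizers contain the identity)
inv : ℕ → ℚ
inv zero = ℚ.0ℚ
inv (suc k) = (+ 1) ℚ./ suc k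

weightSum : List (Form × List Mat) → ℚ
weightSum [] = ℚ.0ℚ
weightSum ((Q , S) ∷ L) = ((+ 2) ℚ./ 1) ℚ.* inv (length S) ℚ.+ weightSum L

intRange : ℕ → List ℤ
intRange n = map (λ i → + i - + n) (upTo (suc (2 ℕ.* n)))

-- r₃(n) = #{(x,y,z) ∈ ℤ³ : x²+y²+z² = n}; every solution has |x|,|y|,|z| ≤ n.
r3 : ℕ → ℕ
r3 n = length (filter (λ t → sq t ℤP.≟ + n) triples)
  where
  triples : List (ℤ × ℤ × ℤ)
  triples = concatMap (λ x → concatMap (λ y → map (λ z → (x , y , z)) (intRange n)) (intRange n)) (intRange n)
  sq : ℤ × ℤ × ℤ → ℤ
  sq (x , y , z) = x * x + y * y + z * z

{-# OPTIONS --safe #-}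
-- Both sides are expressed through the class sum h(N), the weighted number of Selling-reduced forms of
-- discriminant -N, i.e. of triples u, v, w ≥ 0 of equal parity with uv + vw + wu = N.
--
-- 1. Gauss: r₃(n) = 2 (h(4n) - 2 h(n)).  With θ = ∑ (-1)ᵏ q^(k²), the right-hand side (up to the sign (-1)ⁿ) is the
--    coefficient of a series P given by a signed count of xy + yz + zx = n, and it suffices that θ P = θ⁴.  Jacobi's
--    formula θ⁴ = 1 - 8 ∑ (-1)^(d+e) d q^(de) follows from the differential equation θ D(θ⁴) = 4 θ⁴ D(θ) and a
--    Liouville identity for i² + de = n.  The remaining Kronecker relation, on xy + yz + zx + k² = n, is a scissors
--    congruence of cones: it follows by repeatedly splitting sums over pairs of positive integers a, b into
--    a > b, a < b, a = b and by restricting variables to even values.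
-- 2. Reduction: every positive definite Q has total weight 12 of reduced forms Q ∘ g, g ∈ SL₂(ℤ).  Hence a sum of
--    2 / |stabilizer| over Γ₀(p)-orbits is a sum over reduced forms Q, weighted by the number N_p(Q) of zeros of Q on
--    the projective line over F_p.
-- 3. Hecke: counting the triples (Q, Q′, X) of reduced forms of discriminants -N, -p²N and integral matrices X with
--    det X = p, Q ∘ X = Q′ in two ways gives ∑ N_p = (p + 2) h(N) - h(p²N).
module Submission where

open import Defs
open import Data.Bool using (Bool; true; false; if_then_else_; _xor_; _∧_)
open import Data.Nat using (ℕ; zero; suc; z≤n; s≤s; _%_; _^_; _<ᵇ_; ⌊_/2⌋; NonZero) renaming (_+_ to _+ℕ_; _*_ to _*ℕ_; _∸_ to _∸ℕ_; _<_ to _<ℕ_; _≤_ to _≤ℕ_)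
import Data.Nat.Properties as ℕP
open import Data.Nat.Primality using (Prime; prime⇒nonZero; euclidsLemma; ¬prime[0]; ¬prime[1])
open import Data.Nat.Coprimality using (coprime-Bézout; prime⇒coprime)
open import Data.Nat.GCD using (module Bézout)
open Bézout using (Identity; +-; -+)
import Data.Nat as ℕ
import Data.Nat.Divisibility as ℕDiv
open import Data.Integer using (ℤ; +_; -[1+_]; +[1+_]; _+_; _-_; _*_; -_; _<_; _≤_; ∣_∣; +<+; +≤+)
import Data.Integer as ℤ
import Data.Integer.Properties as ℤP
open import Data.Integer.Divisibility using (_∣_)
open import Data.Integer.Divisibility.Signed using (divides) renaming (_∣_ to _∣ₛ_; _∣?_ to _∣ₛ?_; ∣ᵤ⇒∣ to ∣⇒∣ₛ; ∣⇒∣ᵤ to ∣ₛ⇒∣; ∣m∣n⇒∣m+n to ∣ₛ-+; ∣m⇒∣-m to ∣ₛ-neg; ∣m⇒∣m*n to ∣ₛ-*ʳ; ∣n⇒∣m*n to ∣ₛ-*ˡ)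
open import Data.Integer.DivMod using (n%ℕd<d; a≡a%ℕn+[a/ℕn]*n) renaming (_%ℕ_ to _%ℤ_; _/ℕ_ to _/ℤ_)
open import Data.Rational using (ℚ; _/_) renaming (_*_ to _*ℚ_; _-_ to _-ℚ_; _+_ to _+ℚ_)
import Data.Rational as ℚ
import Data.Rational.Properties as ℚP
import Data.Rational.Unnormalised as ℚᵘ
import Data.Rational.Unnormalised.Properties as ℚᵘP
open import Data.Product using (_×_; _,_; proj₁; proj₂; Σ)
open import Data.Sum using (_⊎_; inj₁; inj₂)
open import Data.Empty using (⊥)
open import Data.Unit using (tt)
import Data.Fin.Properties as FinP
open import Data.Fin using (Fin) renaming (zero to fzero; suc to fsuc)
open import Data.Vec using (Vec; []; _∷_)
import Data.Vec.Properties as VecP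
import Data.Product.Properties as ProductP
import Data.Bool.Properties as BoolP
open import Data.List using (List; []; _∷_; _++_; map; filter; concatMap; length; upTo; allFin; lookup)
open import Data.List.Membership.Propositional using (_∈_; lose)
import Data.List.Membership.Propositional.Properties as ∈P
import Data.List.Properties as ListP
open import Data.List.Relation.Unary.Any using (here; there)
open import Data.List.Relation.Unary.All using (All; []; _∷_)
import Data.List.Relation.Unary.All as All
import Data.List.Relation.Unary.All.Properties as AllP
open import Data.List.Relation.Unary.AllPairs using ([]; _∷_; allPairs?)
open import Data.List.Relation.Unary.Unique.Propositional using (Unique)
import Data.List.Relation.Unary.Unique.Propositional.Properties as UniqueP
open import Data.List.Relation.Binary.Permutation.Propositional using (_↭_)
import Data.List.Relation.Binary.Permutation.Propositional as Perm
open import Data.List.Relation.Binary.BagAndSetEquality using (∼bag⇒↭)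
open import Data.List.Membership.Propositional.Properties.WithK using (unique∧set⇒bag)
open import Function using (_∘_; case_of_)
open import Function.Bundles using (_⇔_; mk⇔; Equivalence)
open import Relation.Nullary using (¬_; Dec; yes; no; contradiction)
open import Relation.Nullary.Decidable using (_×-dec_; _→-dec_; ¬?; from-yes)
open import Relation.Binary.PropositionalEquality using (_≡_; _≢_; refl; sym; trans; cong; cong₂; subst; subst₂; module ≡-Reasoning)
open import Data.Integer.Tactic.RingSolver using (solve-∀)
open import Data.Nat.Tactic.RingSolver using () renaming (solve-∀ to ℕ-solve-∀)
open import Data.Nat.Induction using (<-rec)

open ≡-Reasoning

-- Selling's parameters are used instead of the classical inequalities because every boundary case
-- becomes a weight: the factor `ς`, with values 0, 1, 2, satisfies ς(x) + ς(-x) = 2, so the total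
-- weight 12 of the reductions of Q (48 in the normalisation of `h4`) is the same whether or not Q
-- lies on a wall or has extra automorphisms. Stabilizers never have to be classified: 2 /
-- |stabilizer| appears as a share of 48. The same parameters make h(N) a count of lattice points on
-- uv + vw + wu = N, to which theta series apply. Power series are cut at a bound B. The formulas
-- for θ³ and θ⁴ are shown at coefficients n ≤ B, by inductions on n that start from the vanishing
-- at negative indices. The end of the proof is formal. The Hecke relation is linear in h, and N ↦
-- p²N commutes with N ↦ 4N, so it applies to h(4n) - 2 h(n), where Gauss's formula brings in r₃ at
-- n and at p²n. Positive and negative definite forms both have orbits on the left-hand side; this
-- is the source of a factor 2.

private variable
  A B : Set

-- Finite sums and changes of variables

∑ : List A → (A → ℤ) → ℤ
∑ []       f = + 0
∑ (x ∷ xs) f = f x + ∑ xs f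

∑-cong∈ : (xs : List A) {f g : A → ℤ} → (∀ {x} → x ∈ xs → f x ≡ g x) → ∑ xs f ≡ ∑ xs g
∑-cong∈ []       eq = refl
∑-cong∈ (x ∷ xs) eq = cong₂ _+_ (eq (here refl)) (∑-cong∈ xs (eq ∘ there))

∑-cong : (xs : List A) {f g : A → ℤ} → (∀ x → f x ≡ g x) → ∑ xs f ≡ ∑ xs g
∑-cong xs eq = ∑-cong∈ xs (λ {x} _ → eq x)

+-exchange : ∀ a b c d → (a + b) + (c + d) ≡ (a + c) + (b + d)
+-exchange = solve-∀

∑-+ : (xs : List A) (f g : A → ℤ) → ∑ xs (λ x → f x + g x) ≡ ∑ xs f + ∑ xs g
∑-+ []       f g = refl
∑-+ (x ∷ xs) f g =
  trans (cong (_+_ (f x + g x)) (∑-+ xs f g)) (+-exchange (f x) (g x) (∑ xs f) (∑ xs g))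

∑-*ˡ : (c : ℤ) (xs : List A) (f : A → ℤ) → ∑ xs (λ x → c * f x) ≡ c * ∑ xs f
∑-*ˡ c []       f = sym (ℤP.*-zeroʳ c)
∑-*ˡ c (x ∷ xs) f =
  trans (cong (_+_ (c * f x)) (∑-*ˡ c xs f)) (sym (ℤP.*-distribˡ-+ c (f x) (∑ xs f)))

∑-*ʳ : (c : ℤ) (xs : List A) (f : A → ℤ) → ∑ xs (λ x → f x * c) ≡ ∑ xs f * c
∑-*ʳ c xs f =
  trans (∑-cong xs (λ x → ℤP.*-comm (f x) c)) (trans (∑-*ˡ c xs f) (ℤP.*-comm c (∑ xs f)))

∑-neg : (xs : List A) (f : A → ℤ) → ∑ xs (λ x → - f x) ≡ - ∑ xs f
∑-neg []       f = refl
∑-neg (x ∷ xs) f = trans (cong (_+_ (- f x)) (∑-neg xs f)) (sym (ℤP.neg-distrib-+ (f x) (∑ xs f)))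

∑-zero∈ : (xs : List A) {f : A → ℤ} → (∀ {x} → x ∈ xs → f x ≡ + 0) → ∑ xs f ≡ + 0
∑-zero∈ []       eq = refl
∑-zero∈ (x ∷ xs) eq = cong₂ _+_ (eq (here refl)) (∑-zero∈ xs (eq ∘ there))

∑-const : (c : ℤ) (xs : List A) → ∑ xs (λ _ → c) ≡ + length xs * c
∑-const c []       = refl
∑-const c (x ∷ xs) = trans (cong (_+_ (c)) (∑-const c xs)) (sym (ℤP.suc-* (+ length xs) c))

∑-swap : (xs : List A) (ys : List B) (f : A → B → ℤ) →
  ∑ xs (λ x → ∑ ys (f x)) ≡ ∑ ys (λ y → ∑ xs (λ x → f x y))
∑-swap []       ys f = sym (∑-zero∈ ys (λ _ → refl))
∑-swap (x ∷ xs) ys f =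
  trans (cong (_+_ (∑ ys (f x))) (∑-swap xs ys f)) (sym (∑-+ ys (f x) (λ y → ∑ xs (λ x → f x y))))

∑-++ : (xs ys : List A) (f : A → ℤ) → ∑ (xs ++ ys) f ≡ ∑ xs f + ∑ ys f
∑-++ []       ys f = sym (ℤP.+-identityˡ _)
∑-++ (x ∷ xs) ys f = trans (cong (_+_ (f x)) (∑-++ xs ys f)) (sym (ℤP.+-assoc (f x) (∑ xs f) (∑ ys f)))

∑-map : (h : A → B) (xs : List A) (f : B → ℤ) → ∑ (map h xs) f ≡ ∑ xs (f ∘ h)
∑-map h []       f = refl
∑-map h (x ∷ xs) f = cong (_+_ (f (h x))) (∑-map h xs f)

∑-concatMap : (h : A → List B) (xs : List A) (f : B → ℤ) →
  ∑ (concatMap h xs) f ≡ ∑ xs (λ x → ∑ (h x) f)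
∑-concatMap h []       f = refl
∑-concatMap h (x ∷ xs) f =
  trans (∑-++ (h x) (concatMap h xs) f) (cong (_+_ (∑ (h x) f)) (∑-concatMap h xs f))

∑-↭ : {xs ys : List A} → xs ↭ ys → (f : A → ℤ) → ∑ xs f ≡ ∑ ys f
∑-↭ Perm.refl          f = refl
∑-↭ (Perm.prep x p)    f = cong (_+_ (f x)) (∑-↭ p f)
∑-↭ (Perm.swap {xs} {ys} x y p) f =
  trans (sym (ℤP.+-assoc (f x) (f y) (∑ xs f)))
    (trans (cong₂ _+_ (ℤP.+-comm (f x) (f y)) (∑-↭ p f)) (ℤP.+-assoc (f y) (f x) (∑ ys f)))
∑-↭ (Perm.trans p q)   f = trans (∑-↭ p f) (∑-↭ q f)

𝟙 : {P : Set} → Dec P → ℤ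
𝟙 (yes _) = + 1
𝟙 (no _)  = + 0

𝟙-cong : {P Q : Set} (p : Dec P) (q : Dec Q) → (P → Q) → (Q → P) → 𝟙 p ≡ 𝟙 q
𝟙-cong (yes _) (yes _) f g = refl
𝟙-cong (yes p) (no ¬q) f g = contradiction (f p) ¬q
𝟙-cong (no ¬p) (yes q) f g = contradiction (g q) ¬p
𝟙-cong (no _)  (no _)  f g = refl

𝟙-yes : {P : Set} (p : Dec P) → P → 𝟙 p ≡ + 1
𝟙-yes p x = 𝟙-cong p (yes tt) (λ _ → tt) (λ _ → x)

𝟙-no : {P : Set} (p : Dec P) → ¬ P → 𝟙 p ≡ + 0
𝟙-no p ¬x = 𝟙-cong p (no (λ ())) ¬x (λ ())

∑-filter : {P : A → Set} (P? : ∀ x → Dec (P x)) (xs : List A) (f : A → ℤ) →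
  ∑ (filter P? xs) f ≡ ∑ xs (λ x → 𝟙 (P? x) * f x)
∑-filter P? []       f = refl
∑-filter P? (x ∷ xs) f with P? x
... | yes _ = cong₂ _+_ (sym (ℤP.*-identityˡ (f x))) (∑-filter P? xs f)
... | no _  = trans (∑-filter P? xs f) (sym (ℤP.+-identityˡ _))

length≡∑ : (xs : List A) → + length xs ≡ ∑ xs (λ _ → + 1)
length≡∑ xs = sym (trans (∑-const (+ 1) xs) (ℤP.*-identityʳ _))

∑-bij : {xs : List A} {ys : List B} → Unique xs → Unique ys → (f : A → B) (g : B → A) →
  (∀ {x} → x ∈ xs → f x ∈ ys × g (f x) ≡ x) → (∀ {y} → y ∈ ys → g y ∈ xs × f (g y) ≡ y) →
  {v : A → ℤ} {w : B → ℤ} → (∀ {x} → x ∈ xs → v x ≡ w (f x)) → ∑ xs v ≡ ∑ ys w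
∑-bij {xs = xs} {ys} uxs uys f g to from {v} {w} vw = begin
  ∑ xs v         ≡⟨ ∑-cong∈ xs vw ⟩
  ∑ xs (w ∘ f)   ≡⟨ sym (∑-map f xs w) ⟩
  ∑ (map f xs) w ≡⟨ ∑-↭ (∼bag⇒↭ (unique∧set⇒bag (uniq xs (λ x∈ → proj₂ (to x∈)) uxs) uys (mk⇔ t s))) w ⟩
  ∑ ys w         ∎
  where
  uniq : ∀ zs → (∀ {x} → x ∈ zs → g (f x) ≡ x) → Unique zs → Unique (map f zs)
  uniq []       inv u        = []
  uniq (z ∷ zs) inv (z∉ ∷ u) =
    AllP.map⁺ (All.tabulate (λ {x} x∈ eq → All.lookup z∉ x∈
      (trans (sym (inv (here refl))) (trans (cong g eq) (inv (there x∈))))))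
    ∷ uniq zs (inv ∘ there) u
  t : ∀ {y} → y ∈ map f xs → y ∈ ys
  t y∈ with x , x∈ , refl ← ∈P.∈-map⁻ f y∈ = proj₁ (to x∈)
  s : ∀ {y} → y ∈ ys → y ∈ map f xs
  s y∈ = subst (_∈ map f xs) (proj₂ (from y∈)) (∈P.∈-map⁺ f (proj₁ (from y∈)))

dpairs : (xs : List A) → (A → List B) → List (A × B)
dpairs xs ys = concatMap (λ x → map (x ,_) (ys x)) xs

∑-dpairs : (xs : List A) (ys : A → List B) (f : A × B → ℤ) →
  ∑ (dpairs xs ys) f ≡ ∑ xs (λ x → ∑ (ys x) (λ y → f (x , y)))
∑-dpairs xs ys f = trans (∑-concatMap _ xs f) (∑-cong xs (λ x → ∑-map (x ,_) (ys x) f))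

∈-dpairs⁺ : {xs : List A} {ys : A → List B} {x : A} {y : B} → x ∈ xs → y ∈ ys x → (x , y) ∈ dpairs xs ys
∈-dpairs⁺ {xs = xs} {ys} {x} x∈ y∈ =
  ∈P.∈-concatMap⁺ (λ x → map (x ,_) (ys x)) (lose {P = λ z → _ ∈ map (z ,_) (ys z)} x∈ (∈P.∈-map⁺ (x ,_) y∈))

∈-dpairs⁻ : {xs : List A} {ys : A → List B} {x : A} {y : B} → (x , y) ∈ dpairs xs ys → x ∈ xs × y ∈ ys x
∈-dpairs⁻ {xs = z ∷ zs} {ys} p with ∈P.∈-++⁻ (map (z ,_) (ys z)) p
... | inj₁ q with _ , y∈ , refl ← ∈P.∈-map⁻ (z ,_) q = here refl , y∈
... | inj₂ q = let x∈ , y∈ = ∈-dpairs⁻ {xs = zs} {ys} q in there x∈ , y∈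

dpairs-unique : {xs : List A} {ys : A → List B} → Unique xs → (∀ {x} → x ∈ xs → Unique (ys x)) → Unique (dpairs xs ys)
dpairs-unique {xs = []}     u        v = []
dpairs-unique {xs = z ∷ zs} {ys} (z∉ ∷ u) v =
  UniqueP.++⁺ (UniqueP.map⁺ (λ { refl → refl }) (v (here refl))) (dpairs-unique u (v ∘ there)) disj
  where
  disj : ∀ {q} → (q ∈ map (z ,_) (ys z) × q ∈ dpairs zs ys) → ⊥
  disj (p , q) with _ , _ , refl ← ∈P.∈-map⁻ (z ,_) p = All.lookup z∉ (proj₁ (∈-dpairs⁻ {xs = zs} {ys} q)) refl

-- Cone sums

rng : ℕ → List ℕ
rng zero    = []
rng (suc B) = suc B ∷ rng B

∈-rng⁻ : ∀ B {i} → i ∈ rng B → 1 ≤ℕ i × i ≤ℕ B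
∈-rng⁻ (suc B) (here refl) = s≤s z≤n , ℕP.≤-refl
∈-rng⁻ (suc B) (there p)   = let l , u = ∈-rng⁻ B p in l , ℕP.m≤n⇒m≤1+n u

∈-rng⁺ : ∀ B {i} → 1 ≤ℕ i → i ≤ℕ B → i ∈ rng B
∈-rng⁺ zero    (s≤s _) ()
∈-rng⁺ (suc B) l u with ℕP.m≤n⇒m<n∨m≡n u
... | inj₁ (s≤s i≤B) = there (∈-rng⁺ B l i≤B)
... | inj₂ refl      = here refl

rng-unique : ∀ B → Unique (rng B)
rng-unique zero    = []
rng-unique (suc B) =
  All.tabulate (λ i∈ eq → ℕP.<⇒≢ (s≤s (proj₂ (∈-rng⁻ B i∈))) (sym eq)) ∷ rng-unique B

∑-cut : ∀ k j {f : ℕ → ℤ} → (∀ i → k <ℕ i → f i ≡ + 0) → ∑ (rng (j +ℕ k)) f ≡ ∑ (rng k) f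
∑-cut k zero    z = refl
∑-cut k (suc j) z =
  trans (cong₂ _+_ (z (suc (j +ℕ k)) (s≤s (ℕP.m≤n+m k j))) (∑-cut k j z)) (ℤP.+-identityˡ _)

-- The triangle a + b ≤ B is what the half a > b of the square becomes when the larger number is
-- replaced by the difference.
∑△ : ℕ → (ℕ → ℕ → ℤ) → ℤ
∑△ B g = ∑ (rng B) (λ a → ∑ (rng (B ∸ℕ a)) (g a))

∑△-suc : ∀ B g → ∑△ (suc B) g ≡ ∑ (rng B) (λ a → g a (suc (B ∸ℕ a))) + ∑△ B g
∑△-suc B g = begin
  ∑ (rng (B ∸ℕ B)) (g (suc B)) + ∑ (rng B) (λ a → ∑ (rng (suc B ∸ℕ a)) (g a))
    ≡⟨ cong₂ (λ k s → ∑ (rng k) (g (suc B)) + s) (ℕP.n∸n≡0 B)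
         (∑-cong∈ (rng B) (λ {a} a∈ → cong (λ k → ∑ (rng k) (g a)) (ℕP.+-∸-assoc 1 (proj₂ (∈-rng⁻ B a∈))))) ⟩
  + 0 + ∑ (rng B) (λ a → g a (suc (B ∸ℕ a)) + ∑ (rng (B ∸ℕ a)) (g a))
    ≡⟨ ℤP.+-identityˡ _ ⟩
  ∑ (rng B) (λ a → g a (suc (B ∸ℕ a)) + ∑ (rng (B ∸ℕ a)) (g a))
    ≡⟨ ∑-+ (rng B) _ _ ⟩
  ∑ (rng B) (λ a → g a (suc (B ∸ℕ a))) + ∑△ B g ∎

∑△-full : ∀ B {g} → (∀ {a} b → a ∈ rng B → B <ℕ b +ℕ a → g a b ≡ + 0) →
  ∑△ B g ≡ ∑ (rng B) (λ a → ∑ (rng B) (g a))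
∑△-full B {g} z = ∑-cong∈ (rng B) λ {a} a∈ →
  let a≤B = proj₂ (∈-rng⁻ B a∈) in
  trans (sym (∑-cut (B ∸ℕ a) a (λ b lt → z b a∈
          (subst (_<ℕ b +ℕ a) (ℕP.m∸n+n≡m a≤B) (ℕP.+-monoˡ-< a lt)))))
        (cong (λ k → ∑ (rng k) (g a)) (ℕP.m+[n∸m]≡n a≤B))

-- Induction on B: the new row and the new column of the square are the new antidiagonals of the two
-- triangles, and the corner is the new diagonal term.
∑∑-△ : ∀ B (f : ℕ → ℕ → ℤ) →
  ∑ (rng B) (λ a → ∑ (rng B) (f a)) ≡
  (∑△ B (λ b a → f (a +ℕ b) b) + ∑△ B (λ a b → f a (a +ℕ b))) + ∑ (rng B) (λ a → f a a)
∑∑-△ zero    f = refl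
∑∑-△ (suc B) f = begin
  (d + r) + ∑ (rng B) (λ a → f a (suc B) + ∑ (rng B) (f a))
    ≡⟨ cong (_+_ (d + r)) (trans (∑-+ (rng B) _ _) (cong (_+_ c) (∑∑-△ B f))) ⟩
  (d + r) + (c + ((t₁ + t₂) + e))
    ≡⟨ shuffle d r c t₁ t₂ e ⟩
  ((r + t₁) + (c + t₂)) + (d + e)
    ≡⟨ cong (λ z → z + (d + e)) (cong₂ _+_
         (trans (cong (λ z → z + t₁) (∑-cong∈ (rng B) (λ {b} b∈ → cong (λ k → f (suc k) b) (sym (ℕP.m∸n+n≡m (proj₂ (∈-rng⁻ B b∈))))))) (sym (∑△-suc B _)))
         (trans (cong (λ z → z + t₂) (∑-cong∈ (rng B) (λ {a} a∈ → cong (f a) (sym (trans (ℕP.+-suc a (B ∸ℕ a)) (cong suc (ℕP.m+[n∸m]≡n (proj₂ (∈-rng⁻ B a∈))))))))) (sym (∑△-suc B _)))) ⟩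
  (∑△ (suc B) (λ b a → f (a +ℕ b) b) + ∑△ (suc B) (λ a b → f a (a +ℕ b))) + (d + e) ∎
  where
  d = f (suc B) (suc B)
  r = ∑ (rng B) (f (suc B))
  c = ∑ (rng B) (λ a → f a (suc B))
  e = ∑ (rng B) (λ a → f a a)
  t₁ = ∑△ B (λ b a → f (a +ℕ b) b)
  t₂ = ∑△ B (λ a b → f a (a +ℕ b))
  shuffle : ∀ d r c t₁ t₂ e → (d + r) + (c + ((t₁ + t₂) + e)) ≡ ((r + t₁) + (c + t₂)) + (d + e)
  shuffle = solve-∀

-- Where f vanishes outside the square, the triangles of `∑∑-△` can be filled up to squares. The
-- three results are then again sums over full ranges and can be split further.
∑-split : ∀ B (f : ℕ → ℕ → ℤ) → (∀ {a b} → 1 ≤ℕ a → 1 ≤ℕ b → B <ℕ a ⊎ B <ℕ b → f a b ≡ + 0) →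
  ∑ (rng B) (λ a → ∑ (rng B) (f a)) ≡
  (∑ (rng B) (λ a → ∑ (rng B) (λ b → f (a +ℕ b) b)) + ∑ (rng B) (λ a → ∑ (rng B) (λ b → f a (a +ℕ b))))
    + ∑ (rng B) (λ a → f a a)
∑-split B f z = trans (∑∑-△ B f) (cong (λ s → s + ∑ (rng B) (λ a → f a a)) (cong₂ _+_
  (trans (∑△-full B (λ {b} a b∈ lt → let 1≤b = proj₁ (∈-rng⁻ B b∈) in
                      z (ℕP.≤-trans 1≤b (ℕP.m≤n+m b a)) 1≤b (inj₁ lt)))
         (∑-swap (rng B) (rng B) (λ b a → f (a +ℕ b) b)))
  (∑△-full B (λ {a} b a∈ lt → let 1≤a = proj₁ (∈-rng⁻ B a∈) in
                      z 1≤a (ℕP.≤-trans 1≤a (ℕP.m≤m+n a b)) (inj₂ (subst (B <ℕ_) (ℕP.+-comm b a) lt))))))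

sgn : ℕ → ℤ
sgn zero    = + 1
sgn (suc n) = - sgn n

sgn-+ : ∀ m n → sgn (m +ℕ n) ≡ sgn m * sgn n
sgn-+ zero    n = sym (ℤP.*-identityˡ (sgn n))
sgn-+ (suc m) n = trans (cong -_ (sgn-+ m n)) (ℤP.neg-distribˡ-* (sgn m) (sgn n))

sgn² : ∀ n → sgn n * sgn n ≡ + 1
sgn² zero    = refl
sgn² (suc n) = trans (neg² (sgn n)) (sgn² n)
  where
  neg² : ∀ x → - x * - x ≡ x * x
  neg² = solve-∀

-- The factor (-1)^a + 1 is 2 for even a and 0 for odd a. The range is first doubled by vanishing
-- terms, so that its even members are exactly the a + a with a ≤ B.
∑-even : ∀ B {f : ℕ → ℤ} → (∀ a → B <ℕ a → f a ≡ + 0) →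
  ∑ (rng B) (λ a → sgn a * f a) + ∑ (rng B) f ≡ + 2 * ∑ (rng B) (λ a → f (a +ℕ a))
∑-even B {f} z = begin
  ∑ (rng B) (λ a → sgn a * f a) + ∑ (rng B) f
    ≡⟨ sym (∑-+ (rng B) _ _) ⟩
  ∑ (rng B) (λ a → sgn a * f a + f a)
    ≡⟨ sym (∑-cut B B (λ a lt → trans (cong (λ t → sgn a * t + t) (z a lt)) (cong (λ t → t + + 0) (ℤP.*-zeroʳ (sgn a))))) ⟩
  ∑ (rng (B +ℕ B)) (λ a → sgn a * f a + f a)
    ≡⟨ twice B ⟩
  + 2 * ∑ (rng B) (λ a → f (a +ℕ a)) ∎
  where
  step : ∀ s x y r → s * s ≡ + 1 → (- (- (s * s)) * x + x) + ((- (s * s) * y + y) + r) ≡ + 2 * x + r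
  step s x y r eq rewrite eq = ring x y r
    where
    ring : ∀ x y r → (- (- + 1) * x + x) + ((- + 1 * y + y) + r) ≡ + 2 * x + r
    ring = solve-∀
  twice : ∀ k → ∑ (rng (k +ℕ k)) (λ a → sgn a * f a + f a) ≡ + 2 * ∑ (rng k) (λ a → f (a +ℕ a))
  twice zero    = refl
  twice (suc k) rewrite ℕP.+-suc k k | sgn-+ k k =
    trans (step (sgn k) (f (suc (suc (k +ℕ k)))) (f (suc (k +ℕ k))) _ (sgn² k))
      (trans (cong (_+_ (+ 2 * f (suc (suc (k +ℕ k))))) (twice k)) (sym (ℤP.*-distribˡ-+ (+ 2) (f (suc (suc (k +ℕ k)))) (∑ (rng k) (λ a → f (a +ℕ a))))))

-- Cone k stands for the sum, over positive integers m₁ … mₖ, of [q(m) = n] (-1)^{λ(m)} with q a quadratic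
-- form with natural coefficients and λ a linear form mod 2; `cone s l v c` adds a first variable a,
-- the terms s a² + a (v · m) to q, and a to λ when l is true.
data Cone : ℕ → Set where
  ∅    : Cone 0
  cone : ∀ {k} → ℕ → Bool → Vec ℕ k → Cone k → Cone (suc k)

dot : ∀ {k} → Vec ℕ k → Vec ℕ k → ℕ
dot []      []      = 0
dot (x ∷ v) (m ∷ w) = x *ℕ m +ℕ dot v w

val : ∀ {k} → Cone k → Vec ℕ k → ℕ
val ∅              []      = 0
val (cone s _ v c) (a ∷ m) = s *ℕ (a *ℕ a) +ℕ a *ℕ dot v m +ℕ val c m

sgnIf : Bool → ℕ → ℤ
sgnIf true  a = sgn a
sgnIf false a = + 1

parity : ∀ {k} → Cone k → Vec ℕ k → ℤ
parity ∅              []      = + 1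
parity (cone _ l _ c) (a ∷ m) = sgnIf l a * parity c m

_⊕_ : ∀ {k} → Vec ℕ k → Vec ℕ k → Vec ℕ k
[]      ⊕ []      = []
(x ∷ v) ⊕ (y ∷ w) = (x +ℕ y) ∷ (v ⊕ w)

dot-⊕ : ∀ {k} (v w m : Vec ℕ k) → dot (v ⊕ w) m ≡ dot v m +ℕ dot w m
dot-⊕ []      []      []      = refl
dot-⊕ (x ∷ v) (y ∷ w) (a ∷ m) = trans (cong ((x +ℕ y) *ℕ a +ℕ_) (dot-⊕ v w m)) (ring x y a (dot v m) (dot w m))
  where
  ring : ∀ x y a p q → (x +ℕ y) *ℕ a +ℕ (p +ℕ q) ≡ (x *ℕ a +ℕ p) +ℕ (y *ℕ a +ℕ q)
  ring = ℕ-solve-∀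

-- Out of range it is the identity, so that any list of positions can be run through by `largest`.
swapV : ∀ {A : Set} {k} → ℕ → Vec A k → Vec A k
swapV zero    (x ∷ y ∷ v) = y ∷ x ∷ v
swapV (suc i) (x ∷ v)     = x ∷ swapV i v
swapV _       v           = v

swapC : ∀ {k} → ℕ → Cone k → Cone k
-- The coefficient x of the product of the two variables passes to the new first variable;
-- everything else stays with its own variable.
swapC zero    (cone s l (x ∷ v) (cone s′ l′ v′ c)) = cone s′ l′ (x ∷ v′) (cone s l v c)
swapC (suc i) (cone s l v c)                       = cone s l (swapV i v) (swapC i c)
swapC _       c                                    = c

dot-swap : ∀ {k} i (v m : Vec ℕ k) → dot (swapV i v) m ≡ dot v (swapV i m)
dot-swap zero    []          []          = refl
dot-swap zero    (x ∷ [])    (a ∷ [])    = refl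
dot-swap zero    (x ∷ y ∷ v) (a ∷ b ∷ m) = ring (y *ℕ a) (x *ℕ b) (dot v m)
  where
  ring : ∀ p q r → p +ℕ (q +ℕ r) ≡ q +ℕ (p +ℕ r)
  ring = ℕ-solve-∀
dot-swap (suc i) []          []          = refl
dot-swap (suc i) (x ∷ v)     (a ∷ m)     = cong (x *ℕ a +ℕ_) (dot-swap i v m)

val-swap : ∀ {k} i (c : Cone k) (m : Vec ℕ k) → val (swapC i c) m ≡ val c (swapV i m)
val-swap zero    ∅ [] = refl
val-swap zero    (cone s l [] ∅) (a ∷ []) = refl
val-swap zero    (cone s l (x ∷ v) (cone s′ l′ v′ c)) (a ∷ b ∷ m) =
  ring s x s′ a b (dot v m) (dot v′ m) (val c m)
  where
  ring : ∀ s x s′ a b p p′ r →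
    s′ *ℕ (a *ℕ a) +ℕ a *ℕ (x *ℕ b +ℕ p′) +ℕ (s *ℕ (b *ℕ b) +ℕ b *ℕ p +ℕ r) ≡
    s *ℕ (b *ℕ b) +ℕ b *ℕ (x *ℕ a +ℕ p) +ℕ (s′ *ℕ (a *ℕ a) +ℕ a *ℕ p′ +ℕ r)
  ring = ℕ-solve-∀
val-swap (suc i) ∅ [] = refl
val-swap (suc i) (cone s l v c) (a ∷ m) =
  cong₂ (λ d r → s *ℕ (a *ℕ a) +ℕ a *ℕ d +ℕ r) (dot-swap i v m) (val-swap i c m)

*-exchange : ∀ x y z → x * (y * z) ≡ y * (x * z)
*-exchange = solve-∀

parity-swap : ∀ {k} i (c : Cone k) (m : Vec ℕ k) → parity (swapC i c) m ≡ parity c (swapV i m)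
parity-swap zero    ∅ [] = refl
parity-swap zero    (cone s l [] ∅) (a ∷ []) = refl
parity-swap zero    (cone s l (x ∷ v) (cone s′ l′ v′ c)) (a ∷ b ∷ m) =
  *-exchange (sgnIf l′ a) (sgnIf l b) (parity c m)
parity-swap (suc i) ∅ [] = refl
parity-swap (suc i) (cone s l v c) (a ∷ m) = cong (sgnIf l a *_) (parity-swap i c m)

-- Every variable runs through 1, ..., B, and n is the value of q that is selected. For n ≤ B
-- nothing is lost: a variable above B that occurs in q makes q exceed n.
module Eval (B : ℕ) (n : ℤ) where

  ∑ⁿ : ∀ k → (Vec ℕ k → ℤ) → ℤ
  ∑ⁿ zero    f = f []
  ∑ⁿ (suc k) f = ∑ (rng B) (λ a → ∑ⁿ k (λ m → f (a ∷ m)))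

  ∑ⁿ-cong : ∀ k {f g : Vec ℕ k → ℤ} → (∀ m → f m ≡ g m) → ∑ⁿ k f ≡ ∑ⁿ k g
  ∑ⁿ-cong zero    eq = eq []
  ∑ⁿ-cong (suc k) eq = ∑-cong (rng B) (λ a → ∑ⁿ-cong k (λ m → eq (a ∷ m)))

  ∑ⁿ-+ : ∀ k (f g : Vec ℕ k → ℤ) → ∑ⁿ k (λ m → f m + g m) ≡ ∑ⁿ k f + ∑ⁿ k g
  ∑ⁿ-+ zero    f g = refl
  ∑ⁿ-+ (suc k) f g = trans (∑-cong (rng B) (λ a → ∑ⁿ-+ k _ _)) (∑-+ (rng B) _ _)

  ∑ⁿ-*ˡ : ∀ c k (f : Vec ℕ k → ℤ) → ∑ⁿ k (λ m → c * f m) ≡ c * ∑ⁿ k f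
  ∑ⁿ-*ˡ c zero    f = refl
  ∑ⁿ-*ˡ c (suc k) f = trans (∑-cong (rng B) (λ a → ∑ⁿ-*ˡ c k _)) (∑-*ˡ c (rng B) _)

  ∑ⁿ-∑ : ∀ (xs : List ℕ) k (f : ℕ → Vec ℕ k → ℤ) →
    ∑ xs (λ a → ∑ⁿ k (f a)) ≡ ∑ⁿ k (λ m → ∑ xs (λ a → f a m))
  ∑ⁿ-∑ xs zero    f = refl
  ∑ⁿ-∑ xs (suc k) f =
    trans (∑-swap xs (rng B) _) (∑-cong (rng B) (λ b → ∑ⁿ-∑ xs k (λ a m → f a (b ∷ m))))

  data Positive : ∀ {k} → Vec ℕ k → Set where
    []  : Positive []
    _∷_ : ∀ {k a} {m : Vec ℕ k} → 1 ≤ℕ a → Positive m → Positive (a ∷ m)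

  ∑ⁿ-zero : ∀ k {f : Vec ℕ k → ℤ} → (∀ {m} → Positive m → f m ≡ + 0) → ∑ⁿ k f ≡ + 0
  ∑ⁿ-zero zero    z = z []
  ∑ⁿ-zero (suc k) z =
    ∑-zero∈ (rng B) (λ a∈ → ∑ⁿ-zero k (λ pos → z (proj₁ (∈-rng⁻ B a∈) ∷ pos)))

  ∑ⁿ-swap : ∀ {k} i (f : Vec ℕ k → ℤ) → ∑ⁿ k (f ∘ swapV i) ≡ ∑ⁿ k f
  ∑ⁿ-swap {zero}        zero    f = refl
  ∑ⁿ-swap {suc zero}    zero    f = refl
  ∑ⁿ-swap {suc (suc k)} zero    f = ∑-swap (rng B) (rng B) (λ a b → ∑ⁿ k (λ m → f (b ∷ a ∷ m)))
  ∑ⁿ-swap {zero}        (suc i) f = refl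
  ∑ⁿ-swap {suc k}       (suc i) f = ∑-cong (rng B) (λ a → ∑ⁿ-swap i (λ m → f (a ∷ m)))

  term : ∀ {k} → Cone k → Vec ℕ k → ℤ
  term c m = 𝟙 (+ val c m ℤP.≟ n) * parity c m

  eval : ∀ {k} → Cone k → ℤ
  eval {k} c = ∑ⁿ k (term c)

  eval-swap : ∀ {k} i (c : Cone k) → eval (swapC i c) ≡ eval c
  eval-swap {k} i c = trans
    (∑ⁿ-cong k (λ m → cong₂ (λ x y → 𝟙 (+ x ℤP.≟ n) * y) (val-swap i c m) (parity-swap i c m)))
    (∑ⁿ-swap i (term c))

  term-large : n ≤ + B → ∀ {k} (c : Cone k) m → B <ℕ val c m → term c m ≡ + 0
  term-large n≤B c m lt = cong (_* parity c m)
    (𝟙-no (+ val c m ℤP.≟ n) (λ { refl → ℕP.<⇒≱ lt (ℤP.drop‿+≤+ n≤B) }))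

  total : ∀ {k} → Vec ℕ k → ℕ
  total []      = 0
  total (x ∷ v) = x +ℕ total v

  dot-≥total : ∀ {k} (v : Vec ℕ k) {m} → Positive m → total v ≤ℕ dot v m
  dot-≥total []      []        = z≤n
  dot-≥total (x ∷ v) {a ∷ m} (1≤a ∷ pos) =
    ℕP.+-mono-≤ (ℕP.≤-trans (ℕP.≤-reflexive (sym (ℕP.*-identityʳ x))) (ℕP.*-monoʳ-≤ x 1≤a)) (dot-≥total v pos)

  -- All variables are at least 1, so a single nonzero coefficient among s and v already contributes
  -- a.
  linear-≥ : ∀ {k} s (v : Vec ℕ k) {a m} → 1 ≤ℕ s +ℕ total v → 1 ≤ℕ a → Positive m →
    a ≤ℕ s *ℕ (a *ℕ a) +ℕ a *ℕ dot v m
  linear-≥ zero    v {a} {m} h 1≤a pos =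
    ℕP.≤-trans (ℕP.≤-reflexive (sym (ℕP.*-identityʳ a))) (ℕP.*-monoʳ-≤ a (ℕP.≤-trans h (dot-≥total v pos)))
  linear-≥ (suc s) v {a} {m} h 1≤a pos =
    ℕP.≤-trans (ℕP.≤-trans (ℕP.≤-reflexive (sym (ℕP.*-identityʳ a))) (ℕP.*-monoʳ-≤ a 1≤a))
      (ℕP.≤-trans (ℕP.m≤m+n (a *ℕ a) (s *ℕ (a *ℕ a))) (ℕP.m≤m+n _ (a *ℕ dot v m)))

  -- This is `∑-even` in the first variable. Replacing a by a + a multiplies its square by 4 and its
  -- mixed terms by 2, and makes its sign trivial.
  eval-double : n ≤ + B → ∀ {k} s (v : Vec ℕ k) c → 1 ≤ℕ s +ℕ total v →
    eval (cone s true v c) + eval (cone s false v c) ≡ + 2 * eval (cone (4 *ℕ s) false (v ⊕ v) c)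
  eval-double n≤B {k} s v c h = begin
    eval (cone s true v c) + eval (cone s false v c)
      ≡⟨ cong (λ z → z + eval (cone s false v c)) (∑-cong (rng B) (λ a →
           trans (∑ⁿ-cong k (λ m → pull (𝟙 (+ val (cone s true v c) (a ∷ m) ℤP.≟ n)) (sgn a) (parity c m)))
                 (∑ⁿ-*ˡ (sgn a) k (λ m → term (cone s false v c) (a ∷ m))))) ⟩
    ∑ (rng B) (λ a → sgn a * F a) + ∑ (rng B) F
      ≡⟨ ∑-even B {F} (λ a lt → ∑ⁿ-zero k (λ {m} pos → term-large n≤B (cone s false v c) (a ∷ m)
           (ℕP.<-≤-trans lt (ℕP.≤-trans (linear-≥ s v h (ℕP.≤-trans (s≤s z≤n) lt) pos) (ℕP.m≤m+n _ (val c m)))))) ⟩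
    + 2 * ∑ (rng B) (λ a → F (a +ℕ a))
      ≡⟨ cong (+ 2 *_) (∑-cong (rng B) (λ a → ∑ⁿ-cong k (λ m →
           cong (λ x → 𝟙 (+ x ℤP.≟ n) * (+ 1 * parity c m)) (dbl a m)))) ⟩
    + 2 * eval (cone (4 *ℕ s) false (v ⊕ v) c) ∎
    where
    F : ℕ → ℤ
    F a = ∑ⁿ k (λ m → term (cone s false v c) (a ∷ m))
    pull : ∀ i s p → i * (s * p) ≡ s * (i * (+ 1 * p))
    pull = solve-∀
    ring : ∀ s a d r → s *ℕ ((a +ℕ a) *ℕ (a +ℕ a)) +ℕ (a +ℕ a) *ℕ d +ℕ r ≡ 4 *ℕ s *ℕ (a *ℕ a) +ℕ a *ℕ (d +ℕ d) +ℕ r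
    ring = ℕ-solve-∀
    dbl : ∀ a m → val (cone s false v c) ((a +ℕ a) ∷ m) ≡ val (cone (4 *ℕ s) false (v ⊕ v) c) (a ∷ m)
    dbl a m = trans (ring s a (dot v m) (val c m))
      (cong (λ d → 4 *ℕ s *ℕ (a *ℕ a) +ℕ a *ℕ d +ℕ val c m) (sym (dot-⊕ v v m)))

-- The forms left by a > b, a < b and a = b: a + b is substituted for a, or for b, or b is set equal
-- to a. Signs multiply, whence `xor`.
sumFirst sumSecond diag : ∀ {k} → Cone (suc (suc k)) → Σ ℕ Cone
sumFirst  (cone s l (x ∷ v) (cone s′ l′ v′ c)) =
  _ , cone s l ((2 *ℕ s +ℕ x) ∷ v) (cone (s +ℕ x +ℕ s′) (l xor l′) (v ⊕ v′) c)
sumSecond (cone s l (x ∷ v) (cone s′ l′ v′ c)) =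
  _ , cone (s +ℕ x +ℕ s′) (l xor l′) ((x +ℕ 2 *ℕ s′) ∷ (v ⊕ v′)) (cone s′ l′ v′ c)
diag      (cone s l (x ∷ v) (cone s′ l′ v′ c)) =
  _ , cone (s +ℕ x +ℕ s′) (l xor l′) (v ⊕ v′) c

sgnIf-+ : ∀ l a b → sgnIf l (a +ℕ b) ≡ sgnIf l a * sgnIf l b
sgnIf-+ true  a b = sgn-+ a b
sgnIf-+ false a b = refl

sgnIf-xor : ∀ l l′ b → sgnIf (l xor l′) b ≡ sgnIf l b * sgnIf l′ b
sgnIf-xor true  true  b = sym (sgn² b)
sgnIf-xor true  false b = sym (ℤP.*-identityʳ (sgn b))
sgnIf-xor false l′    b = sym (ℤP.*-identityˡ (sgnIf l′ b))

module Split (B : ℕ) (n : ℤ) where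
  open Eval B n public

  evalΣ : Σ ℕ Cone → ℤ
  evalΣ (_ , c) = eval c

  -- The two inequalities say that each of the first two variables occurs in the form. Terms in
  -- which one of them exceeds B therefore vanish, as `∑-split` requires.
  eval-split : n ≤ + B → ∀ {k} s l x (v : Vec ℕ k) s′ l′ v′ c → let C = cone s l (x ∷ v) (cone s′ l′ v′ c) in
    1 ≤ℕ s +ℕ (x +ℕ total v) → 1 ≤ℕ s′ +ℕ (x +ℕ total v′) →
    eval C ≡ (evalΣ (sumFirst C) + evalΣ (sumSecond C)) + evalΣ (diag C)
  eval-split n≤B {k} s l x v s′ l′ v′ c h h′ = trans (∑-split B f vanish) (cong₂ _+_ (cong₂ _+_
      (∑-cong (rng B) (λ a → ∑-cong (rng B) (λ b → ∑ⁿ-cong k (λ m → same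
        (trans (ring₁ s x s′ a b (dot v m) (dot v′ m) (val c m)) (cong (λ d → s *ℕ (a *ℕ a) +ℕ a *ℕ ((2 *ℕ s +ℕ x) *ℕ b +ℕ dot v m) +ℕ ((s +ℕ x +ℕ s′) *ℕ (b *ℕ b) +ℕ b *ℕ d +ℕ val c m)) (sym (dot-⊕ v v′ m))))
        (trans (cong (_* (sgnIf l′ b * parity c m)) (sgnIf-+ l a b))
          (trans (assoc₁ (sgnIf l a) (sgnIf l b) (sgnIf l′ b) (parity c m))
            (cong (λ t → sgnIf l a * (t * parity c m)) (sym (sgnIf-xor l l′ b)))))))))
      (∑-cong (rng B) (λ a → ∑-cong (rng B) (λ b → ∑ⁿ-cong k (λ m → same
        (trans (ring₂ s x s′ a b (dot v m) (dot v′ m) (val c m)) (cong (λ d → (s +ℕ x +ℕ s′) *ℕ (a *ℕ a) +ℕ a *ℕ ((x +ℕ 2 *ℕ s′) *ℕ b +ℕ d) +ℕ (s′ *ℕ (b *ℕ b) +ℕ b *ℕ dot v′ m +ℕ val c m)) (sym (dot-⊕ v v′ m))))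
        (trans (cong (λ t → sgnIf l a * (t * parity c m)) (sgnIf-+ l′ a b))
          (trans (assoc₂ (sgnIf l a) (sgnIf l′ a) (sgnIf l′ b) (parity c m))
            (cong (_* (sgnIf l′ b * parity c m)) (sym (sgnIf-xor l l′ a))))))))))
      (∑-cong (rng B) (λ a → ∑ⁿ-cong k (λ m → same
        (trans (ring₃ s x s′ a (dot v m) (dot v′ m) (val c m)) (cong (λ d → (s +ℕ x +ℕ s′) *ℕ (a *ℕ a) +ℕ a *ℕ d +ℕ val c m) (sym (dot-⊕ v v′ m))))
        (trans (sym (ℤP.*-assoc (sgnIf l a) (sgnIf l′ a) (parity c m)))
          (cong (_* parity c m) (sym (sgnIf-xor l l′ a))))))))
    where
    C = cone s l (x ∷ v) (cone s′ l′ v′ c)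
    f : ℕ → ℕ → ℤ
    f a b = ∑ⁿ k (λ m → term C (a ∷ b ∷ m))
    same : ∀ {i j : ℕ} {p q : ℤ} → i ≡ j → p ≡ q → 𝟙 (+ i ℤP.≟ n) * p ≡ 𝟙 (+ j ℤP.≟ n) * q
    same refl refl = refl
    assoc₁ : ∀ p q r t → (p * q) * (r * t) ≡ p * ((q * r) * t)
    assoc₁ = solve-∀
    assoc₂ : ∀ p q r t → p * ((q * r) * t) ≡ (p * q) * (r * t)
    assoc₂ = solve-∀
    ring₁ : ∀ s x s′ a b p q r →
      s *ℕ ((a +ℕ b) *ℕ (a +ℕ b)) +ℕ (a +ℕ b) *ℕ (x *ℕ b +ℕ p) +ℕ (s′ *ℕ (b *ℕ b) +ℕ b *ℕ q +ℕ r) ≡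
      s *ℕ (a *ℕ a) +ℕ a *ℕ ((2 *ℕ s +ℕ x) *ℕ b +ℕ p) +ℕ ((s +ℕ x +ℕ s′) *ℕ (b *ℕ b) +ℕ b *ℕ (p +ℕ q) +ℕ r)
    ring₁ = ℕ-solve-∀
    ring₂ : ∀ s x s′ a b p q r →
      s *ℕ (a *ℕ a) +ℕ a *ℕ (x *ℕ (a +ℕ b) +ℕ p) +ℕ (s′ *ℕ ((a +ℕ b) *ℕ (a +ℕ b)) +ℕ (a +ℕ b) *ℕ q +ℕ r) ≡
      (s +ℕ x +ℕ s′) *ℕ (a *ℕ a) +ℕ a *ℕ ((x +ℕ 2 *ℕ s′) *ℕ b +ℕ (p +ℕ q)) +ℕ (s′ *ℕ (b *ℕ b) +ℕ b *ℕ q +ℕ r)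
    ring₂ = ℕ-solve-∀
    ring₃ : ∀ s x s′ a p q r →
      s *ℕ (a *ℕ a) +ℕ a *ℕ (x *ℕ a +ℕ p) +ℕ (s′ *ℕ (a *ℕ a) +ℕ a *ℕ q +ℕ r) ≡
      (s +ℕ x +ℕ s′) *ℕ (a *ℕ a) +ℕ a *ℕ (p +ℕ q) +ℕ r
    ring₃ = ℕ-solve-∀
    second-≥ : ∀ {a b m} → 1 ≤ℕ a → 1 ≤ℕ b → Positive m → b ≤ℕ val C (a ∷ b ∷ m)
    second-≥ {a} {b} {m} 1≤a 1≤b pos =
      ℕP.≤-trans (linear-≥ s′ (x ∷ v′) h′ 1≤b (1≤a ∷ pos))
        (ℕP.≤-trans (ℕP.m≤m+n _ (s *ℕ (a *ℕ a) +ℕ a *ℕ dot v m +ℕ val c m))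
          (ℕP.≤-reflexive (ring s x s′ a b (dot v m) (dot v′ m) (val c m))))
      where
      ring : ∀ s x s′ a b p q r →
        s′ *ℕ (b *ℕ b) +ℕ b *ℕ (x *ℕ a +ℕ q) +ℕ (s *ℕ (a *ℕ a) +ℕ a *ℕ p +ℕ r) ≡
        s *ℕ (a *ℕ a) +ℕ a *ℕ (x *ℕ b +ℕ p) +ℕ (s′ *ℕ (b *ℕ b) +ℕ b *ℕ q +ℕ r)
      ring = ℕ-solve-∀
    vanish : ∀ {a b} → 1 ≤ℕ a → 1 ≤ℕ b → B <ℕ a ⊎ B <ℕ b → f a b ≡ + 0
    vanish {a} {b} 1≤a 1≤b big = ∑ⁿ-zero k (λ {m} pos → term-large n≤B C (a ∷ b ∷ m) (large big pos))
      where
      large : B <ℕ a ⊎ B <ℕ b → ∀ {m} → Positive m → B <ℕ val C (a ∷ b ∷ m)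
      large (inj₁ lt) {m} pos = ℕP.<-≤-trans lt
        (ℕP.≤-trans (linear-≥ s (x ∷ v) h 1≤a (1≤b ∷ pos)) (ℕP.m≤m+n _ (val (cone s′ l′ v′ c) (b ∷ m))))
      large (inj₂ lt)     pos = ℕP.<-≤-trans lt (second-≥ 1≤a 1≤b pos)

-- A relation between cone sums: either the first two variables a, b are compared
-- (a > b, a < b, a = b), or the first variable is restricted to even values.
data Relation : Set where
  split  : ∀ {k} → ℕ → Bool → ℕ → Vec ℕ k → ℕ → Bool → Vec ℕ k → Cone k → Relation
  double : ∀ {k} → ℕ → Vec ℕ k → Cone k → Relation

Combination : Set
Combination = List (ℤ × Σ ℕ Cone)

relation : Relation → Combination
relation (split s l x v s′ l′ v′ c) = let C = cone s l (x ∷ v) (cone s′ l′ v′ c) in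
  (+ 1 , _ , C) ∷ (- + 1 , sumFirst C) ∷ (- + 1 , sumSecond C) ∷ (- + 1 , diag C) ∷ []
relation (double s v c) =
  (+ 1 , _ , cone s true v c) ∷ (+ 1 , _ , cone s false v c) ∷ (- + 2 , _ , cone (4 *ℕ s) false (v ⊕ v) c) ∷ []

nonzero : ℕ → Bool
nonzero zero    = false
nonzero (suc _) = true

totalV : ∀ {k} → Vec ℕ k → ℕ
totalV []      = 0
totalV (x ∷ v) = x +ℕ totalV v

-- Every variable that is split or doubled occurs in the quadratic form, so the sums are finite.
bounded : Relation → Bool
bounded (split s l x v s′ l′ v′ c) = nonzero (s +ℕ (x +ℕ totalV v)) ∧ nonzero (s′ +ℕ (x +ℕ totalV v′))
bounded (double s v c)             = nonzero (s +ℕ totalV v)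

scale : ℤ → Combination → Combination
scale z = map (λ t → z * proj₁ t , proj₂ t)

flatten : ∀ {k} → Cone k → List ℕ
flatten ∅              = []
flatten (cone s l v c) = s ∷ (if l then 1 else 0) ∷ (toL v ++ flatten c)
  where
  toL : ∀ {k} → Vec ℕ k → List ℕ
  toL []      = []
  toL (x ∷ v) = x ∷ toL v

_<lex_ : List ℕ → List ℕ → Bool
[]       <lex _        = false
(_ ∷ _)  <lex []       = false
(x ∷ xs) <lex (y ∷ ys) = if x <ᵇ y then true else if y <ᵇ x then false else xs <lex ys

-- Adjacent transpositions running through all orders of up to four variables.
transpositions : ℕ → List ℕ
transpositions 2 = 0 ∷ []
transpositions 3 = 0 ∷ 1 ∷ 0 ∷ 1 ∷ 0 ∷ []
transpositions 4 = 2 ∷ 1 ∷ 0 ∷ 2 ∷ 0 ∷ 1 ∷ 2 ∷ 0 ∷ 2 ∷ 1 ∷ 0 ∷ 2 ∷ 0 ∷ 1 ∷ 2 ∷ 0 ∷ 2 ∷ 1 ∷ 0 ∷ 2 ∷ 0 ∷ 1 ∷ 2 ∷ []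
transpositions _ = []

-- The lexicographically largest reordering serves as a normal form, so that equal sums that name
-- their variables in different orders are merged by `collect`.
largest : ∀ {k} → List ℕ → Cone k → Cone k → Cone k
largest []       cur best = best
largest (i ∷ is) cur best =
  largest is (swapC i cur) (if flatten best <lex flatten (swapC i cur) then swapC i cur else best)

normal : Σ ℕ Cone → Σ ℕ Cone
normal (k , c) = k , largest (transpositions k) c c

_≟C_ : ∀ {k} (c c′ : Cone k) → Dec (c ≡ c′)
∅ ≟C ∅ = yes refl
cone s l v c ≟C cone s′ l′ v′ c′ with s ℕP.≟ s′ | l BoolP.≟ l′ | VecP.≡-dec ℕP._≟_ v v′ | c ≟C c′
... | yes refl | yes refl | yes refl | yes refl = yes refl
... | no ne    | _        | _        | _        = no λ { refl → ne refl }
... | yes _    | no ne    | _        | _        = no λ { refl → ne refl }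
... | yes _    | yes _    | no ne    | _        = no λ { refl → ne refl }
... | yes _    | yes _    | yes _    | no ne    = no λ { refl → ne refl }

_≟Σ_ : (x y : Σ ℕ Cone) → Dec (x ≡ y)
(k , c) ≟Σ (k′ , c′) with k ℕP.≟ k′
... | no ne    = no λ { refl → ne refl }
... | yes refl with c ≟C c′
...   | yes refl = yes refl
...   | no ne    = no λ { refl → ne refl }

insert : ℤ → Σ ℕ Cone → Combination → Combination
insert z c [] = (z , c) ∷ []
insert z c ((z′ , c′) ∷ ts) with c ≟Σ c′
... | yes _ = (z + z′ , c′) ∷ ts
... | no _  = (z′ , c′) ∷ insert z c ts

collect : Combination → Combination
collect []             = []
collect ((z , c) ∷ ts) = insert z (normal c) (collect ts)

vanishes : Combination → Bool
vanishes []                  = true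
vanishes ((+ 0 , _) ∷ ts)    = vanishes ts
vanishes (_ ∷ ts)            = false

certified : List (ℤ × Relation) → Bool
certified []              = true
certified ((_ , r) ∷ rs)  = bounded r ∧ certified rs

expand : List (ℤ × Relation) → Combination
expand = concatMap (λ zr → scale (proj₁ zr) (relation (proj₂ zr)))

∧-true : ∀ {a b} → a ∧ b ≡ true → a ≡ true × b ≡ true
∧-true {true} {true} _ = refl , refl

nonzero-≥ : ∀ {m} → nonzero m ≡ true → 1 ≤ℕ m
nonzero-≥ {suc _} _ = s≤s z≤n

module Combine (B : ℕ) (n : ℤ) where
  open Split B n public

  value : Combination → ℤ
  value ts = ∑ ts (λ t → proj₁ t * evalΣ (proj₂ t))

  totalV≡ : ∀ {k} (v : Vec ℕ k) → totalV v ≡ total v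
  totalV≡ []      = refl
  totalV≡ (x ∷ v) = cong (x +ℕ_) (totalV≡ v)

  relation-zero : n ≤ + B → ∀ r → bounded r ≡ true → value (relation r) ≡ + 0
  relation-zero n≤B (split s l x v s′ l′ v′ c) ok rewrite totalV≡ v | totalV≡ v′ =
    let h , h′ = ∧-true ok
        C = cone s l (x ∷ v) (cone s′ l′ v′ c) in
    cancel (eval C) (evalΣ (sumFirst C)) (evalΣ (sumSecond C)) (evalΣ (diag C))
      (eval-split n≤B s l x v s′ l′ v′ c (nonzero-≥ h) (nonzero-≥ h′))
    where
    ring : ∀ e₁ e₂ e₃ → + 1 * ((e₁ + e₂) + e₃) + (- + 1 * e₁ + (- + 1 * e₂ + (- + 1 * e₃ + + 0))) ≡ + 0
    ring = solve-∀
    cancel : ∀ e e₁ e₂ e₃ → e ≡ (e₁ + e₂) + e₃ → + 1 * e + (- + 1 * e₁ + (- + 1 * e₂ + (- + 1 * e₃ + + 0))) ≡ + 0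
    cancel _ e₁ e₂ e₃ refl = ring e₁ e₂ e₃
  relation-zero n≤B (double s v c) ok rewrite totalV≡ v =
    cancel (eval (cone s true v c)) (eval (cone s false v c)) (eval (cone (4 *ℕ s) false (v ⊕ v) c))
      (eval-double n≤B s v c (nonzero-≥ ok))
    where
    assoc : ∀ x y z → + 1 * x + (+ 1 * y + (- + 2 * z + + 0)) ≡ (x + y) + - + 2 * z
    assoc = solve-∀
    ring : ∀ z → + 2 * z + - + 2 * z ≡ + 0
    ring = solve-∀
    cancel : ∀ x y z → x + y ≡ + 2 * z → + 1 * x + (+ 1 * y + (- + 2 * z + + 0)) ≡ + 0
    cancel x y z eq = trans (assoc x y z) (trans (cong (λ t → t + - + 2 * z) eq) (ring z))

  value-scale : ∀ z ts → value (scale z ts) ≡ z * value ts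
  value-scale z ts = trans (∑-map _ ts _) (trans (∑-cong ts (λ t → ℤP.*-assoc z (proj₁ t) (evalΣ (proj₂ t)))) (∑-*ˡ z ts _))

  expand-zero : n ≤ + B → ∀ rs → certified rs ≡ true → value (expand rs) ≡ + 0
  expand-zero n≤B []             ok = refl
  expand-zero n≤B ((z , r) ∷ rs) ok = let h , h′ = ∧-true ok in
    trans (∑-++ (scale z (relation r)) (expand rs) _)
      (cong₂ _+_ (trans (value-scale z (relation r)) (trans (cong (z *_) (relation-zero n≤B r h)) (ℤP.*-zeroʳ z))) (expand-zero n≤B rs h′))

  -- Exchanging variables preserves the value, so the current and the best cone always agree in
  -- value and the comparison selects among equals.
  eval-largest : ∀ {k} is (cur best : Cone k) → eval cur ≡ eval best → eval (largest is cur best) ≡ eval best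
  eval-largest []       cur best eq = refl
  eval-largest (i ∷ is) cur best eq with flatten best <lex flatten (swapC i cur)
  ... | true  = trans (eval-largest is (swapC i cur) (swapC i cur) refl) (trans (eval-swap i cur) eq)
  ... | false = eval-largest is (swapC i cur) best (trans (eval-swap i cur) eq)

  eval-normal : ∀ c → evalΣ (normal c) ≡ evalΣ c
  eval-normal (k , c) = eval-largest (transpositions k) c c refl

  value-insert : ∀ z c ts → value (insert z c ts) ≡ z * evalΣ c + value ts
  value-insert z c [] = refl
  value-insert z c ((z′ , c′) ∷ ts) with c ≟Σ c′
  ... | yes refl = ring z z′ (evalΣ c) (value ts)
    where
    ring : ∀ z z′ e r → (z + z′) * e + r ≡ z * e + (z′ * e + r)
    ring = solve-∀
  ... | no _     = trans (cong (_+_ (z′ * evalΣ c′)) (value-insert z c ts)) (ring (z * evalΣ c) (z′ * evalΣ c′) (value ts))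
    where
    ring : ∀ x y r → y + (x + r) ≡ x + (y + r)
    ring = solve-∀

  value-collect : ∀ ts → value (collect ts) ≡ value ts
  value-collect []             = refl
  value-collect ((z , c) ∷ ts) =
    trans (value-insert z (normal c) (collect ts)) (cong₂ (λ e r → z * e + r) (eval-normal c) (value-collect ts))

  value-vanishes : ∀ ts → vanishes ts ≡ true → value ts ≡ + 0
  value-vanishes []                 ok = refl
  value-vanishes ((+ 0 , _) ∷ ts)   ok = trans (ℤP.+-identityˡ _) (value-vanishes ts ok)

  -- Proof by reflection: the expanded relations have value 0, so they may be added to `ts`, and
  -- after normalisation the coefficients cancel by computation.
  by-certificate : n ≤ + B → ∀ rs ts → certified rs ≡ true → vanishes (collect (ts ++ expand rs)) ≡ true → value ts ≡ + 0
  by-certificate n≤B rs ts ok van = begin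
    value ts                      ≡⟨ sym (ℤP.+-identityʳ _) ⟩
    value ts + + 0                ≡⟨ cong (_+_ (value ts)) (sym (expand-zero n≤B rs ok)) ⟩
    value ts + value (expand rs)  ≡⟨ sym (∑-++ ts (expand rs) _) ⟩
    value (ts ++ expand rs)       ≡⟨ sym (value-collect (ts ++ expand rs)) ⟩
    value (collect (ts ++ expand rs)) ≡⟨ value-vanishes (collect (ts ++ expand rs)) van ⟩
    + 0 ∎

-- In all six sums every variable carries its sign. In `zx+zy` the first variable is z, and the
-- product xy has coefficient 0.
k²+xy+yz+zx xy+yz+zx k²+xy xy zx+zy k² : Σ ℕ Cone
k²+xy+yz+zx = _ , cone 1 true (0 ∷ 0 ∷ 0 ∷ []) (cone 0 true (1 ∷ 1 ∷ []) (cone 0 true (1 ∷ []) (cone 0 true [] ∅)))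
xy+yz+zx    = _ , cone 0 true (1 ∷ 1 ∷ []) (cone 0 true (1 ∷ []) (cone 0 true [] ∅))
k²+xy       = _ , cone 1 true (0 ∷ 0 ∷ []) (cone 0 true (1 ∷ []) (cone 0 true [] ∅))
xy          = _ , cone 0 true (1 ∷ []) (cone 0 true [] ∅)
zx+zy       = _ , cone 0 true (1 ∷ 1 ∷ []) (cone 0 true (0 ∷ []) (cone 0 true [] ∅))
k²          = _ , cone 1 true [] ∅

-- The coefficients are those of -(θP - J) / 2 for the series P = δ₀ - 4 `xy+yz+zx` - 6 `xy` and J =
-- δ₀ - 8 (`zx+zy` + `xy`), after θ is written as 1 plus twice its part with k > 0.
classRelation : Combination
classRelation =
  (+ 4 , k²+xy+yz+zx) ∷ (+ 2 , xy+yz+zx) ∷ (+ 6 , k²+xy) ∷ (- + 1 , xy) ∷ (- + 4 , zx+zy) ∷ (- + 1 , k²) ∷ []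

-- Found by linear algebra over all splittings and doublings of forms with small coefficients.
certificate : List (ℤ × Relation)
certificate =
  (- + 8 , split 0 true 0 (2 ∷ 1 ∷ []) 1 true (0 ∷ 0 ∷ []) (cone 1 false (1 ∷ []) (cone 0 true [] ∅))) ∷
  (+ 8 , split 0 false 0 (2 ∷ 0 ∷ []) 1 false (0 ∷ 1 ∷ []) (cone 1 true (0 ∷ []) (cone 0 true [] ∅))) ∷
  (+ 8 , split 1 false 0 (1 ∷ 0 ∷ []) 0 false (0 ∷ 2 ∷ []) (cone 0 true (1 ∷ []) (cone 0 true [] ∅))) ∷
  (- + 4 , double 0 (1 ∷ 0 ∷ 0 ∷ []) (cone 1 true (2 ∷ 0 ∷ []) (cone 1 false (1 ∷ []) (cone 0 true [] ∅)))) ∷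
  (- + 4 , split 0 true 1 (1 ∷ 0 ∷ []) 0 true (1 ∷ 0 ∷ []) (cone 0 true (2 ∷ []) (cone 0 false [] ∅))) ∷
  (+ 4 , split 0 true 0 (1 ∷ 0 ∷ []) 0 true (0 ∷ 1 ∷ []) (cone 1 true (2 ∷ []) (cone 1 false [] ∅))) ∷
  (- + 4 , split 1 true 0 (1 ∷ 0 ∷ []) 0 true (0 ∷ 1 ∷ []) (cone 0 false (0 ∷ []) (cone 0 true [] ∅))) ∷
  (- + 4 , split 1 false 0 (1 ∷ 0 ∷ []) 0 true (0 ∷ 1 ∷ []) (cone 0 false (0 ∷ []) (cone 0 true [] ∅))) ∷
  (+ 4 , split 0 false 0 (1 ∷ 0 ∷ []) 0 true (0 ∷ 1 ∷ []) (cone 1 true (2 ∷ []) (cone 1 false [] ∅))) ∷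
  (- + 4 , split 1 true 0 (1 ∷ 0 ∷ []) 0 true (0 ∷ 1 ∷ []) (cone 0 true (0 ∷ []) (cone 0 true [] ∅))) ∷
  (- + 2 , split 0 true 1 (1 ∷ 0 ∷ []) 0 true (1 ∷ 0 ∷ []) (cone 1 true (1 ∷ []) (cone 0 false [] ∅))) ∷
  (- + 4 , split 0 true 1 (0 ∷ 1 ∷ []) 0 true (0 ∷ 1 ∷ []) (cone 1 true (0 ∷ []) (cone 0 true [] ∅))) ∷
  (- + 2 , double 0 (1 ∷ 0 ∷ 0 ∷ []) (cone 0 true (1 ∷ 1 ∷ []) (cone 0 true (1 ∷ []) (cone 0 true [] ∅)))) ∷
  (+ 4 , split 0 true 1 (0 ∷ 0 ∷ []) 0 true (0 ∷ 0 ∷ []) (cone 1 true (2 ∷ []) (cone 0 false [] ∅))) ∷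
  (+ 4 , double 0 (0 ∷ 0 ∷ 1 ∷ []) (cone 1 false (1 ∷ 0 ∷ []) (cone 0 true (1 ∷ []) (cone 0 true [] ∅)))) ∷
  (- + 2 , split 0 false 0 (1 ∷ 0 ∷ []) 0 true (0 ∷ 1 ∷ []) (cone 1 true (1 ∷ []) (cone 0 true [] ∅))) ∷
  (+ 2 , split 0 true 1 (1 ∷ 0 ∷ []) 0 false (0 ∷ 0 ∷ []) (cone 0 true (1 ∷ []) (cone 0 true [] ∅))) ∷
  (+ 4 , split 0 false 0 (1 ∷ 0 ∷ []) 0 true (0 ∷ 1 ∷ []) (cone 1 false (0 ∷ []) (cone 0 true [] ∅))) ∷
  (- + 2 , split 0 true 0 (1 ∷ 0 ∷ []) 0 false (0 ∷ 1 ∷ []) (cone 0 true (1 ∷ []) (cone 0 true [] ∅))) ∷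
  (+ 4 , split 0 true 0 (1 ∷ 0 ∷ []) 0 false (0 ∷ 1 ∷ []) (cone 1 false (0 ∷ []) (cone 0 true [] ∅))) ∷
  (+ 2 , double 0 (1 ∷ 0 ∷ 0 ∷ []) (cone 1 true (0 ∷ 0 ∷ []) (cone 0 true (1 ∷ []) (cone 0 true [] ∅)))) ∷
  (- + 2 , split 0 true 1 (0 ∷ 0 ∷ []) 0 false (0 ∷ 0 ∷ []) (cone 0 true (1 ∷ []) (cone 0 true [] ∅))) ∷
  (+ 2 , split 0 true 1 (0 ∷ 0 ∷ []) 0 true (0 ∷ 0 ∷ []) (cone 0 true (1 ∷ []) (cone 0 false [] ∅))) ∷
  (- + 4 , split 0 true 1 (1 ∷ []) 0 false (1 ∷ []) (cone 1 false [] ∅)) ∷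
  (+ 4 , split 0 true 1 (1 ∷ []) 0 true (1 ∷ []) (cone 1 false [] ∅)) ∷
  (- + 4 , split 0 true 1 (1 ∷ []) 0 true (1 ∷ []) (cone 0 true [] ∅)) ∷
  (- + 8 , split 1 true 0 (0 ∷ []) 0 true (1 ∷ []) (cone 0 true [] ∅)) ∷
  (- + 2 , double 0 (1 ∷ 0 ∷ []) (cone 1 true (2 ∷ []) (cone 1 false [] ∅))) ∷
  (- + 2 , split 1 false 0 (0 ∷ []) 0 true (1 ∷ []) (cone 0 true [] ∅)) ∷
  (- + 4 , split 0 true 0 (2 ∷ []) 1 true (0 ∷ []) (cone 1 false [] ∅)) ∷
  (+ 4 , split 0 false 0 (2 ∷ []) 1 false (0 ∷ []) (cone 1 true [] ∅)) ∷
  (+ 4 , split 1 false 0 (0 ∷ []) 0 false (2 ∷ []) (cone 0 true [] ∅)) ∷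
  (+ 4 , split 0 true 1 (1 ∷ []) 0 true (0 ∷ []) (cone 0 true [] ∅)) ∷
  (- + 4 , split 0 true 1 (1 ∷ []) 0 true (0 ∷ []) (cone 0 false [] ∅)) ∷
  (+ 2 , split 0 true 1 (1 ∷ []) 0 false (0 ∷ []) (cone 0 true [] ∅)) ∷
  (- + 8 , double 0 (1 ∷ 0 ∷ []) (cone 1 false (1 ∷ []) (cone 0 true [] ∅))) ∷
  (+ 8 , split 0 true 0 (1 ∷ []) 0 true (1 ∷ []) (cone 1 false [] ∅)) ∷
  (+ 2 , split 0 false 0 (1 ∷ []) 0 false (1 ∷ []) (cone 1 true [] ∅)) ∷
  (- + 2 , double 0 (1 ∷ 0 ∷ []) (cone 1 true (1 ∷ []) (cone 0 false [] ∅))) ∷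
  (+ 2 , double 0 (0 ∷ 1 ∷ []) (cone 1 false (0 ∷ []) (cone 0 true [] ∅))) ∷
  (+ 2 , double 0 (1 ∷ 0 ∷ []) (cone 0 true (1 ∷ []) (cone 0 true [] ∅))) ∷
  (- + 2 , split 0 true 0 (1 ∷ []) 0 true (1 ∷ []) (cone 0 true [] ∅)) ∷
  (- + 4 , double 0 (1 ∷ []) (cone 1 false [] ∅)) ∷
  (- + 1 , double 0 (1 ∷ []) (cone 1 true [] ∅)) ∷
  (- + 1 , split 0 true 1 [] 0 false [] ∅) ∷
  (+ 1 , double 0 (1 ∷ []) (cone 0 true [] ∅)) ∷
  []

classRelation-zero : ∀ B n → n ≤ + B → Combine.value B n classRelation ≡ + 0
-- The two `refl` carry the computation: every variable used is bounded, and all coefficients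
-- cancel.
classRelation-zero B n n≤B = Combine.by-certificate B n n≤B certificate classRelation refl refl

-- Integer intervals and the operators of theta

∈-intRange⁻ : ∀ B {k} → k ∈ intRange B → ∣ k ∣ ≤ℕ B
∈-intRange⁻ B k∈ with i , i∈ , refl ← ∈P.∈-map⁻ (λ i → + i - + B) k∈ =
  bound (ℕP.≤-pred (∈P.∈-upTo⁻ i∈))
  where
  bound : ∀ {i} → i ≤ℕ B +ℕ (B +ℕ 0) → ∣ + i - + B ∣ ≤ℕ B
  bound {i} le rewrite ℤP.m-n≡m⊖n i B with ℕP.≤-total B i
  ... | inj₁ B≤i rewrite ℤP.⊖-≥ B≤i =
    ℕP.m≤n+o⇒m∸n≤o i B (ℕP.≤-trans le (ℕP.≤-reflexive (cong (B +ℕ_) (ℕP.+-identityʳ B))))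
  ... | inj₂ i≤B rewrite ℤP.∣⊖∣-≤ i≤B = ℕP.m∸n≤m B i

∈-intRange⁺ : ∀ B {k} → ∣ k ∣ ≤ℕ B → k ∈ intRange B
∈-intRange⁺ B {+ k} le = subst (_∈ intRange B) eq
  (∈P.∈-map⁺ (λ i → + i - + B) (∈P.∈-upTo⁺ {i = k +ℕ B} (s≤s (ℕP.+-mono-≤ le (ℕP.m≤m+n B 0)))))
  where
  ring : ∀ x y → (x + y) - y ≡ x
  ring = solve-∀
  eq : + (k +ℕ B) - + B ≡ + k
  eq = trans (cong (_- + B) (ℤP.pos-+ k B)) (ring (+ k) (+ B))
∈-intRange⁺ B { -[1+ k ]} le = subst (_∈ intRange B) eq
  (∈P.∈-map⁺ (λ i → + i - + B) (∈P.∈-upTo⁺ {i = B ∸ℕ suc k} (s≤s (ℕP.≤-trans (ℕP.m∸n≤m B (suc k)) (ℕP.m≤m+n B (B +ℕ 0))))))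
  where
  ring : ∀ x y → x - (x + y) ≡ - y
  ring = solve-∀
  eq : + (B ∸ℕ suc k) - + B ≡ -[1+ k ]
  eq = trans (cong (λ b → + (B ∸ℕ suc k) - b) (trans (cong +_ (sym (ℕP.m∸n+n≡m le))) (ℤP.pos-+ (B ∸ℕ suc k) (suc k))))
    (ring (+ (B ∸ℕ suc k)) (+ suc k))

intRange-unique : ∀ B → Unique (intRange B)
intRange-unique B = UniqueP.map⁺ (λ {i} {j} eq → ℤP.+-injective (cancel (+ i) (+ j) eq)) (UniqueP.upTo⁺ (suc (2 *ℕ B)))
  where
  cancel : ∀ x y → x - + B ≡ y - + B → x ≡ y
  cancel x y eq = trans (sym (back x (+ B))) (trans (cong (λ t → t + + B) eq) (back y (+ B)))
    where
    back : ∀ x b → (x - b) + b ≡ x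
    back = solve-∀

∑-single : {xs : List A} {x₀ : A} {f : A → ℤ} → Unique xs → x₀ ∈ xs →
  (∀ {x} → x ∈ xs → x ≢ x₀ → f x ≡ + 0) → ∑ xs f ≡ f x₀
∑-single {xs = x ∷ xs} {f = f} (x∉ ∷ u) (here refl) z =
  trans (cong (_+_ (f x)) (∑-zero∈ xs (λ y∈ → z (there y∈) (λ eq → All.lookup x∉ y∈ (sym eq))))) (ℤP.+-identityʳ _)
∑-single {xs = x ∷ xs} {f = f} (x∉ ∷ u) (there x₀∈) z =
  trans (cong₂ _+_ (z (here refl) (All.lookup x∉ x₀∈)) (∑-single {f = f} u x₀∈ (z ∘ there))) (ℤP.+-identityˡ _)

neg+ : ℕ → ℤ
neg+ k = - + k

∑-intRange : ∀ B (f : ℤ → ℤ) → ∑ (intRange B) f ≡ f (+ 0) + (∑ (rng B) (f ∘ +_) + ∑ (rng B) (f ∘ neg+))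
∑-intRange B f = begin
  ∑ (intRange B) f
    ≡⟨ ∑-↭ (∼bag⇒↭ (unique∧set⇒bag (intRange-unique B) unique (mk⇔ to from))) f ⟩
  f (+ 0) + ∑ (map +_ (rng B) ++ map neg+ (rng B)) f
    ≡⟨ cong (_+_ (f (+ 0))) (trans (∑-++ (map +_ (rng B)) _ f) (cong₂ _+_ (∑-map +_ (rng B) f) (∑-map neg+ (rng B) f))) ⟩
  f (+ 0) + (∑ (rng B) (f ∘ +_) + ∑ (rng B) (f ∘ neg+)) ∎
  where
  list : List ℤ
  list = + 0 ∷ (map +_ (rng B) ++ map neg+ (rng B))
  disj : ∀ {k} → (k ∈ map +_ (rng B) × k ∈ map neg+ (rng B)) → ⊥
  disj (p , q) with i , i∈ , refl ← ∈P.∈-map⁻ +_ p | ∈P.∈-map⁻ neg+ q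
  ... | suc j , j∈ , ()
  ... | zero  , j∈ , _ = ℕP.<⇒≱ (proj₁ (∈-rng⁻ B j∈)) z≤n
  unique : Unique list
  unique = All.tabulate nz ∷
    UniqueP.++⁺ (UniqueP.map⁺ ℤP.+-injective (rng-unique B))
                (UniqueP.map⁺ (λ eq → ℤP.+-injective (ℤP.neg-injective eq)) (rng-unique B)) disj
    where
    nz : ∀ {k} → k ∈ map +_ (rng B) ++ map neg+ (rng B) → + 0 ≢ k
    nz k∈ eq with ∈P.∈-++⁻ (map +_ (rng B)) k∈
    nz k∈ eq | inj₁ p with ∈P.∈-map⁻ +_ p
    ... | suc i , i∈ , refl = case eq of λ ()
    ... | zero  , i∈ , refl = ℕP.<⇒≱ (proj₁ (∈-rng⁻ B i∈)) z≤n
    nz k∈ eq | inj₂ p with ∈P.∈-map⁻ neg+ p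
    ... | suc i , i∈ , refl = case eq of λ ()
    ... | zero  , i∈ , refl = ℕP.<⇒≱ (proj₁ (∈-rng⁻ B i∈)) z≤n
  to : ∀ {k} → k ∈ intRange B → k ∈ list
  to {k} k∈ with k | ∈-intRange⁻ B k∈
  ... | + 0       | le = here refl
  ... | +[1+ i ]  | le = there (∈P.∈-++⁺ˡ (∈P.∈-map⁺ +_ (∈-rng⁺ B (s≤s z≤n) le)))
  ... | -[1+ i ]  | le = there (∈P.∈-++⁺ʳ (map +_ (rng B)) (∈P.∈-map⁺ neg+ (∈-rng⁺ B {suc i} (s≤s z≤n) le)))
  from : ∀ {k} → k ∈ list → k ∈ intRange B
  from (here refl) = ∈-intRange⁺ B z≤n
  from (there k∈) with ∈P.∈-++⁻ (map +_ (rng B)) k∈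
  ... | inj₁ p with i , i∈ , refl ← ∈P.∈-map⁻ +_ p = ∈-intRange⁺ B (proj₂ (∈-rng⁻ B i∈))
  ... | inj₂ p with i , i∈ , refl ← ∈P.∈-map⁻ neg+ p =
    ∈-intRange⁺ B (subst (_≤ℕ B) (sym (ℤP.∣-i∣≡∣i∣ (+ i))) (proj₂ (∈-rng⁻ B i∈)))

sgnℤ : ℤ → ℤ
sgnℤ k = sgn ∣ k ∣

δ₀ : ℤ → ℤ
δ₀ n = 𝟙 (n ℤP.≟ + 0)

-- A function ℤ → ℤ is read as the coefficients of a power series; Θ and Θ′ multiply by
-- θ = ∑ (-1)ᵏ q^(k²) and by q dθ/dq, where only the exponents k ∈ I are kept, and D is q d/dq.
module ThetaOn (I : List ℤ) where

  Θ Θ′ D : (ℤ → ℤ) → ℤ → ℤ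
  Θ  f n = ∑ (I) (λ k → sgnℤ k * f (n - k * k))
  Θ′ f n = ∑ (I) (λ k → sgnℤ k * (k * k) * f (n - k * k))
  D  f n = n * f n

  Θ-cong : ∀ {f g} → (∀ m → f m ≡ g m) → ∀ n → Θ f n ≡ Θ g n
  Θ-cong eq n = ∑-cong (I) (λ k → cong (sgnℤ k *_) (eq (n - k * k)))

  Θ-* : ∀ c f n → Θ (λ m → c * f m) n ≡ c * Θ f n
  Θ-* c f n = trans (∑-cong (I) (λ k → *-exchange (sgnℤ k) c (f (n - k * k)))) (∑-*ˡ c (I) _)

  Θ′-* : ∀ c f n → Θ′ (λ m → c * f m) n ≡ c * Θ′ f n
  Θ′-* c f n = trans (∑-cong (I) (λ k → *-exchange (sgnℤ k * (k * k)) c (f (n - k * k)))) (∑-*ˡ c (I) _)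

  Θ-+ : ∀ f g n → Θ (λ m → f m + g m) n ≡ Θ f n + Θ g n
  Θ-+ f g n = trans (∑-cong (I) (λ k → ℤP.*-distribˡ-+ (sgnℤ k) (f (n - k * k)) (g (n - k * k)))) (∑-+ (I) _ _)

  Θ′-+ : ∀ f g n → Θ′ (λ m → f m + g m) n ≡ Θ′ f n + Θ′ g n
  Θ′-+ f g n = trans (∑-cong (I) (λ k → ℤP.*-distribˡ-+ (sgnℤ k * (k * k)) (f (n - k * k)) (g (n - k * k)))) (∑-+ (I) _ _)

  -- Multiplications by θ and by Dθ commute; in coefficients this is an exchange of two sums.
  ΘΘ′ : ∀ f n → Θ (Θ′ f) n ≡ Θ′ (Θ f) n
  ΘΘ′ f n = begin
    ∑ I (λ k → sgnℤ k * ∑ I (λ j → sgnℤ j * (j * j) * f (n - k * k - j * j)))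
      ≡⟨ ∑-cong I (λ k → sym (∑-*ˡ (sgnℤ k) I _)) ⟩
    ∑ I (λ k → ∑ I (λ j → sgnℤ k * (sgnℤ j * (j * j) * f (n - k * k - j * j))))
      ≡⟨ ∑-swap I I _ ⟩
    ∑ I (λ j → ∑ I (λ k → sgnℤ k * (sgnℤ j * (j * j) * f (n - k * k - j * j))))
      ≡⟨ ∑-cong I (λ j → ∑-cong I (λ k → trans
           (*-exchange (sgnℤ k) (sgnℤ j * (j * j)) (f (n - k * k - j * j)))
           (cong (λ m → sgnℤ j * (j * j) * (sgnℤ k * f m)) (comm n (k * k) (j * j))))) ⟩
    ∑ I (λ j → ∑ I (λ k → sgnℤ j * (j * j) * (sgnℤ k * f (n - j * j - k * k))))
      ≡⟨ ∑-cong I (λ j → ∑-*ˡ (sgnℤ j * (j * j)) I _) ⟩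
    ∑ I (λ j → sgnℤ j * (j * j) * ∑ I (λ k → sgnℤ k * f (n - j * j - k * k))) ∎
    where
    comm : ∀ n x y → n - x - y ≡ n - y - x
    comm = solve-∀

  -- The product rule, from n = (n - k²) + k² in every term.
  DΘ : ∀ f n → D (Θ f) n ≡ Θ (D f) n + Θ′ f n
  DΘ f n = begin
    n * ∑ I (λ k → sgnℤ k * f (n - k * k))   ≡⟨ sym (∑-*ˡ n I _) ⟩
    ∑ I (λ k → n * (sgnℤ k * f (n - k * k))) ≡⟨ ∑-cong I (λ k → leibniz n k (sgnℤ k) (f (n - k * k))) ⟩
    ∑ I (λ k → sgnℤ k * ((n - k * k) * f (n - k * k)) + sgnℤ k * (k * k) * f (n - k * k)) ≡⟨ ∑-+ I _ _ ⟩
    Θ (D f) n + Θ′ f n ∎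
    where
    leibniz : ∀ n k s x → n * (s * x) ≡ s * ((n - k * k) * x) + s * (k * k) * x
    leibniz = solve-∀

  -- Inductive step of the power rule: for h = θ^(c-1) it leads from D(θ^c) = c θ^(c-1) Dθ to the
  -- exponent c + 1.
  D-power : ∀ c h → (∀ n → D (Θ h) n ≡ c * Θ′ h n) → ∀ n → D (Θ (Θ h)) n ≡ (c + + 1) * Θ′ (Θ h) n
  D-power c h eq n = begin
    D (Θ (Θ h)) n                      ≡⟨ DΘ (Θ h) n ⟩
    Θ (D (Θ h)) n + Θ′ (Θ h) n         ≡⟨ cong (_+ Θ′ (Θ h) n) (trans (Θ-cong eq n) (Θ-* c (Θ′ h) n)) ⟩
    c * Θ (Θ′ h) n + Θ′ (Θ h) n        ≡⟨ cong (λ t → c * t + Θ′ (Θ h) n) (ΘΘ′ h n) ⟩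
    c * Θ′ (Θ h) n + Θ′ (Θ h) n        ≡⟨ ring c (Θ′ (Θ h) n) ⟩
    (c + + 1) * Θ′ (Θ h) n             ∎
    where
    ring : ∀ c x → c * x + x ≡ (c + + 1) * x
    ring = solve-∀

  D-Θδ₀ : ∀ n → D (Θ δ₀) n ≡ + 1 * Θ′ δ₀ n
  D-Θδ₀ n = trans (DΘ δ₀ n) (trans (cong (_+ Θ′ δ₀ n) (∑-zero∈ (I) (λ {k} _ → trans (cong (sgnℤ k *_) (Dδ₀ (n - k * k))) (ℤP.*-zeroʳ (sgnℤ k))))) (ring (Θ′ δ₀ n)))
    where
    Dδ₀ : ∀ m → m * δ₀ m ≡ + 0
    Dδ₀ m with m ℤP.≟ + 0
    ... | yes refl = refl
    ... | no _     = ℤP.*-zeroʳ m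
    ring : ∀ x → + 0 + x ≡ + 1 * x
    ring = solve-∀

  -- The power rule for θ⁴ is multiplied once more by θ, so that θ³ disappears and the equation
  -- becomes linear in θ⁴.
  Θ⁴-ode : ∀ n → Θ (D (Θ (Θ (Θ (Θ δ₀))))) n ≡ + 4 * Θ′ (Θ (Θ (Θ (Θ δ₀)))) n
  Θ⁴-ode n = trans (Θ-cong (D-power (+ 3) (Θ (Θ δ₀)) (D-power (+ 2) (Θ δ₀) (D-power (+ 1) δ₀ D-Θδ₀))) n)
    (trans (Θ-* (+ 4) (Θ′ (Θ (Θ (Θ δ₀)))) n) (cong (+ 4 *_) (ΘΘ′ (Θ (Θ (Θ δ₀))) n)))

module Theta (B : ℕ) where
  open ThetaOn (intRange B) public

  private
    less : ∀ n {k} → k ≢ + 0 → n - k * k < n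
    less n {k} k≢0 = subst (n - k * k <_) (ℤP.+-identityʳ n) (ℤP.+-monoʳ-< n (neg k k≢0))
      where
      neg : ∀ k → k ≢ + 0 → - (k * k) < + 0
      neg (+ 0)      ne = contradiction refl ne
      neg (+[1+ k ]) ne = ℤ.-<+
      neg (-[1+ k ]) ne = ℤ.-<+

  -- The term k = 0 of θ is 1 and every other k lowers the index strictly, so at the first possibly
  -- nonzero coefficient θ acts as the identity.
  Θ-head : ∀ f n → (∀ m → m < n → f m ≡ + 0) → Θ f n ≡ f n
  Θ-head f n z = trans
    (∑-single {f = λ k → sgnℤ k * f (n - k * k)} (intRange-unique B) (∈-intRange⁺ B z≤n)
      (λ {k} _ ne → trans (cong (sgnℤ k *_) (z (n - k * k) (less n ne))) (ℤP.*-zeroʳ (sgnℤ k))))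
    (trans (ℤP.*-identityˡ _) (cong f (ℤP.+-identityʳ n)))

  Θ′-head : ∀ f n → (∀ m → m < n → f m ≡ + 0) → Θ′ f n ≡ + 0
  Θ′-head f n z = ∑-zero∈ (intRange B) (λ {k} _ → zero-at k)
    where
    zero-at : ∀ k → sgnℤ k * (k * k) * f (n - k * k) ≡ + 0
    zero-at k with k ℤP.≟ + 0
    ... | yes refl = refl
    ... | no ne    = trans (cong (sgnℤ k * (k * k) *_) (z (n - k * k) (less n ne))) (ℤP.*-zeroʳ (sgnℤ k * (k * k)))

  upto : {P : ℤ → Set} → (∀ n → n < + 0 → P n) → (∀ n → n ≤ + B → (∀ m → m < n → P m) → P n) → ∀ n → n ≤ + B → P n
  upto {P} neg step (-[1+ n ]) le = neg -[1+ n ] ℤ.-<+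
  upto {P} neg step (+ n)      le = <-rec (λ n → + n ≤ + B → P (+ n)) go n le
    where
    go : ∀ n → (∀ {m} → m <ℕ n → + m ≤ + B → P (+ m)) → + n ≤ + B → P (+ n)
    go n ih le = step (+ n) le below
      where
      below : ∀ m → m < + n → P m
      below (-[1+ m ]) lt = neg -[1+ m ] ℤ.-<+
      below (+ m)      lt = ih (ℤP.drop‿+<+ lt) (ℤP.≤-trans (ℤP.<⇒≤ lt) le)

  -- The constant term of θ is 1, so the coefficients of e vanish one after another.
  Θ-injective : ∀ {e} → (∀ n → n < + 0 → e n ≡ + 0) → (∀ n → n ≤ + B → Θ e n ≡ + 0) → ∀ n → n ≤ + B → e n ≡ + 0
  Θ-injective {e} neg eq = upto neg (λ n le below → trans (sym (Θ-head e n below)) (eq n le))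

  -- Dθ has no constant term, so once all lower coefficients vanish the equation at index n reads n
  -- · e(n) = 0. This leaves only the constant term free, and it is prescribed.
  ode-unique : ∀ c {e} → (∀ n → n < + 0 → e n ≡ + 0) → e (+ 0) ≡ + 0 →
    (∀ n → n ≤ + B → Θ (D e) n ≡ c * Θ′ e n) → ∀ n → n ≤ + B → e n ≡ + 0
  ode-unique c {e} neg e0 eq = upto neg step
    where
    step : ∀ n → n ≤ + B → (∀ m → m < n → e m ≡ + 0) → e n ≡ + 0
    step n le below with n ℤP.≟ + 0
    ... | yes refl = e0
    ... | no n≢0   with ℤP.i*j≡0⇒i≡0∨j≡0 n product
      where
      product : n * e n ≡ + 0
      product = trans (sym (Θ-head (D e) n (λ m lt → trans (cong (m *_) (below m lt)) (ℤP.*-zeroʳ m))))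
        (trans (eq n le) (trans (cong (c *_) (Θ′-head e n below)) (ℤP.*-zeroʳ c)))
    ...   | inj₁ n≡0 = contradiction n≡0 n≢0
    ...   | inj₂ en  = en

-- Jacobi's four squares theorem

sgn-∸ : ∀ {m n} → n ≤ℕ m → sgn (m ∸ℕ n) ≡ sgn m * sgn n
sgn-∸ {m} {n} n≤m = begin
  sgn (m ∸ℕ n)                   ≡⟨ sym (ℤP.*-identityʳ _) ⟩
  sgn (m ∸ℕ n) * + 1             ≡⟨ cong (sgn (m ∸ℕ n) *_) (sym (sgn² n)) ⟩
  sgn (m ∸ℕ n) * (sgn n * sgn n) ≡⟨ sym (ℤP.*-assoc (sgn (m ∸ℕ n)) (sgn n) (sgn n)) ⟩
  sgn (m ∸ℕ n) * sgn n * sgn n   ≡⟨ cong (_* sgn n) (trans (sym (sgn-+ (m ∸ℕ n) n)) (cong sgn (ℕP.m∸n+n≡m n≤m))) ⟩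
  sgn m * sgn n ∎

sgn-⊖ : ∀ m n → sgn ∣ m ℤ.⊖ n ∣ ≡ sgn m * sgn n
sgn-⊖ m n with ℕP.≤-total n m
... | inj₁ n≤m = trans (cong (λ z → sgn ∣ z ∣) (ℤP.⊖-≥ n≤m)) (sgn-∸ n≤m)
... | inj₂ m≤n = trans (cong sgn (ℤP.∣⊖∣-≤ m≤n)) (trans (sgn-∸ m≤n) (ℤP.*-comm (sgn n) (sgn m)))

sgnℤ-+ : ∀ x y → sgnℤ (x + y) ≡ sgnℤ x * sgnℤ y
sgnℤ-+ (+ m)      (+ n)      = sgn-+ m n
sgnℤ-+ (+ m)      (-[1+ n ]) = sgn-⊖ m (suc n)
sgnℤ-+ (-[1+ m ]) (+ n)      = trans (sgn-⊖ n (suc m)) (ℤP.*-comm (sgn n) (sgn (suc m)))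
sgnℤ-+ (-[1+ m ]) (-[1+ n ]) =
  trans (cong (λ k → sgn (suc k)) (sym (ℕP.+-suc m n))) (sgn-+ (suc m) (suc n))

sgnℤ² : ∀ x → sgnℤ x * sgnℤ x ≡ + 1
sgnℤ² x = sgn² ∣ x ∣

sgnℤ-2* : ∀ x y → sgnℤ (x + (y + y)) ≡ sgnℤ x
sgnℤ-2* x y = trans (sgnℤ-+ x (y + y)) (trans (cong (sgnℤ x *_) (trans (sgnℤ-+ y y) (sgnℤ² y))) (ℤP.*-identityʳ _))

sgnℤ-shift : ∀ {x y} h → x ≡ y + (h + h) → sgnℤ x ≡ sgnℤ y
sgnℤ-shift {y = y} h refl = sgnℤ-2* y h

x≡-x⇒x≡0 : ∀ x → x ≡ - x → x ≡ + 0
x≡-x⇒x≡0 (+ 0) _ = refl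

-- Reindexing by h turns the sum into its own negative, and ℤ has no 2-torsion.
∑-involution : {xs : List A} → Unique xs → (h : A → A) → (∀ {x} → x ∈ xs → h x ∈ xs × h (h x) ≡ x) →
  {v : A → ℤ} → (∀ {x} → x ∈ xs → v x ≡ - v (h x)) → ∑ xs v ≡ + 0
∑-involution {xs = xs} u h inv {v} odd =
  x≡-x⇒x≡0 _ (trans (∑-bij u u h h inv inv {v} {λ x → - v x} odd) (∑-neg xs v))

𝟙-trichotomy : ∀ x → (𝟙 (+ 0 ℤP.<? x) + 𝟙 (x ℤP.<? + 0)) + 𝟙 (x ℤP.≟ + 0) ≡ + 1
𝟙-trichotomy (+ 0)      = refl
𝟙-trichotomy (+[1+ n ]) = refl
𝟙-trichotomy (-[1+ n ]) = refl

∑-trichotomy : (t : A → ℤ) (xs : List A) (f : A → ℤ) →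
  ∑ xs f ≡ (∑ (filter (λ x → + 0 ℤP.<? t x) xs) f + ∑ (filter (λ x → t x ℤP.<? + 0) xs) f)
           + ∑ (filter (λ x → t x ℤP.≟ + 0) xs) f
∑-trichotomy t xs f = sym (begin
  (∑ (filter (λ x → + 0 ℤP.<? t x) xs) f + ∑ (filter (λ x → t x ℤP.<? + 0) xs) f) + ∑ (filter (λ x → t x ℤP.≟ + 0) xs) f
    ≡⟨ cong₂ _+_ (cong₂ _+_ (∑-filter _ xs f) (∑-filter _ xs f)) (∑-filter _ xs f) ⟩
  (∑ xs (λ x → p x * f x) + ∑ xs (λ x → q x * f x)) + ∑ xs (λ x → r x * f x)
    ≡⟨ sym (trans (∑-+ xs (λ x → p x * f x + q x * f x) (λ x → r x * f x)) (cong (_+ ∑ xs (λ x → r x * f x)) (∑-+ xs (λ x → p x * f x) (λ x → q x * f x)))) ⟩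
  ∑ xs (λ x → (p x * f x + q x * f x) + r x * f x)
    ≡⟨ ∑-cong xs (λ x → trans (factor (p x) (q x) (r x) (f x)) (trans (cong (_* f x) (𝟙-trichotomy (t x))) (ℤP.*-identityˡ (f x)))) ⟩
  ∑ xs f ∎)
  where
  p q r : _ → ℤ
  p x = 𝟙 (+ 0 ℤP.<? t x)
  q x = 𝟙 (t x ℤP.<? + 0)
  r x = 𝟙 (t x ℤP.≟ + 0)
  factor : ∀ p q r f → (p * f + q * f) + r * f ≡ ((p + q) + r) * f
  factor = solve-∀

positives : ℕ → List ℤ
positives B = map +_ (rng B)

∈-positives⁻ : ∀ B {d} → d ∈ positives B → + 0 < d
∈-positives⁻ B d∈ with i , i∈ , refl ← ∈P.∈-map⁻ +_ d∈ = +<+ (proj₁ (∈-rng⁻ B i∈))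

∈-positives⁺ : ∀ B {d} → + 0 < d → d ≤ + B → d ∈ positives B
∈-positives⁺ B {+ d} (+<+ 0<d) (+≤+ d≤B) = ∈P.∈-map⁺ +_ (∈-rng⁺ B 0<d d≤B)

positives-unique : ∀ B → Unique (positives B)
positives-unique B = UniqueP.map⁺ ℤP.+-injective (rng-unique B)

square-∣∣ : ∀ i → i * i ≡ + (∣ i ∣ *ℕ ∣ i ∣)
square-∣∣ (+ i)      = sym (ℤP.pos-* i i)
square-∣∣ (-[1+ i ]) = refl

m≤m*n : ∀ m {n} → 1 ≤ℕ n → m ≤ℕ m *ℕ n
m≤m*n m 1≤n = ℕP.≤-trans (ℕP.≤-reflexive (sym (ℕP.*-identityʳ m))) (ℕP.*-monoʳ-≤ m 1≤n)

m≤m*m : ∀ m → m ≤ℕ m *ℕ m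
m≤m*m zero    = z≤n
m≤m*m (suc m) = m≤m*n (suc m) (s≤s z≤n)

-- Alternating sums are doubled here and in `∑-sgn-square`, which avoids fractions and a case
-- distinction by parity.
∑-sgn : ∀ m → + 2 * ∑ (rng m) (λ j → sgn j) ≡ sgn m - + 1
∑-sgn zero    = refl
∑-sgn (suc m) = trans (ring (sgn m) (∑ (rng m) sgn)) (trans (cong (λ t → + 2 * (- sgn m) + t) (∑-sgn m)) (ring′ (sgn m)))
  where
  ring : ∀ s r → + 2 * (- s + r) ≡ + 2 * (- s) + + 2 * r
  ring = solve-∀
  ring′ : ∀ s → + 2 * (- s) + (s - + 1) ≡ - s - + 1
  ring′ = solve-∀

∑-sgn-square : ∀ m → + 2 * ∑ (rng m) (λ j → sgn j * (+ j * + j)) ≡ sgn m * (+ m * (+ m + + 1))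
∑-sgn-square zero    = refl
∑-sgn-square (suc m) = begin
  + 2 * (- s * (+ suc m * + suc m) + r) ≡⟨ cong (λ z → + 2 * (- s * (z * z) + r)) (ℤP.pos-+ 1 m) ⟩
  + 2 * (- s * ((+ 1 + x) * (+ 1 + x)) + r) ≡⟨ ring s x r ⟩
  + 2 * (- s * ((+ 1 + x) * (+ 1 + x))) + + 2 * r ≡⟨ cong (_+_ (+ 2 * (- s * ((+ 1 + x) * (+ 1 + x))))) (∑-sgn-square m) ⟩
  + 2 * (- s * ((+ 1 + x) * (+ 1 + x))) + s * (x * (x + + 1)) ≡⟨ ring′ s x ⟩
  - s * ((+ 1 + x) * ((+ 1 + x) + + 1)) ≡⟨ cong (λ z → - s * (z * (z + + 1))) (sym (ℤP.pos-+ 1 m)) ⟩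
  - s * (+ suc m * (+ suc m + + 1)) ∎
  where
  s = sgn m
  x = + m
  r = ∑ (rng m) (λ j → sgn j * (+ j * + j))
  ring : ∀ s x r → + 2 * (- s * ((+ 1 + x) * (+ 1 + x)) + r) ≡ + 2 * (- s * ((+ 1 + x) * (+ 1 + x))) + + 2 * r
  ring = solve-∀
  ring′ : ∀ s x → + 2 * (- s * ((+ 1 + x) * (+ 1 + x))) + s * (x * (x + + 1)) ≡ - s * ((+ 1 + x) * ((+ 1 + x) + + 1))
  ring′ = solve-∀

-- After Liouville and Uspensky: the identity for i² + de = n obtained from
-- F(x, y) = (-1)^(x+y) x y² is the differential equation θ·DJ = 4 J·Dθ satisfied by J = θ⁴.
module Windmill (B : ℕ) (n : ℤ) (n≤B : n ≤ + B) where

  Triple : Set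
  Triple = ℤ × ℤ × ℤ

  onQuadric? : (x : Triple) → Dec (proj₁ x * proj₁ x + proj₁ (proj₂ x) * proj₂ (proj₂ x) ≡ n)
  onQuadric? (i , d , e) = i * i + d * e ℤP.≟ n

  -- With d, e > 0 the equation bounds |i|, d and e by n ≤ B, so the box contains every solution.
  T : List Triple
  T = filter onQuadric? (dpairs (intRange B) (λ _ → dpairs (positives B) (λ _ → positives B)))

  T-unique : Unique T
  T-unique = UniqueP.filter⁺ onQuadric? (dpairs-unique (intRange-unique B)
    (λ _ → dpairs-unique (positives-unique B) (λ _ → positives-unique B)))

  ∈T⁻ : ∀ {i d e} → (i , d , e) ∈ T → (i * i + d * e ≡ n) × + 0 < d × + 0 < e
  ∈T⁻ x∈ with box , eq ← ∈P.∈-filter⁻ onQuadric? {xs = dpairs (intRange B) (λ _ → dpairs (positives B) (λ _ → positives B))} x∈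
         with _ , de∈ ← ∈-dpairs⁻ {xs = intRange B} {ys = λ _ → dpairs (positives B) (λ _ → positives B)} box
         with d∈ , e∈ ← ∈-dpairs⁻ {xs = positives B} {ys = λ _ → positives B} de∈ =
    eq , ∈-positives⁻ B d∈ , ∈-positives⁻ B e∈

  ∈T⁺ : ∀ {i d e} → i * i + d * e ≡ n → + 0 < d → + 0 < e → (i , d , e) ∈ T
  ∈T⁺ {i} {+ d} {+ e} eq (+<+ 0<d) (+<+ 0<e) = ∈P.∈-filter⁺ onQuadric?
    (∈-dpairs⁺ {ys = λ _ → dpairs (positives B) (λ _ → positives B)} (∈-intRange⁺ B (ℕP.≤-trans (m≤m*m ∣ i ∣) (ℕP.≤-trans (ℕP.m≤m+n _ (d *ℕ e)) bound)))
      (∈-dpairs⁺ {ys = λ _ → positives B} (∈-positives⁺ B (+<+ 0<d) (+≤+ (ℕP.≤-trans (m≤m*n d 0<e) de≤B)))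
                 (∈-positives⁺ B (+<+ 0<e) (+≤+ (ℕP.≤-trans (m≤m*n e 0<d) (ℕP.≤-trans (ℕP.≤-reflexive (ℕP.*-comm e d)) de≤B)))))) eq
    where
    bound : ∣ i ∣ *ℕ ∣ i ∣ +ℕ d *ℕ e ≤ℕ B
    bound = ℤP.drop‿+≤+ (subst (_≤ + B) (trans (sym eq) (trans (cong₂ _+_ (square-∣∣ i) (sym (ℤP.pos-* d e))) (sym (ℤP.pos-+ (∣ i ∣ *ℕ ∣ i ∣) (d *ℕ e))))) n≤B)
    de≤B : d *ℕ e ≤ℕ B
    de≤B = ℕP.≤-trans (ℕP.m≤n+m (d *ℕ e) (∣ i ∣ *ℕ ∣ i ∣)) bound

  w : Triple → ℤ
  w (i , d , e) = sgnℤ (i + d + e)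

  -- With F(x, y) = (-1)^(x+y) x y², `F₀` is F(d + e, i) and `F₁` is F(e - 2i, d + i). Up to the
  -- factor -4, `G` sums to the contribution of σ to the coefficient of θ·DJ - 4 J·Dθ at qⁿ.
  F₀ F₁ G : Triple → ℤ
  F₀ (i , d , e) = w (i , d , e) * ((d + e) * (i * i))
  F₁ (i , d , e) = w (i , d , e) * ((e - + 2 * i) * ((d + i) * (d + i)))
  G  (i , d , e) = w (i , d , e) * ((n - + 5 * (i * i)) * (d + e))

  flip : Triple → Triple
  flip (i , d , e) = - i , d , e

  swap : Triple → Triple
  swap (i , d , e) = i , e , d

  flip-T : ∀ {x} → x ∈ T → flip x ∈ T × flip (flip x) ≡ x
  flip-T {i , d , e} x∈ = let eq , d>0 , e>0 = ∈T⁻ x∈ in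
    ∈T⁺ (trans (cong (_+ d * e) (sq i)) eq) d>0 e>0 , cong (_, d , e) (ℤP.neg-involutive i)
    where
    sq : ∀ i → - i * - i ≡ i * i
    sq = solve-∀

  swap-T : ∀ {x} → x ∈ T → swap x ∈ T × swap (swap x) ≡ x
  swap-T {i , d , e} x∈ = let eq , d>0 , e>0 = ∈T⁻ x∈ in
    ∈T⁺ (trans (cong (_+_ (i * i)) (ℤP.*-comm e d)) eq) e>0 d>0 , refl

  w-flip : ∀ i d e → w (- i , d , e) ≡ w (i , d , e)
  w-flip i d e = sgnℤ-shift {y = i + d + e} (- i) (ring i d e)
    where
    ring : ∀ i d e → - i + d + e ≡ i + d + e + (- i + - i)
    ring = solve-∀

  w-swap : ∀ i d e → w (i , e , d) ≡ w (i , d , e)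
  w-swap i d e = cong sgnℤ (ring i d e)
    where
    ring : ∀ i d e → i + e + d ≡ i + d + e
    ring = solve-∀

  -- On i² + de = n, G differs from 2 F₁ - F₀ by E₁, which is odd under i ↦ -i, and by E₂, which is
  -- odd under exchanging d and e. Both sum to 0.
  ∑G : ∑ T G ≡ + 2 * ∑ T F₁ - ∑ T F₀
  ∑G = begin
    ∑ T G
      ≡⟨ ∑-cong∈ T (λ {x} x∈ → pointwise x (proj₁ (∈T⁻ x∈))) ⟩
    ∑ T (λ x → ((+ 2 * F₁ x + - F₀ x) + E₁ x) + E₂ x)
      ≡⟨ trans (∑-+ T (λ x → (+ 2 * F₁ x + - F₀ x) + E₁ x) E₂) (cong₂ _+_ (∑-+ T (λ x → + 2 * F₁ x + - F₀ x) E₁) (∑-involution T-unique swap swap-T (λ {x} _ → odd₂ x))) ⟩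
    (∑ T (λ x → + 2 * F₁ x + - F₀ x) + ∑ T E₁) + + 0
      ≡⟨ cong (_+ + 0) (cong₂ _+_ (trans (∑-+ T (λ x → + 2 * F₁ x) (λ x → - F₀ x)) (cong₂ _+_ (∑-*ˡ (+ 2) T F₁) (∑-neg T F₀))) (∑-involution T-unique flip flip-T (λ {x} _ → odd₁ x))) ⟩
    ((+ 2 * ∑ T F₁ + - ∑ T F₀) + + 0) + + 0
      ≡⟨ trans (ℤP.+-identityʳ _) (ℤP.+-identityʳ _) ⟩
    + 2 * ∑ T F₁ - ∑ T F₀ ∎
    where
    E₁ E₂ : Triple → ℤ
    E₁ (i , d , e) = w (i , d , e) * (- (+ 4 * (i * (d * e - d * d - i * i))))
    E₂ (i , d , e) = w (i , d , e) * ((e - d) * (d * e - + 5 * (i * i)))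
    odd₁ : ∀ x → E₁ x ≡ - E₁ (flip x)
    odd₁ (i , d , e) = trans (ring (w (i , d , e)) i d e) (cong (λ s → - (s * (- (+ 4 * (- i * (d * e - d * d - - i * - i)))))) (sym (w-flip i d e)))
      where
      ring : ∀ s i d e → s * (- (+ 4 * (i * (d * e - d * d - i * i)))) ≡ - (s * (- (+ 4 * (- i * (d * e - d * d - - i * - i)))))
      ring = solve-∀
    odd₂ : ∀ x → E₂ x ≡ - E₂ (swap x)
    odd₂ (i , d , e) = trans (ring (w (i , d , e)) i d e) (cong (λ s → - (s * ((d - e) * (e * d - + 5 * (i * i))))) (sym (w-swap i d e)))
      where
      ring : ∀ s i d e → s * ((e - d) * (d * e - + 5 * (i * i))) ≡ - (s * ((d - e) * (e * d - + 5 * (i * i))))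
      ring = solve-∀
    pointwise : ∀ x → proj₁ x * proj₁ x + proj₁ (proj₂ x) * proj₂ (proj₂ x) ≡ n → G x ≡ ((+ 2 * F₁ x + - F₀ x) + E₁ x) + E₂ x
    pointwise (i , d , e) eq = trans (cong (λ m → w (i , d , e) * ((m - + 5 * (i * i)) * (d + e))) (sym eq)) (ring (w (i , d , e)) i d e)
      where
      ring : ∀ s i d e → s * ((i * i + d * e - + 5 * (i * i)) * (d + e)) ≡
        ((+ 2 * (s * ((e - + 2 * i) * ((d + i) * (d + i)))) + - (s * ((d + e) * (i * i))))
          + s * (- (+ 4 * (i * (d * e - d * d - i * i))))) + s * ((e - d) * (d * e - + 5 * (i * i)))
      ring = solve-∀

  -- The plane t = 0 separates a part of T on which F₁ cancels from a part that is sheared onto u >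
  -- 0; u is t with d and e exchanged.
  t u : Triple → ℤ
  t (i , d , e) = d + + 2 * i - e
  u (i , d , e) = e + + 2 * i - d

  T> T< T= T′ : List Triple
  T> = filter (λ x → + 0 ℤP.<? t x) T
  T< = filter (λ x → t x ℤP.<? + 0) T
  T= = filter (λ x → t x ℤP.≟ + 0) T
  T′ = filter (λ x → + 0 ℤP.<? u x) T

  -- The reflection `h` keeps e and d + i and changes the sign of e - 2i, hence that of F₁. It
  -- exchanges d and t, so it preserves positivity where t > 0.
  F₁-odd : ∑ T> F₁ ≡ + 0
  F₁-odd = ∑-involution (UniqueP.filter⁺ (λ x → + 0 ℤP.<? t x) T-unique) h h-T (λ {x} _ → odd x)
    where
    h : Triple → Triple
    h (i , d , e) = e - i , d + + 2 * i - e , e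
    quad : ∀ i d e → (e - i) * (e - i) + (d + + 2 * i - e) * e ≡ i * i + d * e
    quad = solve-∀
    t-h : ∀ i d e → d ≡ (d + + 2 * i - e) + + 2 * (e - i) - e
    t-h = solve-∀
    back : ∀ i d e → e - (e - i) ≡ i
    back = solve-∀
    h-T : ∀ {x} → x ∈ T> → h x ∈ T> × h (h x) ≡ x
    h-T {i , d , e} x∈ with x∈T , t>0 ← ∈P.∈-filter⁻ (λ x → + 0 ℤP.<? t x) {xs = T} x∈ with eq , d>0 , e>0 ← ∈T⁻ x∈T =
      ∈P.∈-filter⁺ (λ x → + 0 ℤP.<? t x) (∈T⁺ (trans (quad i d e) eq) t>0 e>0) (subst (+ 0 <_) (t-h i d e) d>0) ,
      cong₂ _,_ (back i d e) (cong (_, e) (sym (t-h i d e)))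
    odd : ∀ x → F₁ x ≡ - F₁ (h x)
    odd (i , d , e) = trans (cong (λ s → sgnℤ s * ((e - + 2 * i) * ((d + i) * (d + i)))) (sum i d e)) (ring (sgnℤ (e - i + (d + + 2 * i - e) + e)) i d e)
      where
      sum : ∀ i d e → i + d + e ≡ e - i + (d + + 2 * i - e) + e
      sum = solve-∀
      ring : ∀ s i d e → s * ((e - + 2 * i) * ((d + i) * (d + i))) ≡ - (s * ((e - + 2 * (e - i)) * ((d + + 2 * i - e + (e - i)) * (d + + 2 * i - e + (e - i)))))
      ring = solve-∀

  -- The shear `f` is made so that the new d + e is e - 2i and the new i is d + i. The new e is -t,
  -- which is positive here, and the new u is the old e.
  F₁-shear : ∑ T< F₁ ≡ ∑ T′ F₀
  F₁-shear = ∑-bij (UniqueP.filter⁺ (λ x → t x ℤP.<? + 0) T-unique) (UniqueP.filter⁺ (λ x → + 0 ℤP.<? u x) T-unique)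
    f g to from (λ {x} _ → value x)
    where
    f g : Triple → Triple
    f (i , d , e) = d + i , d , - (d + + 2 * i - e)
    g (i , d , e) = i - d , d , e + + 2 * i - d
    quad : ∀ i d e → (d + i) * (d + i) + d * - (d + + 2 * i - e) ≡ i * i + d * e
    quad = solve-∀
    quad′ : ∀ i d e → (i - d) * (i - d) + d * (e + + 2 * i - d) ≡ i * i + d * e
    quad′ = solve-∀
    u-f : ∀ i d e → e ≡ - (d + + 2 * i - e) + + 2 * (d + i) - d
    u-f = solve-∀
    t-g : ∀ i d e → - e ≡ d + + 2 * (i - d) - (e + + 2 * i - d)
    t-g = solve-∀
    to : ∀ {x} → x ∈ T< → f x ∈ T′ × g (f x) ≡ x
    to {i , d , e} x∈ with x∈T , t<0 ← ∈P.∈-filter⁻ (λ x → t x ℤP.<? + 0) {xs = T} x∈ with eq , d>0 , e>0 ← ∈T⁻ x∈T =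
      ∈P.∈-filter⁺ (λ x → + 0 ℤP.<? u x) (∈T⁺ (trans (quad i d e) eq) d>0 (ℤP.neg-mono-< t<0)) (subst (+ 0 <_) (u-f i d e) e>0) ,
      cong₂ _,_ (fst i d) (cong (d ,_) (sym (u-f i d e)))
      where
      fst : ∀ i d → d + i - d ≡ i
      fst = solve-∀
    from : ∀ {x} → x ∈ T′ → g x ∈ T< × f (g x) ≡ x
    from {i , d , e} x∈ with x∈T , u>0 ← ∈P.∈-filter⁻ (λ x → + 0 ℤP.<? u x) {xs = T} x∈ with eq , d>0 , e>0 ← ∈T⁻ x∈T =
      ∈P.∈-filter⁺ (λ x → t x ℤP.<? + 0) (∈T⁺ (trans (quad′ i d e) eq) d>0 u>0) (subst (_< + 0) (t-g i d e) (ℤP.neg-mono-< e>0)) ,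
      cong₂ _,_ (fst i d) (cong (d ,_) (trd i d e))
      where
      fst : ∀ i d → d + (i - d) ≡ i
      fst = solve-∀
      trd : ∀ i d e → - (d + + 2 * (i - d) - (e + + 2 * i - d)) ≡ e
      trd = solve-∀
    value : ∀ x → F₁ x ≡ F₀ (f x)
    value (i , d , e) = trans (cong (_* ((e - + 2 * i) * ((d + i) * (d + i)))) (sgnℤ-shift {y = d + i + d + - (d + + 2 * i - e)} i (sum i d e))) (ring (sgnℤ (d + i + d + - (d + + 2 * i - e))) i d e)
      where
      sum : ∀ i d e → i + d + e ≡ d + i + d + - (d + + 2 * i - e) + (i + i)
      sum = solve-∀
      ring : ∀ s i d e → s * ((e - + 2 * i) * ((d + i) * (d + i))) ≡ s * ((d + - (d + + 2 * i - e)) * ((d + i) * (d + i)))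
      ring = solve-∀

  -- The map (i, d, e) ↦ (-i, e, d) reverses the sign of u and preserves F₀; exchanging d and e
  -- carries u = 0 to t = 0.
  F₀-symmetric : ∑ T F₀ ≡ (∑ T′ F₀ + ∑ T′ F₀) + ∑ T= F₀
  F₀-symmetric = trans (∑-trichotomy u T F₀) (cong₂ _+_ (cong (_+_ (∑ T′ F₀)) (sym reflect)) diagonal)
    where
    T′< T′= : List Triple
    T′< = filter (λ x → u x ℤP.<? + 0) T
    T′= = filter (λ x → u x ℤP.≟ + 0) T
    r : Triple → Triple
    r (i , d , e) = - i , e , d
    u-r : ∀ i d e → - (e + + 2 * i - d) ≡ d + + 2 * - i - e
    u-r = solve-∀
    r-T : ∀ {x} → x ∈ T → r x ∈ T
    r-T {i , d , e} x∈ = proj₁ (flip-T (proj₁ (swap-T x∈)))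
    r² : ∀ x → r (r x) ≡ x
    r² (i , d , e) = cong (_, d , e) (ℤP.neg-involutive i)
    F₀-r : ∀ x → F₀ x ≡ F₀ (r x)
    F₀-r (i , d , e) = trans (cong (_* ((d + e) * (i * i))) (sym (trans (w-flip i e d) (w-swap i d e)))) (ring (w (- i , e , d)) i d e)
      where
      ring : ∀ s i d e → s * ((d + e) * (i * i)) ≡ s * ((e + d) * (- i * - i))
      ring = solve-∀
    reflect : ∑ T′ F₀ ≡ ∑ T′< F₀
    reflect = ∑-bij (UniqueP.filter⁺ (λ x → + 0 ℤP.<? u x) T-unique) (UniqueP.filter⁺ (λ x → u x ℤP.<? + 0) T-unique) r r to from (λ {x} _ → F₀-r x)
      where
      to : ∀ {x} → x ∈ T′ → r x ∈ T′< × r (r x) ≡ x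
      to {i , d , e} x∈ = let x∈T , p = ∈P.∈-filter⁻ (λ x → + 0 ℤP.<? u x) {xs = T} x∈ in
        ∈P.∈-filter⁺ (λ x → u x ℤP.<? + 0) (r-T x∈T) (subst (_< + 0) (u-r i d e) (ℤP.neg-mono-< p)) , r² (i , d , e)
      from : ∀ {x} → x ∈ T′< → r x ∈ T′ × r (r x) ≡ x
      from {i , d , e} x∈ = let x∈T , p = ∈P.∈-filter⁻ (λ x → u x ℤP.<? + 0) {xs = T} x∈ in
        ∈P.∈-filter⁺ (λ x → + 0 ℤP.<? u x) (r-T x∈T) (subst (+ 0 <_) (u-r i d e) (ℤP.neg-mono-< p)) , r² (i , d , e)
    F₀-swap : ∀ x → F₀ x ≡ F₀ (swap x)
    F₀-swap (i , d , e) = cong₂ (λ s m → s * (m * (i * i))) (sym (w-swap i d e)) (ℤP.+-comm d e)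
    diagonal : ∑ T′= F₀ ≡ ∑ T= F₀
    diagonal = ∑-bij (UniqueP.filter⁺ (λ x → u x ℤP.≟ + 0) T-unique) (UniqueP.filter⁺ (λ x → t x ℤP.≟ + 0) T-unique) swap swap to from (λ {x} _ → F₀-swap x)
      where
      to : ∀ {x} → x ∈ T′= → swap x ∈ T= × swap (swap x) ≡ x
      to x∈ = let x∈T , p = ∈P.∈-filter⁻ (λ x → u x ℤP.≟ + 0) {xs = T} x∈ in
        ∈P.∈-filter⁺ (λ x → t x ℤP.≟ + 0) (proj₁ (swap-T x∈T)) p , refl
      from : ∀ {x} → x ∈ T= → swap x ∈ T′= × swap (swap x) ≡ x
      from x∈ = let x∈T , p = ∈P.∈-filter⁻ (λ x → t x ℤP.≟ + 0) {xs = T} x∈ in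
        ∈P.∈-filter⁺ (λ x → u x ℤP.≟ + 0) (proj₁ (swap-T x∈T)) p , refl

  H : Triple → ℤ
  H x = + 2 * F₁ x + - F₀ x

  -- F₁ yields the F₀-sum over u > 0 once and enters doubled; F₀ yields it twice. So everything off
  -- the plane t = 0 cancels.
  ∑G-ties : ∑ T G ≡ ∑ T= H
  ∑G-ties = begin
    ∑ T G
      ≡⟨ ∑G ⟩
    + 2 * ∑ T F₁ - ∑ T F₀
      ≡⟨ cong₂ (λ x y → + 2 * x - y) (trans (∑-trichotomy t T F₁) (cong (_+ ∑ T= F₁) (cong₂ _+_ F₁-odd F₁-shear))) F₀-symmetric ⟩
    + 2 * ((+ 0 + ∑ T′ F₀) + ∑ T= F₁) - ((∑ T′ F₀ + ∑ T′ F₀) + ∑ T= F₀)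
      ≡⟨ ring (∑ T′ F₀) (∑ T= F₁) (∑ T= F₀) ⟩
    + 2 * ∑ T= F₁ + - ∑ T= F₀
      ≡⟨ sym (trans (∑-+ T= (λ x → + 2 * F₁ x) (λ x → - F₀ x)) (cong₂ _+_ (∑-*ˡ (+ 2) T= F₁) (∑-neg T= F₀))) ⟩
    ∑ T= H ∎
    where
    ring : ∀ x a b → + 2 * ((+ 0 + x) + a) - ((x + x) + b) ≡ + 2 * a + - b
    ring = solve-∀

  -- On t = 0 one has e = d + 2i and n = (d + i)². Ties thus exist only for square n; they are given
  -- by s = d + i and by j = i with |j| < s, which is the range `intRange (s ∸ℕ 1)`.
  roots : List ℕ
  roots = filter (λ s → + s * + s ℤP.≟ n) (rng B)

  pairs : List (ℕ × ℤ)
  pairs = dpairs roots (λ s → intRange (s ∸ℕ 1))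

  private
    0<sub : ∀ {x y} → x < y → + 0 < y - x
    0<sub {x} {y} lt = subst (_< y - x) (ℤP.+-inverseʳ x) (ℤP.+-monoˡ-< (- x) lt)

    sub<0 : ∀ {x y} → + 0 < y - x → x < y
    sub<0 {x} {y} lt = subst₂ _<_ (ℤP.+-identityʳ x) (ring x y) (ℤP.+-monoʳ-< x lt)
      where
      ring : ∀ x y → x + (y - x) ≡ y
      ring = solve-∀

    ∣∣<⇒ : ∀ {j s} → ∣ j ∣ <ℕ s → + 0 < + s - j × + 0 < + s + j
    ∣∣<⇒ {+ j}      {s} lt = 0<sub (+<+ lt) , +<+ (ℕP.≤-trans (ℕP.≤-trans (s≤s z≤n) lt) (ℕP.m≤m+n s j))
    ∣∣<⇒ { -[1+ j ]} {s} lt = +<+ (ℕP.≤-trans (ℕP.≤-trans (s≤s z≤n) lt) (ℕP.m≤m+n s (suc j))) , 0<sub (+<+ lt)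

    ⇒∣∣< : ∀ {j s} → + 0 < + s - j → + 0 < + s + j → ∣ j ∣ <ℕ s
    ⇒∣∣< {+ j}      p q = ℤP.drop‿+<+ (sub<0 p)
    ⇒∣∣< { -[1+ j ]} p q = ℤP.drop‿+<+ (sub<0 q)

    half-pos : ∀ {x} → + 0 < x + x → + 0 < x
    half-pos {+ 0}      (+<+ ())
    half-pos {+[1+ x ]} _ = +<+ (s≤s z≤n)

    abs-pos : ∀ {x} → + 0 < x → + ∣ x ∣ ≡ x
    abs-pos (+<+ _) = refl

  ties : ∑ T= H ≡ ∑ pairs (λ { (s , j) → H (j , + s - j , + s + j) })
  ties = ∑-bij (UniqueP.filter⁺ (λ x → t x ℤP.≟ + 0) T-unique)
    (dpairs-unique (UniqueP.filter⁺ (λ s → + s * + s ℤP.≟ n) (rng-unique B)) (λ {s} _ → intRange-unique (s ∸ℕ 1)))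
    f g to from (λ x∈ → cong H (sym (proj₂ (to x∈))))
    where
    f : Triple → ℕ × ℤ
    f (i , d , e) = ∣ d + i ∣ , i
    g : ℕ × ℤ → Triple
    g (s , j) = j , + s - j , + s + j
    to : ∀ {x} → x ∈ T= → f x ∈ pairs × g (f x) ≡ x
    to {i , d , e} x∈ with x∈T , t≡0 ← ∈P.∈-filter⁻ (λ x → t x ℤP.≟ + 0) {xs = T} x∈ with eq , d>0 , e>0 ← ∈T⁻ x∈T =
      ∈-dpairs⁺ {ys = λ s → intRange (s ∸ℕ 1)} (∈P.∈-filter⁺ (λ s → + s * + s ℤP.≟ n) (∈-rng⁺ B 1≤s s≤B) s²) (∈-intRange⁺ (s ∸ℕ 1) (ℕP.<⇒≤pred i<s)) ,
      cong₂ _,_ refl (cong₂ _,_ d≡ e≡)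
      where
      s : ℕ
      s = ∣ d + i ∣
      e-eq : e ≡ d + + 2 * i
      e-eq = trans (ring e (d + + 2 * i)) (trans (cong (λ z → d + + 2 * i - z) t≡0) (ℤP.+-identityʳ _))
        where
        ring : ∀ e x → e ≡ x - (x - e)
        ring = solve-∀
      pos : + 0 < d + i
      pos = half-pos (subst (+ 0 <_) (trans (cong (_+_ d) e-eq) (ring i d)) (ℤP.+-mono-< d>0 e>0))
        where
        ring : ∀ i d → d + (d + + 2 * i) ≡ (d + i) + (d + i)
        ring = solve-∀
      s≡ : + s ≡ d + i
      s≡ = abs-pos pos
      d≡ : + s - i ≡ d
      d≡ = trans (cong (_- i) s≡) (ring i d)
        where
        ring : ∀ i d → d + i - i ≡ d
        ring = solve-∀
      e≡ : + s + i ≡ e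
      e≡ = trans (cong (_+ i) s≡) (trans (ring i d) (sym e-eq))
        where
        ring : ∀ i d → d + i + i ≡ d + + 2 * i
        ring = solve-∀
      s² : + s * + s ≡ n
      s² = trans (cong₂ _*_ s≡ s≡) (trans (ring i d) (trans (cong (λ z → i * i + d * z) (sym e-eq)) eq))
        where
        ring : ∀ i d → (d + i) * (d + i) ≡ i * i + d * (d + + 2 * i)
        ring = solve-∀
      i<s : ∣ i ∣ <ℕ s
      i<s = ⇒∣∣< {i} (subst (+ 0 <_) (sym d≡) d>0) (subst (+ 0 <_) (sym e≡) e>0)
      1≤s : 1 ≤ℕ s
      1≤s = ℕP.≤-trans (s≤s z≤n) i<s
      s≤B : s ≤ℕ B
      s≤B = ℕP.≤-trans (m≤m*m s) (ℤP.drop‿+≤+ (subst (_≤ + B) (trans (sym s²) (sym (ℤP.pos-* s s))) n≤B))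
    from : ∀ {y} → y ∈ pairs → g y ∈ T= × f (g y) ≡ y
    from {s , j} y∈ with s∈ , j∈ ← ∈-dpairs⁻ {xs = roots} {ys = λ s → intRange (s ∸ℕ 1)} y∈
      with s∈rng , s² ← ∈P.∈-filter⁻ (λ s → + s * + s ℤP.≟ n) {xs = rng B} s∈ =
      ∈P.∈-filter⁺ (λ x → t x ℤP.≟ + 0) (∈T⁺ (trans (quad (+ s) j) s²) (proj₁ pos) (proj₂ pos)) (tie (+ s) j) ,
      cong (_, j) (cong ∣_∣ (back (+ s) j))
      where
      pos : + 0 < + s - j × + 0 < + s + j
      pos = ∣∣<⇒ {j} (ℕP.≤-trans (s≤s (∈-intRange⁻ (s ∸ℕ 1) j∈)) (ℕP.≤-reflexive (ℕP.m+[n∸m]≡n (proj₁ (∈-rng⁻ B s∈rng)))))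
      quad : ∀ s j → j * j + (s - j) * (s + j) ≡ s * s
      quad = solve-∀
      tie : ∀ s j → s - j + + 2 * j - (s + j) ≡ + 0
      tie = solve-∀
      back : ∀ s j → s - j + j ≡ s
      back = solve-∀

  -- On a tie the summand is (-1)^j times a cubic in s and j. Its part odd in j cancels between j
  -- and -j, and the alternating sums of 1 and of j² remain.
  tie-sum : ∀ s → 1 ≤ℕ s → ∑ (intRange (s ∸ℕ 1)) (λ j → H (j , + s - j , + s + j)) ≡ - (+ 2) * (sgn s * (+ s * + s))
  tie-sum (suc m) _ = begin
    ∑ (intRange m) (λ j → H (j , x - j , x + j))
      ≡⟨ ∑-cong (intRange m) simplify ⟩
    ∑ (intRange m) K
      ≡⟨ ∑-intRange m K ⟩
    K (+ 0) + (∑ (rng m) (K ∘ +_) + ∑ (rng m) (K ∘ neg+))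
      ≡⟨ cong (_+_ (K (+ 0))) (trans (sym (∑-+ (rng m) (K ∘ +_) (K ∘ neg+))) (trans (∑-cong (rng m) fold) (trans (∑-+ (rng m) (λ j → + 4 * (x * x * x) * sgn j) (λ j → - (+ 4 * x) * (sgn j * (+ j * + j)))) (cong₂ _+_ (∑-*ˡ (+ 4 * (x * x * x)) (rng m) sgn) (∑-*ˡ (- (+ 4 * x)) (rng m) (λ j → sgn j * (+ j * + j))))))) ⟩
    K (+ 0) + (+ 4 * (x * x * x) * S₀ + - (+ 4 * x) * S₂)
      ≡⟨ halves x S₀ S₂ ⟩
    + 2 * (x * x * x) + (+ 2 * (x * x * x) * (+ 2 * S₀) + - (+ 2 * x) * (+ 2 * S₂))
      ≡⟨ cong₂ (λ a b → + 2 * (x * x * x) + (+ 2 * (x * x * x) * a + - (+ 2 * x) * b)) (∑-sgn m) (∑-sgn-square m) ⟩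
    + 2 * (x * x * x) + (+ 2 * (x * x * x) * (sgn m - + 1) + - (+ 2 * x) * (sgn m * (+ m * (+ m + + 1))))
      ≡⟨ cong (λ x → + 2 * (x * x * x) + (+ 2 * (x * x * x) * (sgn m - + 1) + - (+ 2 * x) * (sgn m * (+ m * (+ m + + 1))))) (ℤP.pos-+ 1 m) ⟩
    + 2 * ((+ 1 + + m) * (+ 1 + + m) * (+ 1 + + m)) + (+ 2 * ((+ 1 + + m) * (+ 1 + + m) * (+ 1 + + m)) * (sgn m - + 1) + - (+ 2 * (+ 1 + + m)) * (sgn m * (+ m * (+ m + + 1))))
      ≡⟨ final (sgn m) (+ m) ⟩
    - (+ 2) * (- sgn m * ((+ 1 + + m) * (+ 1 + + m)))
      ≡⟨ cong (λ x → - (+ 2) * (- sgn m * (x * x))) (sym (ℤP.pos-+ 1 m)) ⟩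
    - (+ 2) * (- sgn m * (x * x)) ∎
    where
    x = + suc m
    S₀ = ∑ (rng m) sgn
    S₂ = ∑ (rng m) (λ j → sgn j * (+ j * + j))
    K : ℤ → ℤ
    K j = sgnℤ j * (+ 2 * ((x - j) * (x * x)) - + 2 * (x * (j * j)))
    simplify : ∀ j → H (j , x - j , x + j) ≡ K j
    simplify j = trans (cong (λ s → + 2 * (s * ((x + j - + 2 * j) * ((x - j + j) * (x - j + j)))) + - (s * ((x - j + (x + j)) * (j * j)))) (sgnℤ-shift {y = j} x (sum x j))) (ring (sgnℤ j) x j)
      where
      sum : ∀ x j → j + (x - j) + (x + j) ≡ j + (x + x)
      sum = solve-∀
      ring : ∀ s x j → + 2 * (s * ((x + j - + 2 * j) * ((x - j + j) * (x - j + j)))) + - (s * ((x - j + (x + j)) * (j * j))) ≡ s * (+ 2 * ((x - j) * (x * x)) - + 2 * (x * (j * j)))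
      ring = solve-∀
    fold : ∀ j → K (+ j) + K (- + j) ≡ + 4 * (x * x * x) * sgn j + - (+ 4 * x) * (sgn j * (+ j * + j))
    fold j = trans (cong (λ s → K (+ j) + s * (+ 2 * ((x - - + j) * (x * x)) - + 2 * (x * (- + j * - + j)))) (cong sgn (ℤP.∣-i∣≡∣i∣ (+ j)))) (ring (sgn j) x (+ j))
      where
      ring : ∀ s x j → s * (+ 2 * ((x - j) * (x * x)) - + 2 * (x * (j * j))) + s * (+ 2 * ((x - - j) * (x * x)) - + 2 * (x * (- j * - j))) ≡ + 4 * (x * x * x) * s + - (+ 4 * x) * (s * (j * j))
      ring = solve-∀
    halves : ∀ x a b → + 1 * (+ 2 * ((x - + 0) * (x * x)) - + 2 * (x * (+ 0 * + 0))) + (+ 4 * (x * x * x) * a + - (+ 4 * x) * b) ≡ + 2 * (x * x * x) + (+ 2 * (x * x * x) * (+ 2 * a) + - (+ 2 * x) * (+ 2 * b))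
    halves = solve-∀
    final : ∀ s m → + 2 * ((+ 1 + m) * (+ 1 + m) * (+ 1 + m)) + (+ 2 * ((+ 1 + m) * (+ 1 + m) * (+ 1 + m)) * (s - + 1) + - (+ 2 * (+ 1 + m)) * (s * (m * (m + + 1)))) ≡ - (+ 2) * (- s * ((+ 1 + m) * (+ 1 + m)))
    final = solve-∀

  ∑G-closed : ∑ T G ≡ - (+ 2) * ∑ roots (λ s → sgn s * (+ s * + s))
  ∑G-closed = begin
    ∑ T G      ≡⟨ ∑G-ties ⟩
    ∑ T= H     ≡⟨ ties ⟩
    ∑ pairs _  ≡⟨ ∑-dpairs roots (λ s → intRange (s ∸ℕ 1)) (λ { (s , j) → H (j , + s - j , + s + j) }) ⟩
    ∑ roots (λ s → ∑ (intRange (s ∸ℕ 1)) (λ j → H (j , + s - j , + s + j)))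
      ≡⟨ ∑-cong∈ roots (λ {s} s∈ → tie-sum s (proj₁ (∈-rng⁻ B (proj₁ (∈P.∈-filter⁻ (λ s → + s * + s ℤP.≟ n) {xs = rng B} s∈))))) ⟩
    ∑ roots (λ s → - (+ 2) * (sgn s * (+ s * + s)))
      ≡⟨ ∑-*ˡ (- (+ 2)) roots (λ s → sgn s * (+ s * + s)) ⟩
    - (+ 2) * ∑ roots (λ s → sgn s * (+ s * + s)) ∎

∑-filter-roots : ∀ B n (f : ℕ → ℤ) → ∑ (filter (λ s → + s * + s ℤP.≟ n) (rng B)) f ≡ ∑ (rng B) (λ s → 𝟙 (+ s * + s ℤP.≟ n) * f s)
∑-filter-roots B n f = ∑-filter (λ s → + s * + s ℤP.≟ n) (rng B) f

module Jacobi (B : ℕ) where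
  open Theta B public

  -- Jacobi's series, symmetrised: d and e contribute equally, so -4 (d + e) takes the place of -8
  -- d.
  σ J : ℤ → ℤ
  σ n = ∑ (positives B) (λ d → ∑ (positives B) (λ e → 𝟙 (d * e ℤP.≟ n) * (sgnℤ (d + e) * (d + e))))
  J n = δ₀ n + - (+ 4) * σ n

  σ-nonpositive : ∀ n → n ≤ + 0 → σ n ≡ + 0
  σ-nonpositive n n≤0 = ∑-zero∈ (positives B) (λ {d} d∈ → ∑-zero∈ (positives B) (λ {e} e∈ →
    cong (_* (sgnℤ (d + e) * (d + e))) (𝟙-no (d * e ℤP.≟ n) (λ eq → ℤP.<⇒≱ (pos d e (∈-positives⁻ B d∈) (∈-positives⁻ B e∈)) (ℤP.≤-trans (ℤP.≤-reflexive eq) n≤0)))))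
    where
    pos : ∀ d e → + 0 < d → + 0 < e → + 0 < d * e
    pos (+[1+ d ]) (+[1+ e ]) _ _ = +<+ (s≤s z≤n)
    pos (+ 0) _ (+<+ ()) _
    pos (+[1+ d ]) (+ 0) _ (+<+ ())

  δ₀-negative : ∀ n → n < + 0 → δ₀ n ≡ + 0
  δ₀-negative n n<0 = 𝟙-no (n ℤP.≟ + 0) (λ eq → ℤP.<-irrefl eq n<0)

  Θ-negative : ∀ f → (∀ n → n < + 0 → f n ≡ + 0) → ∀ n → n < + 0 → Θ f n ≡ + 0
  Θ-negative f neg n n<0 = trans (Θ-head f n (λ m m<n → neg m (ℤP.<-trans m<n n<0))) (neg n n<0)

  -- The coefficient of θ·Df - 4 f·Dθ, where n - 5k² = (n - k²) - 4k².
  twist : (ℤ → ℤ) → ℤ → ℤ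
  twist f n = ∑ (intRange B) (λ k → sgnℤ k * ((n - + 5 * (k * k)) * f (n - k * k)))

  twist-ode : ∀ f n → Θ (D f) n ≡ + 4 * Θ′ f n + twist f n
  twist-ode f n = begin
    ∑ (intRange B) (λ k → sgnℤ k * ((n - k * k) * f (n - k * k)))
      ≡⟨ ∑-cong (intRange B) (λ k → ring n k (sgnℤ k) (f (n - k * k))) ⟩
    ∑ (intRange B) (λ k → + 4 * (sgnℤ k * (k * k) * f (n - k * k)) + sgnℤ k * ((n - + 5 * (k * k)) * f (n - k * k)))
      ≡⟨ ∑-+ (intRange B) (λ k → + 4 * (sgnℤ k * (k * k) * f (n - k * k))) (λ k → sgnℤ k * ((n - + 5 * (k * k)) * f (n - k * k))) ⟩
    ∑ (intRange B) (λ k → + 4 * (sgnℤ k * (k * k) * f (n - k * k))) + twist f n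
      ≡⟨ cong (_+ twist f n) (∑-*ˡ (+ 4) (intRange B) (λ k → sgnℤ k * (k * k) * f (n - k * k))) ⟩
    + 4 * Θ′ f n + twist f n ∎
    where
    ring : ∀ n k s x → s * ((n - k * k) * x) ≡ + 4 * (s * (k * k) * x) + s * ((n - + 5 * (k * k)) * x)
    ring = solve-∀

  -- The constant series contributes only for n = s², from k = s and k = -s, with n - 5s² = -4s²
  -- each time. The resulting -8 ∑ (-1)^s s² cancels -4 times the value -2 ∑ (-1)^s s² found for G.
  twist-J : ∀ n → n ≤ + B → twist J n ≡ + 0
  twist-J n n≤B = begin
    twist J n
      ≡⟨ ∑-cong (intRange B) (λ k → linear (sgnℤ k) (n - + 5 * (k * k)) (δ₀ (n - k * k)) (σ (n - k * k))) ⟩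
    ∑ (intRange B) (λ k → sgnℤ k * ((n - + 5 * (k * k)) * δ₀ (n - k * k)) + - (+ 4) * (sgnℤ k * ((n - + 5 * (k * k)) * σ (n - k * k))))
      ≡⟨ ∑-+ (intRange B) (λ k → sgnℤ k * ((n - + 5 * (k * k)) * δ₀ (n - k * k))) (λ k → - (+ 4) * (sgnℤ k * ((n - + 5 * (k * k)) * σ (n - k * k)))) ⟩
    twist δ₀ n + ∑ (intRange B) (λ k → - (+ 4) * (sgnℤ k * ((n - + 5 * (k * k)) * σ (n - k * k))))
      ≡⟨ cong₂ _+_ twist-δ₀ (trans (∑-*ˡ (- (+ 4)) (intRange B) (λ k → sgnℤ k * ((n - + 5 * (k * k)) * σ (n - k * k)))) (cong (- (+ 4) *_) (trans twist-σ ∑G-closed))) ⟩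
    - (+ 8) * R + - (+ 4) * (- (+ 2) * R)
      ≡⟨ cancel R ⟩
    + 0 ∎
    where
    open Windmill B n n≤B
    R = ∑ roots (λ s → sgn s * (+ s * + s))
    linear : ∀ s m a b → s * (m * (a + - (+ 4) * b)) ≡ s * (m * a) + - (+ 4) * (s * (m * b))
    linear = solve-∀
    cancel : ∀ r → - (+ 8) * r + - (+ 4) * (- (+ 2) * r) ≡ + 0
    cancel = solve-∀
    twist-δ₀ : twist δ₀ n ≡ - (+ 8) * R
    twist-δ₀ = begin
      twist δ₀ n
        ≡⟨ ∑-intRange B Kδ ⟩
      Kδ (+ 0) + (∑ (rng B) (Kδ ∘ +_) + ∑ (rng B) (Kδ ∘ neg+))
        ≡⟨ cong₂ _+_ at0 (cong₂ _+_ (∑-cong (rng B) at+) (trans (∑-cong (rng B) at-) (∑-cong (rng B) at+))) ⟩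
      + 0 + (∑ (rng B) (λ s → - (+ 4) * root s) + ∑ (rng B) (λ s → - (+ 4) * root s))
        ≡⟨ cong (λ x → + 0 + (x + x)) (trans (∑-*ˡ (- (+ 4)) (rng B) root) (cong (- (+ 4) *_) (sym (∑-filter-roots B n (λ s → sgn s * (+ s * + s)))))) ⟩
      + 0 + (- (+ 4) * R + - (+ 4) * R)
        ≡⟨ double′ R ⟩
      - (+ 8) * R ∎
      where
      Kδ : ℤ → ℤ
      Kδ k = sgnℤ k * ((n - + 5 * (k * k)) * δ₀ (n - k * k))
      root : ℕ → ℤ
      root s = 𝟙 (+ s * + s ℤP.≟ n) * (sgn s * (+ s * + s))
      double′ : ∀ r → + 0 + (- (+ 4) * r + - (+ 4) * r) ≡ - (+ 8) * r
      double′ = solve-∀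
      at0 : Kδ (+ 0) ≡ + 0
      at0 with n - + 0 * + 0 ℤP.≟ + 0
      ... | yes eq = trans (cong (λ m → + 1 * (m * + 1)) eq) refl
      ... | no _   = cong (+ 1 *_) (ℤP.*-zeroʳ (n - + 5 * (+ 0 * + 0)))
      at- : ∀ s → Kδ (- + s) ≡ Kδ (+ s)
      at- s = cong₂ (λ a q → a * ((n - + 5 * q) * δ₀ (n - q))) (cong sgn (ℤP.∣-i∣≡∣i∣ (+ s))) (sq (+ s))
        where
        sq : ∀ x → - x * - x ≡ x * x
        sq = solve-∀
      at+ : ∀ s → Kδ (+ s) ≡ - (+ 4) * root s
      at+ s with + s * + s ℤP.≟ n
      ... | yes refl = trans (cong (λ i → sgn s * ((q - + 5 * q) * i)) (𝟙-yes (q - q ℤP.≟ + 0) (ℤP.+-inverseʳ q))) (ring (sgn s) q)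
        where
        q = + s * + s
        ring : ∀ a q → a * ((q - + 5 * q) * + 1) ≡ - (+ 4) * (+ 1 * (a * q))
        ring = solve-∀
      ... | no ne = trans (cong (λ i → sgn s * ((n - + 5 * (+ s * + s)) * i)) (𝟙-no (n - + s * + s ℤP.≟ + 0) (λ eq → ne (sym (ℤP.i-j≡0⇒i≡j n (+ s * + s) eq))))) (ring (sgn s) (n - + 5 * (+ s * + s)) (+ s * + s))
        where
        ring : ∀ a x q → a * (x * + 0) ≡ - (+ 4) * (+ 0 * (a * q))
        ring = solve-∀
    twist-σ : ∑ (intRange B) (λ k → sgnℤ k * ((n - + 5 * (k * k)) * σ (n - k * k))) ≡ ∑ T G
    twist-σ = sym (begin
      ∑ T G
        ≡⟨ ∑-filter onQuadric? (dpairs (intRange B) (λ _ → dpairs P (λ _ → P))) G ⟩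
      ∑ (dpairs (intRange B) (λ _ → dpairs P (λ _ → P))) (λ x → 𝟙 (onQuadric? x) * G x)
        ≡⟨ ∑-dpairs (intRange B) (λ _ → dpairs P (λ _ → P)) (λ x → 𝟙 (onQuadric? x) * G x) ⟩
      ∑ (intRange B) (λ k → ∑ (dpairs P (λ _ → P)) (λ y → 𝟙 (onQuadric? (k , y)) * G (k , y)))
        ≡⟨ ∑-cong (intRange B) (λ k → ∑-dpairs P (λ _ → P) (λ y → 𝟙 (onQuadric? (k , y)) * G (k , y))) ⟩
      ∑ (intRange B) (λ k → ∑ P (λ d → ∑ P (λ e → 𝟙 (onQuadric? (k , d , e)) * G (k , d , e))))
        ≡⟨ ∑-cong (intRange B) (λ k → trans (∑-cong P (λ d → trans (∑-cong P (λ e → pull k d e)) (∑-*ˡ (c k) P _))) (∑-*ˡ (c k) P _)) ⟩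
      ∑ (intRange B) (λ k → c k * σ (n - k * k))
        ≡⟨ ∑-cong (intRange B) (λ k → ℤP.*-assoc (sgnℤ k) (n - + 5 * (k * k)) (σ (n - k * k))) ⟩
      ∑ (intRange B) (λ k → sgnℤ k * ((n - + 5 * (k * k)) * σ (n - k * k))) ∎)
      where
      P = positives B
      c : ℤ → ℤ
      c k = sgnℤ k * (n - + 5 * (k * k))
      pull : ∀ k d e → 𝟙 (onQuadric? (k , d , e)) * G (k , d , e) ≡ c k * (𝟙 (d * e ℤP.≟ n - k * k) * (sgnℤ (d + e) * (d + e)))
      pull k d e = trans (cong₂ (λ i s → i * (s * ((n - + 5 * (k * k)) * (d + e))))
          (𝟙-cong (k * k + d * e ℤP.≟ n) (d * e ℤP.≟ n - k * k) (λ eq → trans (r₁ (k * k) (d * e)) (cong (_- k * k) eq)) (λ eq → trans (cong (_+_ (k * k)) eq) (r₂ (k * k) n)))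
          (trans (cong sgnℤ (ℤP.+-assoc k d e)) (sgnℤ-+ k (d + e))))
        (r₃ (𝟙 (d * e ℤP.≟ n - k * k)) (sgnℤ k) (sgnℤ (d + e)) (n - + 5 * (k * k)) (d + e))
        where
        r₁ : ∀ q x → x ≡ q + x - q
        r₁ = solve-∀
        r₂ : ∀ q n → q + (n - q) ≡ n
        r₂ = solve-∀
        r₃ : ∀ i s s′ m x → i * ((s * s′) * (m * x)) ≡ s * m * (i * (s′ * x))
        r₃ = solve-∀

  -- θ⁴ and J satisfy the same linear differential equation, for J because `twist-J` vanishes, and
  -- both have constant term 1.
  jacobi : ∀ n → n ≤ + B → Θ (Θ (Θ (Θ δ₀))) n ≡ J n
  jacobi n n≤B = ℤP.i-j≡0⇒i≡j (Θ⁴ n) (J n) (trans (ring (Θ⁴ n) (J n)) (ode-unique (+ 4) negative at0 ode n n≤B))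
    where
    Θ⁴ e : ℤ → ℤ
    Θ⁴ = Θ (Θ (Θ (Θ δ₀)))
    e m = Θ⁴ m + - (+ 1) * J m
    ring : ∀ a b → a - b ≡ a + - (+ 1) * b
    ring = solve-∀
    negΘ : ∀ m → m < + 0 → Θ⁴ m ≡ + 0
    negΘ = Θ-negative (Θ (Θ (Θ δ₀))) (Θ-negative (Θ (Θ δ₀)) (Θ-negative (Θ δ₀) (Θ-negative δ₀ δ₀-negative)))
    negative : ∀ m → m < + 0 → e m ≡ + 0
    negative m m<0 = cong₂ (λ a b → a + - (+ 1) * b) (negΘ m m<0) (cong₂ (λ a b → a + - (+ 4) * b) (δ₀-negative m m<0) (σ-nonpositive m (ℤP.<⇒≤ m<0)))
    at0 : e (+ 0) ≡ + 0
    at0 = cong₂ (λ a b → a + - (+ 1) * (+ 1 + - (+ 4) * b))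
      (trans (Θ-head (Θ (Θ (Θ δ₀))) (+ 0) (Θ-negative (Θ (Θ δ₀)) (Θ-negative (Θ δ₀) (Θ-negative δ₀ δ₀-negative))))
        (trans (Θ-head (Θ (Θ δ₀)) (+ 0) (Θ-negative (Θ δ₀) (Θ-negative δ₀ δ₀-negative)))
          (trans (Θ-head (Θ δ₀) (+ 0) (Θ-negative δ₀ δ₀-negative)) (Θ-head δ₀ (+ 0) δ₀-negative))))
      (σ-nonpositive (+ 0) ℤP.≤-refl)
    ode : ∀ m → m ≤ + B → Θ (D e) m ≡ + 4 * Θ′ e m
    ode m m≤B = begin
      Θ (D e) m
        ≡⟨ Θ-cong (λ x → distrib x (Θ⁴ x) (J x)) m ⟩
      Θ (λ x → D Θ⁴ x + - (+ 1) * D J x) m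
        ≡⟨ trans (Θ-+ (D Θ⁴) (λ x → - (+ 1) * D J x) m) (cong (_+_ (Θ (D Θ⁴) m)) (Θ-* (- (+ 1)) (D J) m)) ⟩
      Θ (D Θ⁴) m + - (+ 1) * Θ (D J) m
        ≡⟨ cong₂ (λ a b → a + - (+ 1) * b) (Θ⁴-ode m) (trans (twist-ode J m) (trans (cong (_+_ (+ 4 * Θ′ J m)) (twist-J m m≤B)) (ℤP.+-identityʳ _))) ⟩
      + 4 * Θ′ Θ⁴ m + - (+ 1) * (+ 4 * Θ′ J m)
        ≡⟨ collect′ (Θ′ Θ⁴ m) (Θ′ J m) ⟩
      + 4 * (Θ′ Θ⁴ m + - (+ 1) * Θ′ J m)
        ≡⟨ cong (+ 4 *_) (sym (trans (Θ′-+ Θ⁴ (λ x → - (+ 1) * J x) m) (cong (_+_ (Θ′ Θ⁴ m)) (Θ′-* (- (+ 1)) J m)))) ⟩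
      + 4 * Θ′ e m ∎
      where
      distrib : ∀ x a b → x * (a + - (+ 1) * b) ≡ x * a + - (+ 1) * (x * b)
      distrib = solve-∀
      collect′ : ∀ a b → + 4 * a + - (+ 1) * (+ 4 * b) ≡ + 4 * (a + - (+ 1) * b)
      collect′ = solve-∀

-- A number d is a + b in d - 1 ways; the added copy of g raises the multiplicity to d.
∑△-count : ∀ B (g : ℕ → ℤ) → ∑△ B (λ a b → g (a +ℕ b)) + ∑ (rng B) g ≡ ∑ (rng B) (λ d → + d * g d)
∑△-count zero    g = refl
∑△-count (suc B) g = begin
  ∑△ (suc B) (λ a b → g (a +ℕ b)) + (g (suc B) + ∑ (rng B) g)
    ≡⟨ cong (_+ (g (suc B) + ∑ (rng B) g)) (trans (∑△-suc B (λ a b → g (a +ℕ b))) (cong (_+ ∑△ B (λ a b → g (a +ℕ b)))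
         (trans (∑-cong∈ (rng B) (λ {a} a∈ → cong g (trans (ℕP.+-suc a (B ∸ℕ a)) (cong suc (ℕP.m+[n∸m]≡n (proj₂ (∈-rng⁻ B a∈)))))))
           (trans (∑-const (g (suc B)) (rng B)) (cong (λ l → + l * g (suc B)) (rng-length B)))))) ⟩
  (+ B * g (suc B) + ∑△ B (λ a b → g (a +ℕ b))) + (g (suc B) + ∑ (rng B) g)
    ≡⟨ ring (+ B) (g (suc B)) (∑△ B (λ a b → g (a +ℕ b))) (∑ (rng B) g) ⟩
  (+ 1 + + B) * g (suc B) + (∑△ B (λ a b → g (a +ℕ b)) + ∑ (rng B) g)
    ≡⟨ cong₂ (λ b s → b * g (suc B) + s) (sym (ℤP.pos-+ 1 B)) (∑△-count B g) ⟩
  + suc B * g (suc B) + ∑ (rng B) (λ d → + d * g d) ∎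
  where
  rng-length : ∀ B → length (rng B) ≡ B
  rng-length zero    = refl
  rng-length (suc B) = cong suc (rng-length B)
  ring : ∀ b x t r → (b * x + t) + (x + r) ≡ (+ 1 + b) * x + (t + r)
  ring = solve-∀

∑-cube : (I : List ℤ) (f : ℤ × ℤ × ℤ → ℤ) →
  ∑ (concatMap (λ x → concatMap (λ y → map (λ z → (x , y , z)) I) I) I) f ≡ ∑ I (λ x → ∑ I (λ y → ∑ I (λ z → f (x , y , z))))
∑-cube I f = trans (∑-concatMap (λ x → concatMap (λ y → map (λ z → (x , y , z)) I) I) I f)
  (∑-cong I (λ x → trans (∑-concatMap (λ y → map (λ z → (x , y , z)) I) I f) (∑-cong I (λ y → ∑-map (λ z → (x , y , z)) I f))))

∑-nested : (I : List ℤ) (s : ℤ → ℤ) (f : ℤ → ℤ → ℤ → ℤ) →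
  ∑ I (λ x → s x * ∑ I (λ y → s y * ∑ I (λ z → s z * f x y z))) ≡ ∑ I (λ x → ∑ I (λ y → ∑ I (λ z → s x * (s y * (s z * f x y z)))))
∑-nested I s f = ∑-cong I (λ x → trans (sym (∑-*ˡ (s x) I (λ y → s y * ∑ I (λ z → s z * f x y z))))
  (∑-cong I (λ y → trans (cong (s x *_) (sym (∑-*ˡ (s y) I (λ z → s z * f x y z)))) (sym (∑-*ˡ (s x) I (λ z → s y * (s z * f x y z)))))))

-- The cube of theta as a signed count on xy + yz + zx

module Gauss (B : ℕ) where
  open Jacobi B

  private
    R = rng B
    module C (n : ℤ) = Combine B n

  ⟪_⟫ : Σ ℕ Cone → ℤ → ℤ
  ⟪ c ⟫ n = C.evalΣ n c

  -- The candidate for θ³. Up to sign, 4 and 6 are half of 8 and of 3 · 4: in `h4` an interior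
  -- triple has weight 8, and on each of the three faces with one zero coordinate the weight is 4.
  P : ℤ → ℤ
  P n = δ₀ n + (- (+ 4) * ⟪ xy+yz+zx ⟫ n + - (+ 6) * ⟪ xy ⟫ n)

  -- Only k > 0 is kept because the variables of a cone are positive.
  Θ⁺ : (ℤ → ℤ) → ℤ → ℤ
  Θ⁺ f n = ∑ R (λ k → sgn k * f (n - + k * + k))

  Θ≡Θ⁺ : ∀ f n → Θ f n ≡ f n + + 2 * Θ⁺ f n
  Θ≡Θ⁺ f n = begin
    Θ f n ≡⟨ ∑-intRange B (λ k → sgnℤ k * f (n - k * k)) ⟩
    + 1 * f (n - + 0) + (Θ⁺ f n + ∑ R (λ k → sgnℤ (- + k) * f (n - - + k * - + k)))
      ≡⟨ cong₂ (λ a b → + 1 * f a + (Θ⁺ f n + b)) (ℤP.+-identityʳ n)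
           (∑-cong R (λ k → cong₂ (λ s q → s * f (n - q)) (cong sgn (ℤP.∣-i∣≡∣i∣ (+ k))) (sq (+ k)))) ⟩
    + 1 * f n + (Θ⁺ f n + Θ⁺ f n) ≡⟨ ring (f n) (Θ⁺ f n) ⟩
    f n + + 2 * Θ⁺ f n ∎
    where
    sq : ∀ x → - x * - x ≡ x * x
    sq = solve-∀
    ring : ∀ a b → + 1 * a + (b + b) ≡ a + + 2 * b
    ring = solve-∀

  Θ⁺-+ : ∀ f g n → Θ⁺ (λ m → f m + g m) n ≡ Θ⁺ f n + Θ⁺ g n
  Θ⁺-+ f g n = trans (∑-cong R (λ k → ℤP.*-distribˡ-+ (sgn k) (f (n - + k * + k)) (g (n - + k * + k)))) (∑-+ R (λ k → sgn k * f (n - + k * + k)) (λ k → sgn k * g (n - + k * + k)))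

  Θ⁺-* : ∀ c f n → Θ⁺ (λ m → c * f m) n ≡ c * Θ⁺ f n
  Θ⁺-* c f n = trans (∑-cong R (λ k → *-exchange (sgn k) c (f (n - + k * + k)))) (∑-*ˡ c R (λ k → sgn k * f (n - + k * + k)))

  shift-𝟙 : ∀ k {v v′ : ℕ} n → v ≡ k *ℕ k +ℕ v′ → 𝟙 (+ v ℤP.≟ n) ≡ 𝟙 (+ v′ ℤP.≟ n - + k * + k)
  shift-𝟙 k {v} {v′} n refl = 𝟙-cong (+ v ℤP.≟ n) (+ v′ ℤP.≟ n - + k * + k)
    (λ eq → trans (r₁ (+ k * + k) (+ v′)) (cong (_- + k * + k) (trans (sym expand′) eq)))
    (λ eq → trans expand′ (trans (cong (_+_ (+ k * + k)) eq) (r₂ (+ k * + k) n)))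
    where
    expand′ : + (k *ℕ k +ℕ v′) ≡ + k * + k + + v′
    expand′ = trans (ℤP.pos-+ (k *ℕ k) v′) (cong (_+ + v′) (ℤP.pos-* k k))
    r₁ : ∀ q x → x ≡ q + x - q
    r₁ = solve-∀
    r₂ : ∀ q n → q + (n - q) ≡ n
    r₂ = solve-∀

  -- Adding a square variable to a cone is multiplication by the positive half of θ.
  square-cone : ∀ {j} (c : Cone j) v → (∀ m → dot v m ≡ 0) → ∀ n → Θ⁺ ⟪ _ , c ⟫ n ≡ ⟪ _ , cone 1 true v c ⟫ n
  square-cone {j} c v v≡0 n = sym (∑-cong R (λ k → trans
    (C.∑ⁿ-cong n j (λ m → trans
      (cong (_* (sgn k * parity c m)) (shift-𝟙 k n (trans (cong (λ d → 1 *ℕ (k *ℕ k) +ℕ k *ℕ d +ℕ val c m) (v≡0 m)) (ring k (val c m)))))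
      (*-exchange (𝟙 (+ val c m ℤP.≟ n - + k * + k)) (sgn k) (parity c m))))
    (C.∑ⁿ-*ˡ n (sgn k) j (C.term (n - + k * + k) c))))
    where
    ring : ∀ k v → 1 *ℕ (k *ℕ k) +ℕ k *ℕ 0 +ℕ v ≡ k *ℕ k +ℕ v
    ring = ℕ-solve-∀

  Θ⁺-δ₀ : ∀ n → Θ⁺ δ₀ n ≡ ⟪ k² ⟫ n
  Θ⁺-δ₀ n = sym (∑-cong R (λ k → trans
    (cong (_* (sgn k * + 1)) (trans (shift-𝟙 k {v′ = 0} n (ring k)) (𝟙-cong (+ 0 ℤP.≟ n - + k * + k) (n - + k * + k ℤP.≟ + 0) sym sym)))
    (trans (*-exchange (δ₀ (n - + k * + k)) (sgn k) (+ 1)) (cong (sgn k *_) (ℤP.*-identityʳ (δ₀ (n - + k * + k)))))))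
    where
    ring : ∀ k → 1 *ℕ (k *ℕ k) +ℕ k *ℕ 0 +ℕ 0 ≡ k *ℕ k +ℕ 0
    ring = ℕ-solve-∀

  -- In the sum over de = n a factor d is removed by writing d as a + b in all ways (`∑△-count`),
  -- which leaves cone sums. The factors d and e contribute equally, whence the 2.
  σ-cones : ∀ n → n ≤ + B → σ n ≡ + 2 * (⟪ zx+zy ⟫ n + ⟪ xy ⟫ n)
  σ-cones n n≤B = begin
    σ n
      ≡⟨ trans (∑-map +_ R _) (∑-cong R (λ d → ∑-map +_ R _)) ⟩
    ∑ R (λ d → ∑ R (λ e → 𝟙 (+ d * + e ℤP.≟ n) * (sgnℤ (+ d + + e) * (+ d + + e))))
      ≡⟨ ∑-cong R (λ d → trans (∑-cong R (λ e → spread d e)) (∑-+ R (λ e → + d * g e d) (λ e → + e * g d e))) ⟩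
    ∑ R (λ d → ∑ R (λ e → + d * g e d) + ∑ R (λ e → + e * g d e))
      ≡⟨ ∑-+ R (λ d → ∑ R (λ e → + d * g e d)) (λ d → ∑ R (λ e → + e * g d e)) ⟩
    ∑ R (λ d → ∑ R (λ e → + d * g e d)) + ∑ R (λ d → ∑ R (λ e → + e * g d e))
      ≡⟨ cong (_+ ∑ R (λ d → ∑ R (λ e → + e * g d e))) (∑-swap R R (λ d e → + d * g e d)) ⟩
    ∑ R (λ e → ∑ R (λ d → + d * g e d)) + ∑ R (λ e → ∑ R (λ d → + d * g e d))
      ≡⟨ cong (λ s → s + s) (trans (∑-cong∈ R (λ {e} e∈ → sym (trans (cong (_+ ∑ R (g e)) (sym (∑△-full B (λ {a} b a∈ lt → vanish e a b (proj₁ (∈-rng⁻ B e∈)) lt)))) (∑△-count B (g e))))) (∑-+ R (λ e → ∑ R (λ a → ∑ R (λ b → g e (a +ℕ b)))) (λ e → ∑ R (g e)))) ⟩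
    (X + Y) + (X + Y)
      ≡⟨ cong₂ (λ x y → (x + y) + (x + y)) (∑-cong R (λ e → ∑-cong R (λ a → ∑-cong R (λ b → toX e a b)))) (∑-cong R (λ e → ∑-cong R (λ d → toY e d))) ⟩
    (⟪ zx+zy ⟫ n + ⟪ xy ⟫ n) + (⟪ zx+zy ⟫ n + ⟪ xy ⟫ n)
      ≡⟨ twice (⟪ zx+zy ⟫ n + ⟪ xy ⟫ n) ⟩
    + 2 * (⟪ zx+zy ⟫ n + ⟪ xy ⟫ n) ∎
    where
    g : ℕ → ℕ → ℤ
    g e d = 𝟙 (+ (e *ℕ d) ℤP.≟ n) * (sgn e * sgn d)
    X = ∑ R (λ e → ∑ R (λ a → ∑ R (λ b → g e (a +ℕ b))))
    Y = ∑ R (λ e → ∑ R (g e))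
    twice : ∀ x → x + x ≡ + 2 * x
    twice = solve-∀
    spread : ∀ d e → 𝟙 (+ d * + e ℤP.≟ n) * (sgnℤ (+ d + + e) * (+ d + + e)) ≡ + d * g e d + + e * g d e
    spread d e rewrite sgn-+ d e | sym (ℤP.pos-* d e) | ℕP.*-comm e d = ring (𝟙 (+ (d *ℕ e) ℤP.≟ n)) (sgn d) (sgn e) (+ d) (+ e)
      where
      ring : ∀ i s s′ x y → i * ((s * s′) * (x + y)) ≡ x * (i * (s′ * s)) + y * (i * (s * s′))
      ring = solve-∀
    vanish : ∀ e a b → 1 ≤ℕ e → B <ℕ b +ℕ a → g e (a +ℕ b) ≡ + 0
    vanish e a b 1≤e lt = cong (_* (sgn e * sgn (a +ℕ b))) (𝟙-no (+ (e *ℕ (a +ℕ b)) ℤP.≟ n)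
      (λ { refl → ℕP.<⇒≱ (ℕP.<-≤-trans lt (ℕP.≤-trans (ℕP.≤-reflexive (ℕP.+-comm b a)) (ℕP.≤-trans (m≤m*n (a +ℕ b) 1≤e) (ℕP.≤-reflexive (ℕP.*-comm (a +ℕ b) e))))) (ℤP.drop‿+≤+ n≤B) }))
    toX : ∀ e a b → g e (a +ℕ b) ≡ C.term n (proj₂ zx+zy) (e ∷ a ∷ b ∷ [])
    toX e a b = cong₂ (λ v s → 𝟙 (+ v ℤP.≟ n) * s) (ring e a b) (trans (cong (sgn e *_) (sgn-+ a b)) (assoc (sgn e) (sgn a) (sgn b)))
      where
      ring : ∀ e a b → e *ℕ (a +ℕ b) ≡ e *ℕ (1 *ℕ a +ℕ (1 *ℕ b +ℕ 0)) +ℕ (a *ℕ (0 *ℕ b +ℕ 0) +ℕ (b *ℕ 0 +ℕ 0))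
      ring = ℕ-solve-∀
      assoc : ∀ s t r → s * (t * r) ≡ s * (t * (r * + 1))
      assoc = solve-∀
    toY : ∀ e d → g e d ≡ C.term n (proj₂ xy) (e ∷ d ∷ [])
    toY e d = cong₂ (λ v s → 𝟙 (+ v ℤP.≟ n) * s) (ring e d) (cong (sgn e *_) (sym (ℤP.*-identityʳ (sgn d))))
      where
      ring : ∀ e d → e *ℕ d ≡ e *ℕ (1 *ℕ d +ℕ 0) +ℕ (d *ℕ 0 +ℕ 0)
      ring = ℕ-solve-∀

  -- Once θ is split as 1 + 2 Θ⁺, the difference of the two sides is -2 times the value of
  -- `classRelation`.
  ΘP≡J : ∀ n → n ≤ + B → Θ P n ≡ J n
  ΘP≡J n n≤B = ℤP.i-j≡0⇒i≡j (Θ P n) (J n) (begin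
    Θ P n - J n
      ≡⟨ cong₂ _-_ (trans (Θ≡Θ⁺ P n) (cong (λ s → P n + + 2 * s) Θ⁺P)) (cong (λ s → δ₀ n + - (+ 4) * s) (σ-cones n n≤B)) ⟩
    (δ₀ n + (- (+ 4) * e₂ + - (+ 6) * e₄)) + + 2 * (e₆ + (- (+ 4) * e₁ + - (+ 6) * e₃)) - (δ₀ n + - (+ 4) * (+ 2 * (e₅ + e₄)))
      ≡⟨ ring (δ₀ n) e₁ e₂ e₃ e₄ e₅ e₆ ⟩
    - (+ 2) * (+ 4 * e₁ + (+ 2 * e₂ + (+ 6 * e₃ + (- + 1 * e₄ + (- + 4 * e₅ + (- + 1 * e₆ + + 0))))))
      ≡⟨ cong (- (+ 2) *_) (classRelation-zero B n n≤B) ⟩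
    - (+ 2) * + 0 ≡⟨ refl ⟩
    + 0 ∎)
    where
    e₁ = ⟪ k²+xy+yz+zx ⟫ n
    e₂ = ⟪ xy+yz+zx ⟫ n
    e₃ = ⟪ k²+xy ⟫ n
    e₄ = ⟪ xy ⟫ n
    e₅ = ⟪ zx+zy ⟫ n
    e₆ = ⟪ k² ⟫ n
    Θ⁺P : Θ⁺ P n ≡ e₆ + (- (+ 4) * e₁ + - (+ 6) * e₃)
    Θ⁺P = trans (Θ⁺-+ δ₀ (λ m → - (+ 4) * ⟪ xy+yz+zx ⟫ m + - (+ 6) * ⟪ xy ⟫ m) n) (cong₂ _+_ (Θ⁺-δ₀ n)
      (trans (Θ⁺-+ (λ m → - (+ 4) * ⟪ xy+yz+zx ⟫ m) (λ m → - (+ 6) * ⟪ xy ⟫ m) n) (cong₂ _+_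
        (trans (Θ⁺-* (- (+ 4)) ⟪ xy+yz+zx ⟫ n) (cong (- (+ 4) *_) (square-cone (proj₂ xy+yz+zx) (0 ∷ 0 ∷ 0 ∷ []) (λ { (_ ∷ _ ∷ _ ∷ []) → refl }) n)))
        (trans (Θ⁺-* (- (+ 6)) ⟪ xy ⟫ n) (cong (- (+ 6) *_) (square-cone (proj₂ xy) (0 ∷ 0 ∷ []) (λ { (_ ∷ _ ∷ []) → refl }) n))))))
    ring : ∀ d e₁ e₂ e₃ e₄ e₅ e₆ →
      (d + (- (+ 4) * e₂ + - (+ 6) * e₄)) + + 2 * (e₆ + (- (+ 4) * e₁ + - (+ 6) * e₃)) - (d + - (+ 4) * (+ 2 * (e₅ + e₄))) ≡
      - (+ 2) * (+ 4 * e₁ + (+ 2 * e₂ + (+ 6 * e₃ + (- + 1 * e₄ + (- + 4 * e₅ + (- + 1 * e₆ + + 0))))))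
    ring = solve-∀

  evalΣ-negative : ∀ c n → n < + 0 → ⟪ c ⟫ n ≡ + 0
  evalΣ-negative (j , c) n n<0 = C.∑ⁿ-zero n j (λ {m} _ → cong (_* parity c m) (𝟙-no (+ val c m ℤP.≟ n) (λ { refl → case n<0 of λ { (+<+ ()) } })))

  -- Both θ · P and θ · θ³ equal J, and θ can be cancelled.
  P≡Θ³ : ∀ n → n ≤ + B → P n ≡ Θ (Θ (Θ δ₀)) n
  P≡Θ³ n n≤B = ℤP.i-j≡0⇒i≡j (P n) (Θ³ n) (trans (ring (P n) (Θ³ n)) (Θ-injective negative zero-image n n≤B))
    where
    Θ³ e : ℤ → ℤ
    Θ³ = Θ (Θ (Θ δ₀))
    e m = P m + - (+ 1) * Θ³ m
    ring : ∀ a b → a - b ≡ a + - (+ 1) * b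
    ring = solve-∀
    negative : ∀ m → m < + 0 → e m ≡ + 0
    negative m m<0 = cong₂ (λ a b → a + - (+ 1) * b)
      (cong₂ _+_ (δ₀-negative m m<0) (cong₂ (λ a b → - (+ 4) * a + - (+ 6) * b) (evalΣ-negative xy+yz+zx m m<0) (evalΣ-negative xy m m<0)))
      (Θ-negative (Θ (Θ δ₀)) (Θ-negative (Θ δ₀) (Θ-negative δ₀ δ₀-negative)) m m<0)
    zero-image : ∀ m → m ≤ + B → Θ e m ≡ + 0
    zero-image m m≤B = trans (Θ-+ P (λ x → - (+ 1) * Θ³ x) m) (trans (cong₂ _+_ (trans (ΘP≡J m m≤B) (sym (jacobi m m≤B))) (Θ-* (- (+ 1)) Θ³ m)) (cancel (Θ Θ³ m)))
      where
      cancel : ∀ x → x + - (+ 1) * x ≡ + 0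
      cancel = solve-∀

  -- Since (-1)^(x+y+z) = (-1)^(x²+y²+z²), every term carries the sign (-1)ⁿ. The bound is B = n
  -- because `r3 n` searches the cube of `intRange n`.
  r3-series : (n : ℕ) → n ≡ B → Θ (Θ (Θ δ₀)) (+ n) ≡ sgn n * + r3 n
  r3-series n refl = begin
    Θ (Θ (Θ δ₀)) (+ n)
      ≡⟨ ∑-nested I sgnℤ (λ x y z → δ₀ (+ n - x * x - y * y - z * z)) ⟩
    ∑ I (λ x → ∑ I (λ y → ∑ I (λ z → sgnℤ x * (sgnℤ y * (sgnℤ z * δ₀ (+ n - x * x - y * y - z * z))))))
      ≡⟨ ∑-cong I (λ x → ∑-cong I (λ y → ∑-cong I (λ z → sign x y z))) ⟩
    ∑ I (λ x → ∑ I (λ y → ∑ I (λ z → 𝟙 (sq (x , y , z) ℤP.≟ + n) * sgn n)))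
      ≡⟨ sym (∑-cube I (λ t → 𝟙 (sq t ℤP.≟ + n) * sgn n)) ⟩
    ∑ cube (λ t → 𝟙 (sq t ℤP.≟ + n) * sgn n)
      ≡⟨ trans (∑-cong cube (λ t → cong (𝟙 (sq t ℤP.≟ + n) *_) (sym (ℤP.*-identityˡ (sgn n))))) (sym (∑-filter (λ t → sq t ℤP.≟ + n) cube (λ _ → + 1 * sgn n))) ⟩
    ∑ (filter (λ t → sq t ℤP.≟ + n) cube) (λ _ → + 1 * sgn n)
      ≡⟨ trans (∑-*ʳ (sgn n) (filter (λ t → sq t ℤP.≟ + n) cube) (λ _ → + 1)) (cong (_* sgn n) (sym (length≡∑ (filter (λ t → sq t ℤP.≟ + n) cube)))) ⟩
    + r3 n * sgn n ≡⟨ ℤP.*-comm (+ r3 n) (sgn n) ⟩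
    sgn n * + r3 n ∎
    where
    I = intRange n
    sq : ℤ × ℤ × ℤ → ℤ
    sq (x , y , z) = x * x + y * y + z * z
    cube : List (ℤ × ℤ × ℤ)
    cube = concatMap (λ x → concatMap (λ y → map (λ z → (x , y , z)) I) I) I
    sgn-square : ∀ x → sgnℤ (x * x) ≡ sgnℤ x
    sgn-square x = trans (cong sgnℤ (square-∣∣ x)) (nat ∣ x ∣)
      where
      nat : ∀ k → sgn (k *ℕ k) ≡ sgn k
      nat zero    = refl
      nat (suc k) = cong -_ (trans (sgn-+ k (k *ℕ suc k)) (trans (cong (λ m → sgn k * sgn m) (ℕP.*-suc k k)) (trans (cong (sgn k *_) (trans (sgn-+ k (k *ℕ k)) (cong (sgn k *_) (nat k)))) (trans (cong (sgn k *_) (sgn² k)) (ℤP.*-identityʳ (sgn k))))))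
    sign : ∀ x y z → sgnℤ x * (sgnℤ y * (sgnℤ z * δ₀ (+ n - x * x - y * y - z * z))) ≡ 𝟙 (sq (x , y , z) ℤP.≟ + n) * sgn n
    sign x y z with sq (x , y , z) ℤP.≟ + n
    ... | yes eq = begin
      sgnℤ x * (sgnℤ y * (sgnℤ z * δ₀ (+ n - x * x - y * y - z * z)))
        ≡⟨ cong (λ i → sgnℤ x * (sgnℤ y * (sgnℤ z * i))) (𝟙-yes (+ n - x * x - y * y - z * z ℤP.≟ + 0) (trans (cong (λ m → m - x * x - y * y - z * z) (sym eq)) (ring (x * x) (y * y) (z * z)))) ⟩
      sgnℤ x * (sgnℤ y * (sgnℤ z * + 1))
        ≡⟨ assoc (sgnℤ x) (sgnℤ y) (sgnℤ z) ⟩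
      + 1 * (sgnℤ x * sgnℤ y * sgnℤ z)
        ≡⟨ cong (+ 1 *_) (sym (trans (cong sgnℤ (sym eq)) (trans (sgnℤ-+ (x * x + y * y) (z * z)) (cong₂ _*_ (trans (sgnℤ-+ (x * x) (y * y)) (cong₂ _*_ (sgn-square x) (sgn-square y))) (sgn-square z))))) ⟩
      + 1 * sgn n ∎
      where
      ring : ∀ a b c → a + b + c - a - b - c ≡ + 0
      ring = solve-∀
      assoc : ∀ a b c → a * (b * (c * + 1)) ≡ + 1 * (a * b * c)
      assoc = solve-∀
    ... | no ne = trans (cong (λ i → sgnℤ x * (sgnℤ y * (sgnℤ z * i))) (𝟙-no (+ n - x * x - y * y - z * z ℤP.≟ + 0) (λ eq → ne (sym (trans (ring (x * x) (y * y) (z * z) (+ n)) (trans (cong (_+ (x * x + y * y + z * z)) eq) (ℤP.+-identityˡ _))))))) (zeros (sgnℤ x) (sgnℤ y) (sgnℤ z) (sgn n))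
      where
      ring : ∀ a b c n → n ≡ (n - a - b - c) + (a + b + c)
      ring = solve-∀
      zeros : ∀ a b c s → a * (b * (c * + 0)) ≡ + 0 * s
      zeros = solve-∀

-- The three squares formula

-- Twice the unit step with value 1/2 at 0. By ς(x) + ς(-x) = 2, a form on a wall between two
-- reduction domains is shared equally by both.
ς : ℤ → ℤ
ς (+ 0)      = + 1
ς (+[1+ _ ]) = + 2
ς (-[1+ _ ]) = + 0

sgn-cases : ∀ n → sgn n ≡ + 1 ⊎ sgn n ≡ - + 1
sgn-cases zero    = inj₁ refl
sgn-cases (suc n) with sgn-cases n
... | inj₁ eq = inj₂ (cong -_ eq)
... | inj₂ eq = inj₁ (cong -_ eq)

sgn-*-even : ∀ m n → sgn m ≡ + 1 → sgn (m *ℕ n) ≡ + 1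
sgn-*-odd  : ∀ m n → sgn m ≡ - + 1 → sgn (m *ℕ n) ≡ sgn n
sgn-*-even zero    n eq = refl
sgn-*-even (suc m) n eq = trans (sgn-+ n (m *ℕ n)) (trans (cong (sgn n *_) (sgn-*-odd m n (trans (sym (ℤP.neg-involutive (sgn m))) (cong -_ eq)))) (sgn² n))
sgn-*-odd (suc m) n eq = trans (sgn-+ n (m *ℕ n)) (trans (cong (sgn n *_) (sgn-*-even m n (trans (sym (ℤP.neg-involutive (sgn m))) (cong -_ eq)))) (ℤP.*-identityʳ (sgn n)))

half-even : ∀ x → sgn x ≡ + 1 → ⌊ x /2⌋ +ℕ ⌊ x /2⌋ ≡ x
half-even zero          eq = refl
half-even (suc (suc x)) eq = trans (cong suc (ℕP.+-suc ⌊ x /2⌋ ⌊ x /2⌋)) (cong (λ m → suc (suc m)) (half-even x (trans (sym (ℤP.neg-involutive (sgn x))) eq)))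

Nat³ : Set
Nat³ = ℕ × ℕ × ℕ

e₂ : Nat³ → ℕ
e₂ (x , y , z) = x *ℕ y +ℕ y *ℕ z +ℕ z *ℕ x

box₀ : ℕ → List Nat³
box₀ N = dpairs (0 ∷ rng N) (λ _ → dpairs (0 ∷ rng N) (λ _ → 0 ∷ rng N))

0∷rng-unique : ∀ N → Unique (0 ∷ rng N)
0∷rng-unique N = All.tabulate (λ i∈ eq → ℕP.<⇒≢ (proj₁ (∈-rng⁻ N i∈)) eq) ∷ rng-unique N

∈-0∷rng : ∀ N {i} → i ≤ℕ N → i ∈ 0 ∷ rng N
∈-0∷rng N {zero}  le = here refl
∈-0∷rng N {suc i} le = there (∈-rng⁺ N (s≤s z≤n) le)

Tri : ℕ → List Nat³
Tri N = filter (λ t → e₂ t ℕP.≟ N) (box₀ N)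

Tri-unique : ∀ N → Unique (Tri N)
Tri-unique N = UniqueP.filter⁺ (λ t → e₂ t ℕP.≟ N) (dpairs-unique (0∷rng-unique N) (λ _ → dpairs-unique (0∷rng-unique N) (λ _ → 0∷rng-unique N)))

∈-Tri⁻ : ∀ N {t} → t ∈ Tri N → e₂ t ≡ N
∈-Tri⁻ N t∈ = proj₂ (∈P.∈-filter⁻ (λ t → e₂ t ℕP.≟ N) {xs = box₀ N} t∈)

∈-Tri⁺ : ∀ N {t} → 1 ≤ℕ N → e₂ t ≡ N → t ∈ Tri N
∈-Tri⁺ N {x , y , z} 1≤N eq = ∈P.∈-filter⁺ (λ t → e₂ t ℕP.≟ N)
  (∈-dpairs⁺ {ys = λ _ → dpairs (0 ∷ rng N) (λ _ → 0 ∷ rng N)} (∈-0∷rng N (bound x y z eq))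
    (∈-dpairs⁺ {ys = λ _ → 0 ∷ rng N} (∈-0∷rng N (bound y z x (trans (rot x y z) eq))) (∈-0∷rng N (bound z x y (trans (rot′ x y z) eq))))) eq
  where
  rot : ∀ x y z → y *ℕ z +ℕ z *ℕ x +ℕ x *ℕ y ≡ x *ℕ y +ℕ y *ℕ z +ℕ z *ℕ x
  rot = ℕ-solve-∀
  rot′ : ∀ x y z → z *ℕ x +ℕ x *ℕ y +ℕ y *ℕ z ≡ x *ℕ y +ℕ y *ℕ z +ℕ z *ℕ x
  rot′ = ℕ-solve-∀
  bound : ∀ x y z → x *ℕ y +ℕ y *ℕ z +ℕ z *ℕ x ≡ N → x ≤ℕ N
  -- Only for y = z = 0 could x be unbounded, and then e₂ would be 0.
  bound x zero    zero    eq = contradiction (subst (1 ≤ℕ_) (trans (sym eq) (cong (λ m → m +ℕ 0 +ℕ 0) (ℕP.*-zeroʳ x))) 1≤N) (λ ())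
  bound x (suc y) z       eq = ℕP.≤-trans (m≤m*n x {suc y} (s≤s z≤n)) (ℕP.≤-trans (ℕP.m≤m+n _ (suc y *ℕ z)) (ℕP.≤-trans (ℕP.m≤m+n _ (z *ℕ x)) (ℕP.≤-reflexive eq)))
  bound x zero    (suc z) eq = ℕP.≤-trans (ℕP.m≤m+n x (z *ℕ x)) (ℕP.≤-trans (ℕP.m≤n+m _ (x *ℕ 0 +ℕ 0)) (ℕP.≤-reflexive eq))

Ω : Nat³ → ℤ
Ω (x , y , z) = ς (+ x) * (ς (+ y) * ς (+ z))

SameParity : Nat³ → Set
SameParity (u , v , w) = sgn u ≡ sgn w × sgn v ≡ sgn w

sameParity? : ∀ t → Dec (SameParity t)
sameParity? (u , v , w) = (sgn u ℤP.≟ sgn w) ×-dec (sgn v ℤP.≟ sgn w)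

-- h4 N = 4 h(N): Ω is 8 when u, v, w > 0 and 4 when one of them vanishes, instead of the weights 2 and 1.
h4 : ℕ → ℤ
h4 N = ∑ (filter sameParity? (Tri N)) Ω

-- The bijection doubles all coordinates. It is onto because three odd numbers have odd e₂, which is
-- impossible for 4n; `ς` does not see the factor 2.
h4-quadruple : ∀ n → 1 ≤ℕ n → h4 (4 *ℕ n) ≡ ∑ (Tri n) Ω
h4-quadruple n 1≤n = sym (∑-bij (Tri-unique n) (UniqueP.filter⁺ sameParity? (Tri-unique (4 *ℕ n))) f g to from (λ {t} _ → weight t))
  where
  f g : Nat³ → Nat³
  f (x , y , z) = x +ℕ x , y +ℕ y , z +ℕ z
  g (x , y , z) = ⌊ x /2⌋ , ⌊ y /2⌋ , ⌊ z /2⌋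
  even : ∀ x → sgn (x +ℕ x) ≡ + 1
  even x = trans (sgn-+ x x) (sgn² x)
  halve : ∀ x → ⌊ x +ℕ x /2⌋ ≡ x
  halve x = sym (ℕP.n≡⌊n+n/2⌋ x)
  quad : ∀ x y z → (x +ℕ x) *ℕ (y +ℕ y) +ℕ (y +ℕ y) *ℕ (z +ℕ z) +ℕ (z +ℕ z) *ℕ (x +ℕ x) ≡ 4 *ℕ (x *ℕ y +ℕ y *ℕ z +ℕ z *ℕ x)
  quad = ℕ-solve-∀
  to : ∀ {t} → t ∈ Tri n → f t ∈ filter sameParity? (Tri (4 *ℕ n)) × g (f t) ≡ t
  to {x , y , z} t∈ =
    ∈P.∈-filter⁺ sameParity? (∈-Tri⁺ (4 *ℕ n) (ℕP.≤-trans 1≤n (ℕP.m≤m+n n _)) (trans (quad x y z) (cong (4 *ℕ_) (∈-Tri⁻ n t∈)))) (trans (even x) (sym (even z)) , trans (even y) (sym (even z))) ,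
    cong₂ _,_ (halve x) (cong₂ _,_ (halve y) (halve z))
  from : ∀ {t} → t ∈ filter sameParity? (Tri (4 *ℕ n)) → g t ∈ Tri n × f (g t) ≡ t
  from {u , v , w} t∈ with t∈Tri , su , sv ← ∈P.∈-filter⁻ sameParity? {xs = Tri (4 *ℕ n)} t∈ =
    ∈-Tri⁺ n 1≤n (ℕP.*-cancelˡ-≡ _ _ 4 (trans (sym (quad ⌊ u /2⌋ ⌊ v /2⌋ ⌊ w /2⌋)) (trans (cong e₂ eq) (∈-Tri⁻ (4 *ℕ n) t∈Tri)))) , eq
    where
    w-even : sgn w ≡ + 1
    w-even with sgn-cases w
    ... | inj₁ p = p
    ... | inj₂ p = contradiction (trans (sym (sgn-*-even 4 n refl)) (trans (cong sgn (sym (∈-Tri⁻ (4 *ℕ n) t∈Tri))) odd)) (λ ())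
      where
      odd : sgn (e₂ (u , v , w)) ≡ - + 1
      odd = trans (sgn-+ (u *ℕ v +ℕ v *ℕ w) (w *ℕ u)) (cong₂ _*_ (trans (sgn-+ (u *ℕ v) (v *ℕ w)) (cong₂ _*_ (trans (sgn-*-odd u v (trans su p)) (trans sv p)) (trans (sgn-*-odd v w (trans sv p)) p))) (trans (sgn-*-odd w u p) (trans su p)))
    eq : f (g (u , v , w)) ≡ (u , v , w)
    eq = cong₂ _,_ (half-even u (trans su w-even)) (cong₂ _,_ (half-even v (trans sv w-even)) (half-even w w-even))
  ς-double : ∀ x → ς (+ x) ≡ ς (+ (x +ℕ x))
  ς-double zero    = refl
  ς-double (suc x) = refl
  weight : ∀ t → Ω t ≡ Ω (f t)
  weight (x , y , z) = cong₂ _*_ (ς-double x) (cong₂ _*_ (ς-double y) (ς-double z))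

-- If m coordinates are odd, e₂ + x + y + z has the parity of m (m + 1) / 2, which for m ≤ 3 is even
-- exactly when m is 0 or 3. The indicator of equal parity is thus traded for the signs that occur
-- in P.
parity-sign : ∀ t → + 1 + - (+ 2) * 𝟙 (sameParity? t) ≡ - (sgn (e₂ t) * (sgn (proj₁ t) * (sgn (proj₁ (proj₂ t)) * sgn (proj₂ (proj₂ t)))))
parity-sign (x , y , z) with sgn-cases x | sgn-cases y | sgn-cases z
... | cx | cy | cz = trans (cong (λ i → + 1 + - (+ 2) * i) (𝟙-cong (sameParity? (x , y , z)) ((sgn x ℤP.≟ sgn z) ×-dec (sgn y ℤP.≟ sgn z)) (λ p → p) (λ p → p)))
    (trans (by-cases cx cy cz) (cong (λ s → - (s * (sgn x * (sgn y * sgn z)))) (sym (trans (sgn-+ (x *ℕ y +ℕ y *ℕ z) (z *ℕ x)) (cong (_* sgn (z *ℕ x)) (sgn-+ (x *ℕ y) (y *ℕ z)))))))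
  where
  by-cases : sgn x ≡ + 1 ⊎ sgn x ≡ - + 1 → sgn y ≡ + 1 ⊎ sgn y ≡ - + 1 → sgn z ≡ + 1 ⊎ sgn z ≡ - + 1 →
    + 1 + - (+ 2) * 𝟙 ((sgn x ℤP.≟ sgn z) ×-dec (sgn y ℤP.≟ sgn z)) ≡ - (sgn (x *ℕ y) * sgn (y *ℕ z) * sgn (z *ℕ x) * (sgn x * (sgn y * sgn z)))
  by-cases (inj₁ p) (inj₁ q) (inj₁ r) rewrite sgn-*-even x y p | sgn-*-even y z q | sgn-*-even z x r | p | q | r = refl
  by-cases (inj₁ p) (inj₁ q) (inj₂ r) rewrite sgn-*-even x y p | sgn-*-even y z q | sgn-*-odd z x r | p | q | r = refl
  by-cases (inj₁ p) (inj₂ q) (inj₁ r) rewrite sgn-*-even x y p | sgn-*-odd y z q | sgn-*-even z x r | p | q | r = refl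
  by-cases (inj₁ p) (inj₂ q) (inj₂ r) rewrite sgn-*-even x y p | sgn-*-odd y z q | sgn-*-odd z x r | p | q | r = refl
  by-cases (inj₂ p) (inj₁ q) (inj₁ r) rewrite sgn-*-odd x y p | sgn-*-even y z q | sgn-*-even z x r | p | q | r = refl
  by-cases (inj₂ p) (inj₁ q) (inj₂ r) rewrite sgn-*-odd x y p | sgn-*-even y z q | sgn-*-odd z x r | p | q | r = refl
  by-cases (inj₂ p) (inj₂ q) (inj₁ r) rewrite sgn-*-odd x y p | sgn-*-odd y z q | sgn-*-even z x r | p | q | r = refl
  by-cases (inj₂ p) (inj₂ q) (inj₂ r) rewrite sgn-*-odd x y p | sgn-*-odd y z q | sgn-*-odd z x r | p | q | r = refl

module _ (n : ℕ) (1≤n : 1 ≤ℕ n) where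
  private
    open Gauss n using (⟪_⟫)
    module C = Combine n (+ n)
    R = rng n
    g : Nat³ → ℤ
    g (x , y , z) = 𝟙 (e₂ (x , y , z) ℕP.≟ n) * ((sgn x * (sgn y * sgn z)) * Ω (x , y , z))

    interior : ∀ x y z → 1 ≤ℕ x → 1 ≤ℕ y → 1 ≤ℕ z → g (x , y , z) ≡ + 8 * C.term (proj₂ xy+yz+zx) (x ∷ y ∷ z ∷ [])
    interior (suc x) (suc y) (suc z) _ _ _ = trans
      (cong (_* ((sgn (suc x) * (sgn (suc y) * sgn (suc z))) * + 8)) (𝟙-cong (e₂ (suc x , suc y , suc z) ℕP.≟ n) (+ val (proj₂ xy+yz+zx) (suc x ∷ suc y ∷ suc z ∷ []) ℤP.≟ + n)
        (λ eq → cong +_ (trans (sym (ring (suc x) (suc y) (suc z))) eq)) (λ eq → trans (ring (suc x) (suc y) (suc z)) (ℤP.+-injective eq))))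
      (assoc (𝟙 (+ val (proj₂ xy+yz+zx) (suc x ∷ suc y ∷ suc z ∷ []) ℤP.≟ + n)) (sgn (suc x)) (sgn (suc y)) (sgn (suc z)))
      where
      ring : ∀ x y z → x *ℕ y +ℕ y *ℕ z +ℕ z *ℕ x ≡ x *ℕ (1 *ℕ y +ℕ (1 *ℕ z +ℕ 0)) +ℕ (y *ℕ (1 *ℕ z +ℕ 0) +ℕ (z *ℕ 0 +ℕ 0))
      ring = ℕ-solve-∀
      assoc : ∀ i a b c → i * ((a * (b * c)) * + 8) ≡ + 8 * (i * (a * (b * (c * + 1))))
      assoc = solve-∀

    boundary : ∀ x y {v : ℕ} {s w : ℤ} → s ≡ sgn x * sgn y → w ≡ + 4 → v ≡ x *ℕ y → 𝟙 (v ℕP.≟ n) * (s * w) ≡ + 4 * C.term (proj₂ xy) (x ∷ y ∷ [])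
    boundary x y {v} refl refl refl = trans
      (cong (_* ((sgn x * sgn y) * + 4)) (𝟙-cong (v ℕP.≟ n) (+ val (proj₂ xy) (x ∷ y ∷ []) ℤP.≟ + n) (λ eq → cong +_ (trans (sym (ring x y)) eq)) (λ eq → trans (ring x y) (ℤP.+-injective eq))))
      (assoc (𝟙 (+ val (proj₂ xy) (x ∷ y ∷ []) ℤP.≟ + n)) (sgn x) (sgn y))
      where
      ring : ∀ x y → x *ℕ y ≡ x *ℕ (1 *ℕ y +ℕ 0) +ℕ (y *ℕ 0 +ℕ 0)
      ring = ℕ-solve-∀
      assoc : ∀ i a b → i * ((a * b) * + 4) ≡ + 4 * (i * (a * (b * + 1)))
      assoc = solve-∀

    degenerate : ∀ t → e₂ t ≡ 0 → g t ≡ + 0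
    degenerate t eq = cong (_* _) (𝟙-no (e₂ t ℕP.≟ n) (λ eq′ → ℕP.<⇒≢ 1≤n (trans (sym eq) eq′)))

    ς⁺ : ∀ {x} → 1 ≤ℕ x → ς (+ x) ≡ + 2
    ς⁺ {suc x} _ = refl

    edge-z : ∀ x y → 1 ≤ℕ x → 1 ≤ℕ y → g (x , y , 0) ≡ + 4 * C.term (proj₂ xy) (x ∷ y ∷ [])
    edge-z x y 1≤x 1≤y = boundary x y (cong (sgn x *_) (ℤP.*-identityʳ (sgn y))) (cong₂ (λ a b → a * (b * + 1)) (ς⁺ 1≤x) (ς⁺ 1≤y)) (ring x y)
      where
      ring : ∀ x y → x *ℕ y +ℕ y *ℕ 0 +ℕ 0 *ℕ x ≡ x *ℕ y
      ring = ℕ-solve-∀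
    edge-y : ∀ x z → 1 ≤ℕ x → 1 ≤ℕ z → g (x , 0 , z) ≡ + 4 * C.term (proj₂ xy) (x ∷ z ∷ [])
    edge-y x z 1≤x 1≤z = boundary x z (cong (sgn x *_) (ℤP.*-identityˡ (sgn z))) (cong₂ (λ a b → a * (+ 1 * b)) (ς⁺ 1≤x) (ς⁺ 1≤z)) (ring x z)
      where
      ring : ∀ x z → x *ℕ 0 +ℕ 0 *ℕ z +ℕ z *ℕ x ≡ x *ℕ z
      ring = ℕ-solve-∀
    edge-x : ∀ y z → 1 ≤ℕ y → 1 ≤ℕ z → g (0 , y , z) ≡ + 4 * C.term (proj₂ xy) (y ∷ z ∷ [])
    edge-x y z 1≤y 1≤z = boundary y z (ℤP.*-identityˡ (sgn y * sgn z)) (cong₂ (λ a b → + 1 * (a * b)) (ς⁺ 1≤y) (ς⁺ 1≤z)) (ring y z)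
      where
      ring : ∀ y z → 0 *ℕ y +ℕ y *ℕ z +ℕ z *ℕ 0 ≡ y *ℕ z
      ring = ℕ-solve-∀

    positive : ∀ {x} → x ∈ R → 1 ≤ℕ x
    positive x∈ = proj₁ (∈-rng⁻ n x∈)

    scaled₂ : ∀ {f : ℕ → ℕ → ℤ} → (∀ x y → 1 ≤ℕ x → 1 ≤ℕ y → f x y ≡ + 4 * C.term (proj₂ xy) (x ∷ y ∷ [])) → ∑ R (λ x → ∑ R (f x)) ≡ + 4 * ⟪ xy ⟫ (+ n)
    scaled₂ {f} eq = trans (∑-cong∈ R (λ {x} x∈ → trans (∑-cong∈ R (λ {y} y∈ → eq x y (positive x∈) (positive y∈))) (∑-*ˡ (+ 4) R (λ y → C.term (proj₂ xy) (x ∷ y ∷ []))))) (∑-*ˡ (+ 4) R (λ x → ∑ R (λ y → C.term (proj₂ xy) (x ∷ y ∷ []))))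

    scaled₃ : ∑ R (λ x → ∑ R (λ y → ∑ R (λ z → g (x , y , z)))) ≡ + 8 * ⟪ xy+yz+zx ⟫ (+ n)
    scaled₃ = trans (∑-cong∈ R (λ {x} x∈ → trans (∑-cong∈ R (λ {y} y∈ → trans (∑-cong∈ R (λ {z} z∈ → interior x y z (positive x∈) (positive y∈) (positive z∈))) (∑-*ˡ (+ 8) R (λ z → term₃ x y z)))) (∑-*ˡ (+ 8) R (λ y → ∑ R (term₃ x y))))) (∑-*ˡ (+ 8) R (λ x → ∑ R (λ y → ∑ R (term₃ x y))))
      where
      term₃ : ℕ → ℕ → ℕ → ℤ
      term₃ x y z = C.term (proj₂ xy+yz+zx) (x ∷ y ∷ z ∷ [])

    zero₀ : ∑ R (λ x → g (x , 0 , 0)) ≡ + 0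
    zero₀ = ∑-zero∈ R (λ {x} _ → degenerate (x , 0 , 0) (ring x))
      where
      ring : ∀ x → x *ℕ 0 +ℕ 0 *ℕ 0 +ℕ 0 *ℕ x ≡ 0
      ring = ℕ-solve-∀
    zero₁ : ∑ R (λ y → g (0 , y , 0)) ≡ + 0
    zero₁ = ∑-zero∈ R (λ {y} _ → degenerate (0 , y , 0) (ring y))
      where
      ring : ∀ y → 0 *ℕ y +ℕ y *ℕ 0 +ℕ 0 *ℕ 0 ≡ 0
      ring = ℕ-solve-∀
    zero₂ : ∑ R (λ z → g (0 , 0 , z)) ≡ + 0
    zero₂ = ∑-zero∈ R (λ {z} _ → degenerate (0 , 0 , z) (ring z))
      where
      ring : ∀ z → 0 *ℕ 0 +ℕ 0 *ℕ z +ℕ z *ℕ 0 ≡ 0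
      ring = ℕ-solve-∀

  -- Triples with two zeros have e₂ = 0 and drop out. Those with one zero lie on three faces of
  -- weight 4; the others have weight 8.
  ∑Tri-cones : ∑ (Tri n) (λ t → (sgn (proj₁ t) * (sgn (proj₁ (proj₂ t)) * sgn (proj₂ (proj₂ t)))) * Ω t) ≡ + 8 * ⟪ xy+yz+zx ⟫ (+ n) + + 12 * ⟪ xy ⟫ (+ n)
  ∑Tri-cones = begin
    ∑ (Tri n) _
      ≡⟨ ∑-filter (λ t → e₂ t ℕP.≟ n) (box₀ n) (λ t → (sgn (proj₁ t) * (sgn (proj₁ (proj₂ t)) * sgn (proj₂ (proj₂ t)))) * Ω t) ⟩
    ∑ (box₀ n) g
      ≡⟨ trans (∑-dpairs R₀ (λ _ → dpairs R₀ (λ _ → R₀)) g) (∑-cong R₀ (λ x → ∑-dpairs R₀ (λ _ → R₀) (λ y → g (x , y)))) ⟩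
    ∑ R₀ (λ x → ∑ R₀ (λ y → ∑ R₀ (λ z → g (x , y , z))))
      ≡⟨ refl ⟩
    ((g (0 , 0 , 0) + ∑ R (λ z → g (0 , 0 , z))) + ∑ R (λ y → g (0 , y , 0) + ∑ R (λ z → g (0 , y , z))))
      + ∑ R (λ x → (g (x , 0 , 0) + ∑ R (λ z → g (x , 0 , z))) + ∑ R (λ y → g (x , y , 0) + ∑ R (λ z → g (x , y , z))))
      ≡⟨ cong₂ _+_ (cong₂ _+_ (cong₂ _+_ (degenerate (0 , 0 , 0) refl) zero₂) (trans (∑-+ R (λ y → g (0 , y , 0)) (λ y → ∑ R (λ z → g (0 , y , z)))) (cong₂ _+_ zero₁ (scaled₂ edge-x))))
           (trans (∑-+ R (λ x → g (x , 0 , 0) + ∑ R (λ z → g (x , 0 , z))) (λ x → ∑ R (λ y → g (x , y , 0) + ∑ R (λ z → g (x , y , z)))))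
             (cong₂ _+_ (trans (∑-+ R (λ x → g (x , 0 , 0)) (λ x → ∑ R (λ z → g (x , 0 , z)))) (cong₂ _+_ zero₀ (scaled₂ edge-y)))
               (trans (∑-cong R (λ x → ∑-+ R (λ y → g (x , y , 0)) (λ y → ∑ R (λ z → g (x , y , z))))) (trans (∑-+ R (λ x → ∑ R (λ y → g (x , y , 0))) (λ x → ∑ R (λ y → ∑ R (λ z → g (x , y , z))))) (cong₂ _+_ (scaled₂ edge-z) scaled₃))))) ⟩
    (((+ 0 + + 0) + (+ 0 + + 4 * ⟪ xy ⟫ (+ n))) + ((+ 0 + + 4 * ⟪ xy ⟫ (+ n)) + (+ 4 * ⟪ xy ⟫ (+ n) + + 8 * ⟪ xy+yz+zx ⟫ (+ n))))
      ≡⟨ ring (⟪ xy ⟫ (+ n)) (⟪ xy+yz+zx ⟫ (+ n)) ⟩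
    + 8 * ⟪ xy+yz+zx ⟫ (+ n) + + 12 * ⟪ xy ⟫ (+ n) ∎
    where
    R₀ = 0 ∷ R
    ring : ∀ a b → (((+ 0 + + 0) + (+ 0 + + 4 * a)) + ((+ 0 + + 4 * a) + (+ 4 * a + + 8 * b))) ≡ + 8 * b + + 12 * a
    ring = solve-∀

  -- By `h4-quadruple` the left side sums Ω times 1 - 2 [equal parity] over `Tri n`, and
  -- `parity-sign` makes it -(-1)ⁿ times a signed count, that is 2 (-1)ⁿ P(n). The sign recurs in
  -- `r3-series` and cancels.
  gauss : h4 (4 *ℕ n) - + 2 * h4 n ≡ + 2 * + r3 n
  gauss = begin
    h4 (4 *ℕ n) - + 2 * h4 n
      ≡⟨ cong₂ (λ a b → a - + 2 * b) (h4-quadruple n 1≤n) (∑-filter sameParity? (Tri n) Ω) ⟩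
    ∑ (Tri n) Ω - + 2 * ∑ (Tri n) (λ t → 𝟙 (sameParity? t) * Ω t)
      ≡⟨ trans (minus (∑ (Tri n) Ω) (∑ (Tri n) (λ t → 𝟙 (sameParity? t) * Ω t))) (cong (_+_ (∑ (Tri n) Ω)) (sym (∑-*ˡ (- (+ 2)) (Tri n) (λ t → 𝟙 (sameParity? t) * Ω t)))) ⟩
    ∑ (Tri n) Ω + ∑ (Tri n) (λ t → - (+ 2) * (𝟙 (sameParity? t) * Ω t))
      ≡⟨ sym (∑-+ (Tri n) Ω (λ t → - (+ 2) * (𝟙 (sameParity? t) * Ω t))) ⟩
    ∑ (Tri n) (λ t → Ω t + - (+ 2) * (𝟙 (sameParity? t) * Ω t))
      ≡⟨ ∑-cong∈ (Tri n) (λ {t} t∈ → trans (factor (𝟙 (sameParity? t)) (Ω t)) (trans (cong (_* Ω t) (parity-sign t)) (trans (cong (λ m → - (sgn m * S t) * Ω t) (∈-Tri⁻ n t∈)) (pull (sgn n) (S t) (Ω t))))) ⟩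
    ∑ (Tri n) (λ t → - sgn n * (S t * Ω t))
      ≡⟨ trans (∑-*ˡ (- sgn n) (Tri n) (λ t → S t * Ω t)) (cong (- sgn n *_) ∑Tri-cones) ⟩
    - sgn n * (+ 8 * E₃ + + 12 * E₂)
      ≡⟨ rearrange (sgn n) E₃ E₂ ⟩
    + 2 * (sgn n * (+ 0 + (- (+ 4) * E₃ + - (+ 6) * E₂)))
      ≡⟨ cong (λ d → + 2 * (sgn n * (d + (- (+ 4) * E₃ + - (+ 6) * E₂)))) (sym (𝟙-no (+ n ℤP.≟ + 0) (λ eq → ℕP.<⇒≢ 1≤n (sym (ℤP.+-injective eq))))) ⟩
    + 2 * (sgn n * Gauss.P n (+ n))
      ≡⟨ cong (λ p → + 2 * (sgn n * p)) (trans (Gauss.P≡Θ³ n (+ n) ℤP.≤-refl) (Gauss.r3-series n n refl)) ⟩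
    + 2 * (sgn n * (sgn n * + r3 n))
      ≡⟨ cong (+ 2 *_) (trans (sym (ℤP.*-assoc (sgn n) (sgn n) (+ r3 n))) (trans (cong (_* + r3 n) (sgn² n)) (ℤP.*-identityˡ (+ r3 n)))) ⟩
    + 2 * + r3 n ∎
    where
    E₃ = ⟪ xy+yz+zx ⟫ (+ n)
    E₂ = ⟪ xy ⟫ (+ n)
    S : Nat³ → ℤ
    S t = sgn (proj₁ t) * (sgn (proj₁ (proj₂ t)) * sgn (proj₂ (proj₂ t)))
    minus : ∀ a b → a - + 2 * b ≡ a + - (+ 2) * b
    minus = solve-∀
    factor : ∀ i x → x + - (+ 2) * (i * x) ≡ (+ 1 + - (+ 2) * i) * x
    factor = solve-∀
    pull : ∀ a s x → - (a * s) * x ≡ - a * (s * x)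
    pull = solve-∀
    rearrange : ∀ s a b → - s * (+ 8 * a + + 12 * b) ≡ + 2 * (s * (+ 0 + (- (+ 4) * a + - (+ 6) * b)))
    rearrange = solve-∀

-- Reduction of binary quadratic forms

infixl 7 _·_

_·_ : Mat → Mat → Mat
(α , β , γ , δ) · (α′ , β′ , γ′ , δ′) =
  α * α′ + β * γ′ , α * β′ + β * δ′ , γ * α′ + δ * γ′ , γ * β′ + δ * δ′

det : Mat → ℤ
det (α , β , γ , δ) = α * δ - β * γ

adj : Mat → Mat
adj (α , β , γ , δ) = δ , - β , - γ , α

𝐈 : Mat
𝐈 = + 1 , + 0 , + 0 , + 1

mat≡ : ∀ {α β γ δ α′ β′ γ′ δ′ : ℤ} → α ≡ α′ → β ≡ β′ → γ ≡ γ′ → δ ≡ δ′ → (α , β , γ , δ) ≡ (α′ , β′ , γ′ , δ′)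
mat≡ refl refl refl refl = refl

form≡ : ∀ {a b c a′ b′ c′ : ℤ} → a ≡ a′ → b ≡ b′ → c ≡ c′ → (a , b , c) ≡ (a′ , b′ , c′)
form≡ refl refl refl = refl

·-assoc : ∀ g h k → (g · h) · k ≡ g · (h · k)
·-assoc (a , b , c , d) (a′ , b′ , c′ , d′) (a″ , b″ , c″ , d″) =
  mat≡ (row a b a′ b′ c′ d′ a″ c″) (row a b a′ b′ c′ d′ b″ d″) (row c d a′ b′ c′ d′ a″ c″) (row c d a′ b′ c′ d′ b″ d″)
  where
  row : ∀ a b a′ b′ c′ d′ x y → (a * a′ + b * c′) * x + (a * b′ + b * d′) * y ≡ a * (a′ * x + b′ * y) + b * (c′ * x + d′ * y)
  row = solve-∀

𝐈-identityˡ : ∀ g → 𝐈 · g ≡ g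
𝐈-identityˡ (a , b , c , d) = mat≡ (r₁ a c) (r₁ b d) (r₂ a c) (r₂ b d)
  where
  r₁ : ∀ x y → + 1 * x + + 0 * y ≡ x
  r₁ = solve-∀
  r₂ : ∀ x y → + 0 * x + + 1 * y ≡ y
  r₂ = solve-∀

𝐈-identityʳ : ∀ g → g · 𝐈 ≡ g
𝐈-identityʳ (a , b , c , d) = mat≡ (r₁ a b) (r₂ a b) (r₁ c d) (r₂ c d)
  where
  r₁ : ∀ x y → x * + 1 + y * + 0 ≡ x
  r₁ = solve-∀
  r₂ : ∀ x y → x * + 0 + y * + 1 ≡ y
  r₂ = solve-∀

det-· : ∀ g h → det (g · h) ≡ det g * det h
det-· (a , b , c , d) (a′ , b′ , c′ , d′) = ring a b c d a′ b′ c′ d′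
  where
  ring : ∀ a b c d a′ b′ c′ d′ → (a * a′ + b * c′) * (c * b′ + d * d′) - (a * b′ + b * d′) * (c * a′ + d * c′) ≡ (a * d - b * c) * (a′ * d′ - b′ * c′)
  ring = solve-∀

det-adj : ∀ g → det (adj g) ≡ det g
det-adj (a , b , c , d) = ring a b c d
  where
  ring : ∀ a b c d → d * a - - b * - c ≡ a * d - b * c
  ring = solve-∀

adj-· : ∀ g h → adj (g · h) ≡ adj h · adj g
adj-· (a , b , c , d) (a′ , b′ , c′ , d′) = mat≡ (r₁ c d b′ d′) (r₂ a b b′ d′) (r₃ c d a′ c′) (r₄ a b a′ c′)
  where
  r₁ : ∀ c d b′ d′ → c * b′ + d * d′ ≡ d′ * d + - b′ * - c
  r₁ = solve-∀
  r₂ : ∀ a b b′ d′ → - (a * b′ + b * d′) ≡ d′ * - b + - b′ * a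
  r₂ = solve-∀
  r₃ : ∀ c d a′ c′ → - (c * a′ + d * c′) ≡ - c′ * d + a′ * - c
  r₃ = solve-∀
  r₄ : ∀ a b a′ c′ → a * a′ + b * c′ ≡ - c′ * - b + a′ * a
  r₄ = solve-∀

adj-adj : ∀ g → adj (adj g) ≡ g
adj-adj (a , b , c , d) = mat≡ refl (ℤP.neg-involutive b) (ℤP.neg-involutive c) refl

adj-inverseʳ : ∀ g → det g ≡ + 1 → g · adj g ≡ 𝐈
adj-inverseʳ (a , b , c , d) eq = mat≡ (trans (r₁ a b c d) eq) (r₂ a b) (r₃ c d) (trans (r₄ a b c d) eq)
  where
  r₁ : ∀ a b c d → a * d + b * - c ≡ a * d - b * c
  r₁ = solve-∀
  r₂ : ∀ a b → a * - b + b * a ≡ + 0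
  r₂ = solve-∀
  r₃ : ∀ c d → c * d + d * - c ≡ + 0
  r₃ = solve-∀
  r₄ : ∀ a b c d → c * - b + d * a ≡ a * d - b * c
  r₄ = solve-∀

adj-inverseˡ : ∀ g → det g ≡ + 1 → adj g · g ≡ 𝐈
adj-inverseˡ g eq = subst (λ h → adj g · h ≡ 𝐈) (adj-adj g) (adj-inverseʳ (adj g) (trans (det-adj g) eq))

act-· : ∀ Q g h → act (act Q g) h ≡ act Q (g · h)
act-· (a , b , c) (α , β , γ , δ) (α′ , β′ , γ′ , δ′) = form≡ (diag′ a b c α β γ δ α′ γ′) (cross a b c α β γ δ α′ β′ γ′ δ′) (diag′ a b c α β γ δ β′ δ′)
  where
  diag′ : ∀ a b c α β γ δ x y →
    (a * α * α + b * α * γ + c * γ * γ) * x * x + (+ 2 * a * α * β + b * (α * δ + β * γ) + + 2 * c * γ * δ) * x * y + (a * β * β + b * β * δ + c * δ * δ) * y * y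
    ≡ a * (α * x + β * y) * (α * x + β * y) + b * (α * x + β * y) * (γ * x + δ * y) + c * (γ * x + δ * y) * (γ * x + δ * y)
  diag′ = solve-∀
  cross : ∀ a b c α β γ δ α′ β′ γ′ δ′ →
    + 2 * (a * α * α + b * α * γ + c * γ * γ) * α′ * β′ + (+ 2 * a * α * β + b * (α * δ + β * γ) + + 2 * c * γ * δ) * (α′ * δ′ + β′ * γ′) + + 2 * (a * β * β + b * β * δ + c * δ * δ) * γ′ * δ′
    ≡ + 2 * a * (α * α′ + β * γ′) * (α * β′ + β * δ′) + b * ((α * α′ + β * γ′) * (γ * β′ + δ * δ′) + (α * β′ + β * δ′) * (γ * α′ + δ * γ′)) + + 2 * c * (γ * α′ + δ * γ′) * (γ * β′ + δ * δ′)
  cross = solve-∀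

act-𝐈 : ∀ Q → act Q 𝐈 ≡ Q
act-𝐈 (a , b , c) = form≡ (r₁ a b c) (r₂ a b c) (r₃ a b c)
  where
  r₁ : ∀ a b c → a * + 1 * + 1 + b * + 1 * + 0 + c * + 0 * + 0 ≡ a
  r₁ = solve-∀
  r₂ : ∀ a b c → + 2 * a * + 1 * + 0 + b * (+ 1 * + 1 + + 0 * + 0) + + 2 * c * + 0 * + 1 ≡ b
  r₂ = solve-∀
  r₃ : ∀ a b c → a * + 0 * + 0 + b * + 0 * + 1 + c * + 1 * + 1 ≡ c
  r₃ = solve-∀

act-adj : ∀ {Q Q′} g → det g ≡ + 1 → act Q g ≡ Q′ → act Q′ (adj g) ≡ Q
act-adj {Q} g eq refl = trans (act-· Q g (adj g)) (trans (cong (act Q) (adj-inverseʳ g eq)) (act-𝐈 Q))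

disc-act : ∀ Q g → disc (act Q g) ≡ det g * det g * disc Q
disc-act (a , b , c) (α , β , γ , δ) = ring a b c α β γ δ
  where
  ring : ∀ a b c α β γ δ →
    (+ 2 * a * α * β + b * (α * δ + β * γ) + + 2 * c * γ * δ) * (+ 2 * a * α * β + b * (α * δ + β * γ) + + 2 * c * γ * δ)
      - + 4 * (a * α * α + b * α * γ + c * γ * γ) * (a * β * β + b * β * δ + c * δ * δ)
    ≡ (α * δ - β * γ) * (α * δ - β * γ) * (b * b - + 4 * a * c)
  ring = solve-∀

disc-act₁ : ∀ Q g → det g ≡ + 1 → disc (act Q g) ≡ disc Q
disc-act₁ Q g eq = trans (disc-act Q g) (trans (cong (λ d → d * d * disc Q) eq) (ℤP.*-identityˡ (disc Q)))

-- Selling parameters: Q(X,Y) = (u X² + v Y² + w (X - Y)²) / 2 and uv + vw + wu = - disc Q.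
uOf vOf wOf : Form → ℤ
uOf (a , b , c) = + 2 * a + b
vOf (a , b , c) = + 2 * c + b
wOf (a , b , c) = - b

-- Supported on u, v, w ≥ 0; each vanishing parameter halves the generic value 8.
wt : Form → ℤ
wt Q = ς (uOf Q) * (ς (vOf Q) * ς (wOf Q))

ς≢0 : ∀ x → ς x ≢ + 0 → + 0 ≤ x
ς≢0 (+ n)      _  = +≤+ z≤n
ς≢0 (-[1+ n ]) ne = contradiction refl ne

wt≢0 : ∀ Q → wt Q ≢ + 0 → + 0 ≤ uOf Q × + 0 ≤ vOf Q × + 0 ≤ wOf Q
wt≢0 Q ne = ς≢0 (uOf Q) (λ eq → ne (cong (_* (ς (vOf Q) * ς (wOf Q))) eq)) ,
  ς≢0 (vOf Q) (λ eq → ne (trans (cong (λ z → ς (uOf Q) * (z * ς (wOf Q))) eq) (ℤP.*-zeroʳ (ς (uOf Q))))) ,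
  ς≢0 (wOf Q) (λ eq → ne (trans (cong (λ z → ς (uOf Q) * (ς (vOf Q) * z)) eq) (trans (cong (ς (uOf Q) *_) (ℤP.*-zeroʳ (ς (vOf Q)))) (ℤP.*-zeroʳ (ς (uOf Q))))))

*-nonneg : ∀ {x y} → + 0 ≤ x → + 0 ≤ y → + 0 ≤ x * y
*-nonneg {+ m} {+ n} _ _ = subst (+ 0 ≤_) (ℤP.pos-* m n) (+≤+ z≤n)

square-nonneg : ∀ x → + 0 ≤ x * x
square-nonneg x = subst (+ 0 ≤_) (sym (square-∣∣ x)) (+≤+ z≤n)

square≤0 : ∀ x → x * x ≤ + 0 → x ≡ + 0
square≤0 (+ 0)      _ = refl
square≤0 (+[1+ n ]) (+≤+ ())
square≤0 (-[1+ n ]) (+≤+ ())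

-- The norm form of the Eisenstein integers; `hexagon` lists its six units.
norm : ℤ → ℤ → ℤ
norm x y = x * x + x * y + y * y

norm-4 : ∀ x y → + 4 * norm x y ≡ (+ 2 * x + y) * (+ 2 * x + y) + + 3 * (y * y)
norm-4 x y = ring x y
  where
  ring : ∀ x y → + 4 * (x * x + x * y + y * y) ≡ (+ 2 * x + y) * (+ 2 * x + y) + + 3 * (y * y)
  ring = solve-∀

norm-comm : ∀ x y → norm x y ≡ norm y x
norm-comm x y = ring x y
  where
  ring : ∀ x y → x * x + x * y + y * y ≡ y * y + y * x + x * x
  ring = solve-∀

norm≤0 : ∀ x y → norm x y ≤ + 0 → x ≡ + 0
norm≤0 x y le = square≤0 x (lower x (subst (_≤ + 0) (trans (cong (+ 4 *_) (norm-comm x y)) (norm-4 y x)) (ℤP.*-monoˡ-≤-nonNeg (+ 4) le)))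
  where
  lower : ∀ x → (+ 2 * y + x) * (+ 2 * y + x) + + 3 * (x * x) ≤ + 0 → x * x ≤ + 0
  lower x le = ℤP.*-cancelˡ-≤-pos (x * x) (+ 0) (+ 3) (ℤP.≤-trans (subst (_≤ (+ 2 * y + x) * (+ 2 * y + x) + + 3 * (x * x)) (ℤP.+-identityˡ (+ 3 * (x * x))) (ℤP.+-monoˡ-≤ (+ 3 * (x * x)) (square-nonneg (+ 2 * y + x)))) le)

norm≥1 : ∀ x y → ¬ (x ≡ + 0 × y ≡ + 0) → + 0 ≤ norm x y - + 1
norm≥1 x y ne with norm x y ℤP.≤? + 0
... | yes le = contradiction (norm≤0 x y le , norm≤0 y x (subst (_≤ + 0) (norm-comm x y) le)) ne
... | no ¬le = ℤP.i≤j⇒0≤j-i (ℤP.i<j⇒suc[i]≤j (ℤP.≰⇒> ¬le))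

-- Norm 1 gives 4 = (2y + x)² + 3x², and 3x² is at least 12 when |x| ≥ 2.
norm≡1⇒small : ∀ x y → norm x y ≡ + 1 → ∣ x ∣ ≤ℕ 1
norm≡1⇒small x y eq = ℕP.≮⇒≥ (λ 2≤x → ℕP.<⇒≢ (ℕP.<-≤-trans {4} {12} (ℕP.m≤m+n 5 7)
    (ℕP.≤-trans (ℕP.*-monoʳ-≤ 3 (ℕP.*-mono-≤ 2≤x 2≤x)) (ℕP.m≤n+m _ (k *ℕ k)))) (sym four))
  where
  k = ∣ + 2 * y + x ∣
  four : k *ℕ k +ℕ 3 *ℕ (∣ x ∣ *ℕ ∣ x ∣) ≡ 4
  four = ℤP.+-injective (begin
    + (k *ℕ k +ℕ 3 *ℕ (∣ x ∣ *ℕ ∣ x ∣))                  ≡⟨ ℤP.pos-+ (k *ℕ k) _ ⟩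
    + (k *ℕ k) + + (3 *ℕ (∣ x ∣ *ℕ ∣ x ∣))               ≡⟨ cong₂ _+_ (sym (square-∣∣ (+ 2 * y + x))) (trans (ℤP.pos-* 3 (∣ x ∣ *ℕ ∣ x ∣)) (cong (+ 3 *_) (sym (square-∣∣ x)))) ⟩
    (+ 2 * y + x) * (+ 2 * y + x) + + 3 * (x * x)        ≡⟨ sym (norm-4 y x) ⟩
    + 4 * norm y x                                       ≡⟨ cong (+ 4 *_) (trans (norm-comm y x) eq) ⟩
    + 4 ∎)

small : ∀ x → ∣ x ∣ ≤ℕ 1 → x ≡ + 0 ⊎ x ≡ + 1 ⊎ x ≡ - + 1
small (+ 0)              _ = inj₁ refl
small (+ 1)              _ = inj₂ (inj₁ refl)
small (+ suc (suc n))    (s≤s ())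
small (-[1+ 0 ])         _ = inj₂ (inj₂ refl)
small (-[1+ suc n ])     (s≤s ())

hexagon : List (ℤ × ℤ)
hexagon = (+ 1 , + 0) ∷ (+ 0 , + 1) ∷ (- + 1 , + 0) ∷ (+ 0 , - + 1) ∷ (+ 1 , - + 1) ∷ (- + 1 , + 1) ∷ []

norm≡1 : ∀ x y → norm x y ≡ + 1 → (x , y) ∈ hexagon
norm≡1 x y eq with small x (norm≡1⇒small x y eq) | small y (norm≡1⇒small y x (trans (norm-comm y x) eq))
... | inj₁ refl        | inj₂ (inj₁ refl) = there (here refl)
... | inj₁ refl        | inj₂ (inj₂ refl) = there (there (there (here refl)))
... | inj₂ (inj₁ refl) | inj₁ refl        = here refl
... | inj₂ (inj₁ refl) | inj₂ (inj₂ refl) = there (there (there (there (here refl))))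
... | inj₂ (inj₂ refl) | inj₁ refl        = there (there (here refl))
... | inj₂ (inj₂ refl) | inj₂ (inj₁ refl) = there (there (there (there (there (here refl)))))
... | inj₁ refl        | inj₁ refl        = contradiction eq (λ ())
... | inj₂ (inj₁ refl) | inj₂ (inj₁ refl) = contradiction eq (λ ())
... | inj₂ (inj₂ refl) | inj₂ (inj₂ refl) = contradiction eq (λ ())

-- Each matrix is listed with its negative. The first six permute u, v, w cyclically; the last six
-- replace w by -w and, from a form with u, v > 0 and w ≥ 0, lead to a reduced form only on the wall
-- w = 0.
hexMatrices : List Mat
hexMatrices =
  (+ 1 , + 0 , + 0 , + 1) ∷ (+ 0 , + 1 , - + 1 , + 1) ∷ (+ 1 , - + 1 , + 1 , + 0) ∷
  (- + 1 , + 0 , + 0 , - + 1) ∷ (+ 0 , - + 1 , + 1 , - + 1) ∷ (- + 1 , + 1 , - + 1 , + 0) ∷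
  (+ 1 , + 0 , - + 1 , + 1) ∷ (+ 0 , + 1 , - + 1 , + 0) ∷ (+ 1 , - + 1 , + 0 , + 1) ∷
  (- + 1 , + 0 , + 1 , - + 1) ∷ (+ 0 , - + 1 , + 1 , + 0) ∷ (- + 1 , + 1 , + 0 , - + 1) ∷ []

_≟M_ : (g h : Mat) → Dec (g ≡ h)
_≟M_ = ProductP.≡-dec ℤP._≟_ (ProductP.≡-dec ℤP._≟_ (ProductP.≡-dec ℤP._≟_ ℤP._≟_))

hexMatrices-det : All (λ g → det g ≡ + 1) hexMatrices
hexMatrices-det = from-yes (All.all? (λ g → det g ℤP.≟ + 1) hexMatrices)

hexMatrices-unique : Unique hexMatrices
hexMatrices-unique = from-yes (allPairs? (λ g h → ¬? (g ≟M h)) hexMatrices)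

-- Each row is one of six vectors, so the 36 matrices are checked by evaluation.
hexMatrices-complete : ∀ {α β γ δ} → (α , β) ∈ hexagon → (γ , δ) ∈ hexagon → det (α , β , γ , δ) ≡ + 1 → (α , β , γ , δ) ∈ hexMatrices
hexMatrices-complete r∈ s∈ eq = All.lookup (All.lookup table r∈) s∈ eq
  where
  open import Data.List.Membership.DecPropositional _≟M_ using (_∈?_)
  table : All (λ r → All (λ s → det (proj₁ r , proj₂ r , s) ≡ + 1 → (proj₁ r , proj₂ r , s) ∈ hexMatrices) hexagon) hexagon
  table = from-yes (All.all? (λ r → All.all? (λ s → (det (proj₁ r , proj₂ r , s) ℤP.≟ + 1) →-dec ((proj₁ r , proj₂ r , s) ∈? hexMatrices)) hexagon) hexagon)

-- Equal to a + c + Q(1, 1), the quantity that decreases in Selling's algorithm.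
mOf : Form → ℤ
mOf Q = uOf Q + (vOf Q + wOf Q)

excess : Form → Mat → ℤ × ℤ × ℤ
excess Q (α , β , γ , δ) =
  uOf Q * (norm α β - + 1) , vOf Q * (norm γ δ - + 1) , wOf Q * (norm (α - γ) (β - δ) - + 1)

-- The sum of the three norms of a superbase grows by a combination of u, v, w with coefficients ≥ 0.
mOf-act : ∀ Q g → mOf (act Q g) - mOf Q ≡ proj₁ (excess Q g) + (proj₁ (proj₂ (excess Q g)) + proj₂ (proj₂ (excess Q g)))
mOf-act (a , b , c) (α , β , γ , δ) = ring a b c α β γ δ
  where
  ring : ∀ a b c α β γ δ →
    (+ 2 * (a * α * α + b * α * γ + c * γ * γ) + (+ 2 * a * α * β + b * (α * δ + β * γ) + + 2 * c * γ * δ)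
      + ((+ 2 * (a * β * β + b * β * δ + c * δ * δ) + (+ 2 * a * α * β + b * (α * δ + β * γ) + + 2 * c * γ * δ))
        + - (+ 2 * a * α * β + b * (α * δ + β * γ) + + 2 * c * γ * δ)))
      - ((+ 2 * a + b) + ((+ 2 * c + b) + - b)) ≡
    (+ 2 * a + b) * (α * α + α * β + β * β - + 1) + ((+ 2 * c + b) * (γ * γ + γ * δ + δ * δ - + 1)
      + - b * ((α - γ) * (α - γ) + (α - γ) * (β - δ) + (β - δ) * (β - δ) - + 1))
  ring = solve-∀

-- Determinant 1 makes both rows and their difference nonzero, so their norms are at least 1.
excess-nonneg : ∀ Q g → det g ≡ + 1 → + 0 ≤ uOf Q → + 0 ≤ vOf Q → + 0 ≤ wOf Q →
  + 0 ≤ proj₁ (excess Q g) × + 0 ≤ proj₁ (proj₂ (excess Q g)) × + 0 ≤ proj₂ (proj₂ (excess Q g))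
excess-nonneg Q (α , β , γ , δ) eq u≥0 v≥0 w≥0 =
  *-nonneg u≥0 (norm≥1 α β (λ { (refl , refl) → contradiction eq (λ ()) })) ,
  *-nonneg v≥0 (norm≥1 γ δ (λ { (refl , refl) → contradiction (trans (sym (ring₁ α β)) eq) (λ ()) })) ,
  *-nonneg w≥0 (norm≥1 (α - γ) (β - δ) (λ { (p , q) → contradiction (trans (sym (trans (ring₂ α β γ δ) (trans (cong₂ (λ x y → x * δ - y * γ) p q) refl))) eq) (λ ()) }))
  where
  ring₁ : ∀ α β → α * + 0 - β * + 0 ≡ + 0
  ring₁ = solve-∀
  ring₂ : ∀ α β γ δ → α * δ - β * γ ≡ (α - γ) * δ - (β - δ) * γ
  ring₂ = solve-∀

sum-nonneg : ∀ {x y z} → + 0 ≤ x → + 0 ≤ y → + 0 ≤ z → + 0 ≤ x + (y + z)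
sum-nonneg x≥0 y≥0 z≥0 = ℤP.+-mono-≤ x≥0 (ℤP.+-mono-≤ y≥0 z≥0)

-- Neither h nor `adj h` can make u + v + w smaller, so all three excesses vanish. From u, v > 0
-- both rows have norm 1. As w may be 0, the difference of the rows is left unrestricted, which is
-- why twelve matrices appear and not six.
reduced-unique : ∀ Q h → det h ≡ + 1 → + 0 < uOf Q → + 0 < vOf Q → + 0 ≤ wOf Q →
  wt (act Q h) ≢ + 0 → h ∈ hexMatrices
reduced-unique Q h@(α , β , γ , δ) eq u>0 v>0 w≥0 ne =
  hexMatrices-complete (norm≡1 α β (unit (uOf Q) (norm α β) u>0 X≡0)) (norm≡1 γ δ (unit (vOf Q) (norm γ δ) v>0 Y≡0)) eq
  where
  Q₁ = act Q h
  h⁻¹ = adj h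
  X = proj₁ (excess Q h)
  Y = proj₁ (proj₂ (excess Q h))
  Z = proj₂ (proj₂ (excess Q h))
  nonneg = excess-nonneg Q h eq (ℤP.<⇒≤ u>0) (ℤP.<⇒≤ v>0) w≥0
  X≥0 = proj₁ nonneg
  Y≥0 = proj₁ (proj₂ nonneg)
  Z≥0 = proj₂ (proj₂ nonneg)
  back : + 0 ≤ mOf Q - mOf Q₁
  back =
    let p , q , r = wt≢0 Q₁ ne
        x , y , z = excess-nonneg Q₁ h⁻¹ (trans (det-adj h) eq) p q r in
    subst (+ 0 ≤_) (trans (sym (mOf-act Q₁ h⁻¹)) (cong (λ Q′ → mOf Q′ - mOf Q₁) (act-adj {Q} h eq refl))) (sum-nonneg x y z)
  total≤0 : X + (Y + Z) ≤ + 0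
  total≤0 = subst (_≤ + 0) (mOf-act Q h) (subst (_≤ + 0) (flip′ (mOf Q) (mOf Q₁)) (ℤP.neg-mono-≤ back))
    where
    flip′ : ∀ a b → - (a - b) ≡ b - a
    flip′ = solve-∀
  X≡0 : X ≡ + 0
  X≡0 = ℤP.≤-antisym (ℤP.≤-trans (subst (_≤ X + (Y + Z)) (ℤP.+-identityʳ X) (ℤP.+-monoʳ-≤ X (ℤP.+-mono-≤ Y≥0 Z≥0))) total≤0) X≥0
  Y≡0 : Y ≡ + 0
  Y≡0 = ℤP.≤-antisym (ℤP.≤-trans (subst₂ _≤_ (zeros Y) refl (ℤP.+-mono-≤ X≥0 (ℤP.+-monoʳ-≤ Y Z≥0))) total≤0) Y≥0
    where
    zeros : ∀ y → + 0 + (y + + 0) ≡ y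
    zeros = solve-∀
  unit : ∀ x e → + 0 < x → x * (e - + 1) ≡ + 0 → e ≡ + 1
  unit x e x>0 eq with ℤP.i*j≡0⇒i≡0∨j≡0 x eq
  ... | inj₁ refl = contradiction x>0 (λ { (+<+ ()) })
  ... | inj₂ e-1  = ℤP.i-j≡0⇒i≡j e (+ 1) e-1

ς-pos : ∀ {x} → + 0 < x → ς x ≡ + 2
ς-pos {+[1+ n ]} _ = refl
ς-pos {+ 0} (+<+ ())

ς-± : ∀ x → ς x + ς (- x) ≡ + 2
ς-± (+ 0)      = refl
ς-± (+[1+ n ]) = refl
ς-± (-[1+ n ]) = refl

act-neg : ∀ Q α β γ δ → act Q (- α , - β , - γ , - δ) ≡ act Q (α , β , γ , δ)
act-neg (a , b , c) α β γ δ = form≡ (diag′ a b c α γ) (cross a b c α β γ δ) (diag′ a b c β δ)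
  where
  diag′ : ∀ a b c x y → a * - x * - x + b * - x * - y + c * - y * - y ≡ a * x * x + b * x * y + c * y * y
  diag′ = solve-∀
  cross : ∀ a b c α β γ δ → + 2 * a * - α * - β + b * (- α * - δ + - β * - γ) + + 2 * c * - γ * - δ ≡ + 2 * a * α * β + b * (α * δ + β * γ) + + 2 * c * γ * δ
  cross = solve-∀

-- The six cyclic matrices contribute 24 ς(w) and the other six 24 ς(-w), because u, v and the
-- parameters u + 2w, v + 2w are positive.
hex-total : ∀ Q → + 0 < uOf Q → + 0 < vOf Q → + 0 ≤ wOf Q → ∑ hexMatrices (λ h → wt (act Q h)) ≡ + 48
hex-total (a , b , c) u>0 v>0 w≥0 = begin
  ∑ hexMatrices (λ h → wt (act (a , b , c) h))
    ≡⟨ cong₂ _+_ e₁ (cong₂ _+_ e₂′ (cong₂ _+_ e₃ (cong₂ _+_ (negated (+ 1) (+ 0) (+ 0) (+ 1) e₁) (cong₂ _+_ (negated (+ 0) (+ 1) (- + 1) (+ 1) e₂′) (cong₂ _+_ (negated (+ 1) (- + 1) (+ 1) (+ 0) e₃) (cong₂ _+_ f₁ (cong₂ _+_ f₂ (cong₂ _+_ f₃ (cong₂ _+_ (negated (+ 1) (+ 0) (- + 1) (+ 1) f₁) (cong₂ _+_ (negated (+ 0) (+ 1) (- + 1) (+ 0) f₂) (cong₂ _+_ (negated (+ 1) (- + 1) (+ 0) (+ 1) f₃) refl))))))))))) ⟩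
  R₁ + (R₂ + (R₃ + (R₁ + (R₂ + (R₃ + (L + (L + (L + (L + (L + (L + + 0)))))))))))
    ≡⟨ combine (ς (- b)) (ς b) ⟩
  + 24 * (ς (- b) + ς b)
    ≡⟨ cong (+ 24 *_) (trans (ℤP.+-comm (ς (- b)) (ς b)) (ς-± b)) ⟩
  + 48 ∎
  where
  negated : ∀ α β γ δ {x} → wt (act (a , b , c) (α , β , γ , δ)) ≡ x → wt (act (a , b , c) (- α , - β , - γ , - δ)) ≡ x
  negated α β γ δ eq = trans (cong wt (act-neg (a , b , c) α β γ δ)) eq
  R₁ = + 2 * (+ 2 * ς (- b))
  R₂ = ς (- b) * (+ 2 * + 2)
  R₃ = + 2 * (ς (- b) * + 2)
  L  = ς b * + 4
  combine : ∀ r l → + 2 * (+ 2 * r) + (r * (+ 2 * + 2) + (+ 2 * (r * + 2) + (+ 2 * (+ 2 * r) + (r * (+ 2 * + 2) + (+ 2 * (r * + 2) + (l * + 4 + (l * + 4 + (l * + 4 + (l * + 4 + (l * + 4 + (l * + 4 + + 0))))))))))) ≡ + 24 * (r + l)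
  combine = solve-∀
  u = + 2 * a + b
  v = + 2 * c + b
  bigger : ∀ x y → + 0 < + 2 * x + y → + 0 ≤ - y → + 0 < + 2 * x - y
  bigger x y p q = subst (+ 0 <_) (ring x y) (ℤP.+-mono-<-≤ p (ℤP.+-mono-≤ q q))
    where
    ring : ∀ x y → (+ 2 * x + y) + (- y + - y) ≡ + 2 * x - y
    ring = solve-∀
  u′>0 : + 0 < + 2 * a - b
  u′>0 = bigger a b u>0 w≥0
  v′>0 : + 0 < + 2 * c - b
  v′>0 = bigger c b v>0 w≥0
  weight : ∀ {p q r x y z : ℤ} → p ≡ x → q ≡ y → r ≡ z → ς p * (ς q * ς r) ≡ ς x * (ς y * ς z)
  weight refl refl refl = refl
  rot₁ : ς u * (ς v * ς (- b)) ≡ R₁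
  rot₁ = cong₂ (λ x y → x * (y * ς (- b))) (ς-pos u>0) (ς-pos v>0)
  rot₂ : ς (- b) * (ς u * ς v) ≡ R₂
  rot₂ = cong₂ (λ x y → ς (- b) * (x * y)) (ς-pos u>0) (ς-pos v>0)
  rot₃ : ς v * (ς (- b) * ς u) ≡ R₃
  rot₃ = cong₂ (λ x y → x * (ς (- b) * y)) (ς-pos v>0) (ς-pos u>0)
  order₁ : ∀ l → + 2 * (l * + 2) ≡ l * + 4
  order₁ = solve-∀
  order₂ : ∀ l → + 2 * (+ 2 * l) ≡ l * + 4
  order₂ = solve-∀
  flip₁ : ς (+ 2 * a - b) * (ς b * ς (+ 2 * c - b)) ≡ L
  flip₁ = trans (cong₂ (λ x y → x * (ς b * y)) (ς-pos u′>0) (ς-pos v′>0)) (order₁ (ς b))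
  flip₂ : ς (+ 2 * c - b) * (ς (+ 2 * a - b) * ς b) ≡ L
  flip₂ = trans (cong₂ (λ x y → x * (y * ς b)) (ς-pos v′>0) (ς-pos u′>0)) (order₂ (ς b))
  flip₃ : ς b * (ς (+ 2 * c - b) * ς (+ 2 * a - b)) ≡ L
  flip₃ = cong₂ (λ x y → ς b * (x * y)) (ς-pos v′>0) (ς-pos u′>0)
  e₁ : wt (act (a , b , c) (+ 1 , + 0 , + 0 , + 1)) ≡ R₁
  e₁ = trans (weight (r₁ a b c) (r₂ a b c) (r₃ a b c)) rot₁
    where
    r₁ : ∀ a b c → + 2 * (a * (+ 1) * (+ 1) + b * (+ 1) * (+ 0) + c * (+ 0) * (+ 0)) + (+ 2 * a * (+ 1) * (+ 0) + b * ((+ 1) * (+ 1) + (+ 0) * (+ 0)) + + 2 * c * (+ 0) * (+ 1)) ≡ + 2 * a + b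
    r₁ = solve-∀
    r₂ : ∀ a b c → + 2 * (a * (+ 0) * (+ 0) + b * (+ 0) * (+ 1) + c * (+ 1) * (+ 1)) + (+ 2 * a * (+ 1) * (+ 0) + b * ((+ 1) * (+ 1) + (+ 0) * (+ 0)) + + 2 * c * (+ 0) * (+ 1)) ≡ + 2 * c + b
    r₂ = solve-∀
    r₃ : ∀ a b c → - (+ 2 * a * (+ 1) * (+ 0) + b * ((+ 1) * (+ 1) + (+ 0) * (+ 0)) + + 2 * c * (+ 0) * (+ 1)) ≡ - b
    r₃ = solve-∀
  e₂′ : wt (act (a , b , c) (+ 0 , + 1 , - + 1 , + 1)) ≡ R₂
  e₂′ = trans (weight (r₁ a b c) (r₂ a b c) (r₃ a b c)) rot₂
    where
    r₁ : ∀ a b c → + 2 * (a * (+ 0) * (+ 0) + b * (+ 0) * (- + 1) + c * (- + 1) * (- + 1)) + (+ 2 * a * (+ 0) * (+ 1) + b * ((+ 0) * (+ 1) + (+ 1) * (- + 1)) + + 2 * c * (- + 1) * (+ 1)) ≡ - b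
    r₁ = solve-∀
    r₂ : ∀ a b c → + 2 * (a * (+ 1) * (+ 1) + b * (+ 1) * (+ 1) + c * (+ 1) * (+ 1)) + (+ 2 * a * (+ 0) * (+ 1) + b * ((+ 0) * (+ 1) + (+ 1) * (- + 1)) + + 2 * c * (- + 1) * (+ 1)) ≡ + 2 * a + b
    r₂ = solve-∀
    r₃ : ∀ a b c → - (+ 2 * a * (+ 0) * (+ 1) + b * ((+ 0) * (+ 1) + (+ 1) * (- + 1)) + + 2 * c * (- + 1) * (+ 1)) ≡ + 2 * c + b
    r₃ = solve-∀
  e₃ : wt (act (a , b , c) (+ 1 , - + 1 , + 1 , + 0)) ≡ R₃
  e₃ = trans (weight (r₁ a b c) (r₂ a b c) (r₃ a b c)) rot₃
    where
    r₁ : ∀ a b c → + 2 * (a * (+ 1) * (+ 1) + b * (+ 1) * (+ 1) + c * (+ 1) * (+ 1)) + (+ 2 * a * (+ 1) * (- + 1) + b * ((+ 1) * (+ 0) + (- + 1) * (+ 1)) + + 2 * c * (+ 1) * (+ 0)) ≡ + 2 * c + b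
    r₁ = solve-∀
    r₂ : ∀ a b c → + 2 * (a * (- + 1) * (- + 1) + b * (- + 1) * (+ 0) + c * (+ 0) * (+ 0)) + (+ 2 * a * (+ 1) * (- + 1) + b * ((+ 1) * (+ 0) + (- + 1) * (+ 1)) + + 2 * c * (+ 1) * (+ 0)) ≡ - b
    r₂ = solve-∀
    r₃ : ∀ a b c → - (+ 2 * a * (+ 1) * (- + 1) + b * ((+ 1) * (+ 0) + (- + 1) * (+ 1)) + + 2 * c * (+ 1) * (+ 0)) ≡ + 2 * a + b
    r₃ = solve-∀
  f₁ : wt (act (a , b , c) (+ 1 , + 0 , - + 1 , + 1)) ≡ L
  f₁ = trans (weight (r₁ a b c) (r₂ a b c) (r₃ a b c)) flip₁
    where
    r₁ : ∀ a b c → + 2 * (a * (+ 1) * (+ 1) + b * (+ 1) * (- + 1) + c * (- + 1) * (- + 1)) + (+ 2 * a * (+ 1) * (+ 0) + b * ((+ 1) * (+ 1) + (+ 0) * (- + 1)) + + 2 * c * (- + 1) * (+ 1)) ≡ + 2 * a - b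
    r₁ = solve-∀
    r₂ : ∀ a b c → + 2 * (a * (+ 0) * (+ 0) + b * (+ 0) * (+ 1) + c * (+ 1) * (+ 1)) + (+ 2 * a * (+ 1) * (+ 0) + b * ((+ 1) * (+ 1) + (+ 0) * (- + 1)) + + 2 * c * (- + 1) * (+ 1)) ≡ b
    r₂ = solve-∀
    r₃ : ∀ a b c → - (+ 2 * a * (+ 1) * (+ 0) + b * ((+ 1) * (+ 1) + (+ 0) * (- + 1)) + + 2 * c * (- + 1) * (+ 1)) ≡ + 2 * c - b
    r₃ = solve-∀
  f₂ : wt (act (a , b , c) (+ 0 , + 1 , - + 1 , + 0)) ≡ L
  f₂ = trans (weight (r₁ a b c) (r₂ a b c) (r₃ a b c)) flip₂
    where
    r₁ : ∀ a b c → + 2 * (a * (+ 0) * (+ 0) + b * (+ 0) * (- + 1) + c * (- + 1) * (- + 1)) + (+ 2 * a * (+ 0) * (+ 1) + b * ((+ 0) * (+ 0) + (+ 1) * (- + 1)) + + 2 * c * (- + 1) * (+ 0)) ≡ + 2 * c - b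
    r₁ = solve-∀
    r₂ : ∀ a b c → + 2 * (a * (+ 1) * (+ 1) + b * (+ 1) * (+ 0) + c * (+ 0) * (+ 0)) + (+ 2 * a * (+ 0) * (+ 1) + b * ((+ 0) * (+ 0) + (+ 1) * (- + 1)) + + 2 * c * (- + 1) * (+ 0)) ≡ + 2 * a - b
    r₂ = solve-∀
    r₃ : ∀ a b c → - (+ 2 * a * (+ 0) * (+ 1) + b * ((+ 0) * (+ 0) + (+ 1) * (- + 1)) + + 2 * c * (- + 1) * (+ 0)) ≡ b
    r₃ = solve-∀
  f₃ : wt (act (a , b , c) (+ 1 , - + 1 , + 0 , + 1)) ≡ L
  f₃ = trans (weight (r₁ a b c) (r₂ a b c) (r₃ a b c)) flip₃
    where
    r₁ : ∀ a b c → + 2 * (a * (+ 1) * (+ 1) + b * (+ 1) * (+ 0) + c * (+ 0) * (+ 0)) + (+ 2 * a * (+ 1) * (- + 1) + b * ((+ 1) * (+ 1) + (- + 1) * (+ 0)) + + 2 * c * (+ 0) * (+ 1)) ≡ b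
    r₁ = solve-∀
    r₂ : ∀ a b c → + 2 * (a * (- + 1) * (- + 1) + b * (- + 1) * (+ 1) + c * (+ 1) * (+ 1)) + (+ 2 * a * (+ 1) * (- + 1) + b * ((+ 1) * (+ 1) + (- + 1) * (+ 0)) + + 2 * c * (+ 0) * (+ 1)) ≡ + 2 * c - b
    r₂ = solve-∀
    r₃ : ∀ a b c → - (+ 2 * a * (+ 1) * (- + 1) + b * ((+ 1) * (+ 1) + (- + 1) * (+ 0)) + + 2 * c * (+ 0) * (+ 1)) ≡ + 2 * a - b
    r₃ = solve-∀

-- Positive definite forms and Selling's algorithm

record PosDef (N : ℕ) (Q : Form) : Set where
  constructor posDef
  field
    N>0   : 1 ≤ℕ N
    disc≡ : disc Q ≡ - (+ N)
    a>0   : + 0 < proj₁ Q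

*-cancel-pos : ∀ {x y} → + 0 < x → + 0 < x * y → + 0 < y
*-cancel-pos {+[1+ m ]} {+[1+ n ]} _ _ = +<+ (s≤s z≤n)
*-cancel-pos {+[1+ m ]} {+ 0}      _ p = contradiction (subst (+ 0 <_) (ℤP.*-zeroʳ +[1+ m ]) p) (λ { (+<+ ()) })
*-cancel-pos {+[1+ m ]} { -[1+ n ]} _ ()
*-cancel-pos {+ 0} (+<+ ())

-- Completing the square: 4a Q(X, Y) = (2aX + bY)² + N Y².
posDef-value : ∀ {N a b c} X Y → PosDef N (a , b , c) → Y ≢ + 0 → + 0 < a * X * X + b * X * Y + c * Y * Y
posDef-value {N} {a} {b} {c} X Y (posDef N>0 eq a>0) Y≢0 =
  *-cancel-pos {+ 4 * a} (ℤP.*-monoˡ-<-pos (+ 4) a>0)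
    (subst (+ 0 <_) (sym (trans (ring a b c X Y) (cong (λ d → (+ 2 * a * X + b * Y) * (+ 2 * a * X + b * Y) + - d * (Y * Y)) eq)))
      (ℤP.+-mono-≤-< (square-nonneg (+ 2 * a * X + b * Y)) (pos N Y N>0 Y≢0)))
  where
  ring : ∀ a b c X Y → (+ 4 * a) * (a * X * X + b * X * Y + c * Y * Y) ≡ (+ 2 * a * X + b * Y) * (+ 2 * a * X + b * Y) + - (b * b - + 4 * a * c) * (Y * Y)
  ring = solve-∀
  pos : ∀ N Y → 1 ≤ℕ N → Y ≢ + 0 → + 0 < - (- (+ N)) * (Y * Y)
  pos (suc N) (+ 0)      _ ne = contradiction refl ne
  pos (suc N) (+[1+ k ]) _ ne = +<+ (s≤s z≤n)
  pos (suc N) (-[1+ k ]) _ ne = +<+ (s≤s z≤n)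

posDef-act : ∀ {N Q} g → det g ≡ + 1 → PosDef N Q → PosDef N (act Q g)
posDef-act {N} {Q@(a , b , c)} g@(α , β , γ , δ) eq pd@(posDef N>0 d a>0) = posDef N>0 (trans (disc-act₁ Q g eq) d) leading
  where
  leading : + 0 < a * α * α + b * α * γ + c * γ * γ
  leading with γ ℤP.≟ + 0
  ... | no ne    = posDef-value α γ pd ne
  ... | yes refl = subst (+ 0 <_) (ring a b c α) (pos (α * α) (square-nonneg α) α²≢0)
    where
    ring : ∀ a b c α → a * (α * α) ≡ a * α * α + b * α * + 0 + c * + 0 * + 0
    ring = solve-∀
    α²≢0 : α * α ≢ + 0
    α²≢0 sq with refl ← square≤0 α (ℤP.≤-reflexive sq) = contradiction (trans (sym eq) (det0 β δ)) (λ ())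
      where
      det0 : ∀ β δ → + 0 * δ - β * + 0 ≡ + 0
      det0 = solve-∀
    pos : ∀ x → + 0 ≤ x → x ≢ + 0 → + 0 < a * x
    pos (+ 0)      _ ne = contradiction refl ne
    pos (+[1+ k ]) _ ne = subst (+ 0 <_) (ℤP.*-comm +[1+ k ] a) (subst (_< +[1+ k ] * a) (ℤP.*-zeroʳ +[1+ k ]) (ℤP.*-monoˡ-<-pos +[1+ k ] a>0))

posDef-c : ∀ {N a b c} → PosDef N (a , b , c) → + 0 < c
posDef-c {N} {a} {b} {c} pd = subst (+ 0 <_) (ring a b c) (posDef-value (+ 0) (+ 1) pd (λ ()))
  where
  ring : ∀ a b c → a * + 0 * + 0 + b * + 0 * + 1 + c * + 1 * + 1 ≡ c
  ring = solve-∀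

posDef-m : ∀ {N Q} → PosDef N Q → + 0 < mOf Q
posDef-m {N} {a , b , c} pd@(posDef _ _ a>0) =
  subst (+ 0 <_) (ring a b c) (ℤP.+-mono-< (ℤP.+-mono-< a>0 (posDef-c pd)) (posDef-value (+ 1) (+ 1) pd (λ ())))
  where
  ring : ∀ a b c → a + c + (a * + 1 * + 1 + b * + 1 * + 1 + c * + 1 * + 1) ≡ (+ 2 * a + b) + ((+ 2 * c + b) + - b)
  ring = solve-∀

-- As uv + vw + wu = N > 0, at most one parameter of a reduced form vanishes; the normalisation
-- places a possible zero at w.
Strict : Form → Set
Strict Q = + 0 < uOf Q × + 0 < vOf Q × + 0 ≤ wOf Q

Reducible : Form → Set
Reducible Q = Σ Mat λ g → det g ≡ + 1 × Strict (act Q g)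

reducible-act : ∀ {Q} g → det g ≡ + 1 → Reducible (act Q g) → Reducible Q
reducible-act {Q} g eq (h , eq′ , s) =
  g · h , trans (det-· g h) (cong₂ _*_ eq eq′) , subst Strict (act-· Q g h) s

𝐒 𝐓 𝐓ᵗ : Mat
𝐒  = + 0 , + 1 , - + 1 , + 0
𝐓  = + 1 , + 1 , + 0 , + 1
𝐓ᵗ = + 1 , + 0 , + 1 , + 1

act-𝐒 : ∀ a b c → act (a , b , c) 𝐒 ≡ (c , - b , a)
act-𝐒 a b c = form≡ (r₁ a b c) (r₂ a b c) (r₃ a b c)
  where
  r₁ : ∀ a b c → a * + 0 * + 0 + b * + 0 * - + 1 + c * - + 1 * - + 1 ≡ c
  r₁ = solve-∀
  r₂ : ∀ a b c → + 2 * a * + 0 * + 1 + b * (+ 0 * + 0 + + 1 * - + 1) + + 2 * c * - + 1 * + 0 ≡ - b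
  r₂ = solve-∀
  r₃ : ∀ a b c → a * + 1 * + 1 + b * + 1 * + 0 + c * + 0 * + 0 ≡ a
  r₃ = solve-∀

act-𝐓 : ∀ a b c → act (a , b , c) 𝐓 ≡ (a , + 2 * a + b , a + b + c)
act-𝐓 a b c = form≡ (r₁ a b c) (r₂ a b c) (r₃ a b c)
  where
  r₁ : ∀ a b c → a * + 1 * + 1 + b * + 1 * + 0 + c * + 0 * + 0 ≡ a
  r₁ = solve-∀
  r₂ : ∀ a b c → + 2 * a * + 1 * + 1 + b * (+ 1 * + 1 + + 1 * + 0) + + 2 * c * + 0 * + 1 ≡ + 2 * a + b
  r₂ = solve-∀
  r₃ : ∀ a b c → a * + 1 * + 1 + b * + 1 * + 1 + c * + 1 * + 1 ≡ a + b + c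
  r₃ = solve-∀

act-𝐓ᵗ : ∀ a b c → act (a , b , c) 𝐓ᵗ ≡ (a + b + c , + 2 * c + b , c)
act-𝐓ᵗ a b c = form≡ (r₁ a b c) (r₂ a b c) (r₃ a b c)
  where
  r₁ : ∀ a b c → a * + 1 * + 1 + b * + 1 * + 1 + c * + 1 * + 1 ≡ a + b + c
  r₁ = solve-∀
  r₂ : ∀ a b c → + 2 * a * + 1 * + 0 + b * (+ 1 * + 1 + + 0 * + 1) + + 2 * c * + 1 * + 1 ≡ + 2 * c + b
  r₂ = solve-∀
  r₃ : ∀ a b c → a * + 0 * + 0 + b * + 0 * + 1 + c * + 1 * + 1 ≡ c
  r₃ = solve-∀

private
  double-pos : ∀ {x} → + 0 < x → + 0 < + 2 * x + + 0
  double-pos {+[1+ n ]} _ = +<+ (s≤s z≤n)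
  double-pos {+ 0} (+<+ ())

  decrease : ∀ m x k → x < + 0 → m ≤ + suc k → m + + 2 * x ≤ + k
  decrease m x k x<0 le = ℤP.≤-trans (ℤP.+-mono-≤ le (ℤP.≤-trans (ℤP.*-monoˡ-≤-nonNeg (+ 2) (ℤP.i<j⇒i≤pred[j] x<0)) (ℤ.-≤- {1} {0} z≤n)))
    (ℤP.≤-reflexive refl)

-- Selling's algorithm: a negative parameter is removed by a matrix that makes u + v + w smaller.
reducible : ∀ {N} k Q → PosDef N Q → mOf Q ≤ + k → Reducible Q
reducible zero    Q           pd le = contradiction (posDef-m pd) (ℤP.≤⇒≯ le)
reducible (suc k) Q@(a , b , c) pd le with + 0 ℤP.<? b | + 0 ℤP.<? uOf Q | + 0 ℤP.<? vOf Q
... | yes b>0 | _ | _ = reducible-act {Q} 𝐒 refl (reducible k (act Q 𝐒) (posDef-act 𝐒 refl pd)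
        (subst (_≤ + k) (trans (ring a b c) (cong mOf (sym (act-𝐒 a b c)))) (decrease (mOf Q) (- b) k (ℤP.neg-mono-< b>0) le)))
  where
  ring : ∀ a b c → ((+ 2 * a + b) + ((+ 2 * c + b) + - b)) + + 2 * - b ≡ (+ 2 * c + - b) + ((+ 2 * a + - b) + - - b)
  ring = solve-∀
... | no b≤0  | yes u>0 | yes v>0 = 𝐈 , refl , subst Strict (sym (act-𝐈 Q)) (u>0 , v>0 , ℤP.neg-mono-≤ (ℤP.≮⇒≥ b≤0))
... | no b≤0  | no u≤0  | _ with uOf Q ℤP.≟ + 0
-- For u = 0 the new middle coefficient 2a + b is u itself, so `𝐓` moves the zero from u to w, where
-- `Strict` admits it.
...   | yes u≡0 = 𝐓 , refl , subst Strict (sym (trans (act-𝐓 a b c) (cong (λ z → a , z , a + b + c) u≡0)))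
          (double-pos (PosDef.a>0 pd) , double-pos (posDef-c (subst (PosDef _) (act-𝐓 a b c) (posDef-act 𝐓 refl pd))) , +≤+ z≤n)
...   | no u≢0  = reducible-act {Q} 𝐓 refl (reducible k (act Q 𝐓) (posDef-act 𝐓 refl pd)
          (subst (_≤ + k) (trans (ring a b c) (cong mOf (sym (act-𝐓 a b c)))) (decrease (mOf Q) (uOf Q) k (ℤP.≤∧≢⇒< (ℤP.≮⇒≥ u≤0) u≢0) le)))
  where
  ring : ∀ a b c → ((+ 2 * a + b) + ((+ 2 * c + b) + - b)) + + 2 * (+ 2 * a + b) ≡ (+ 2 * a + (+ 2 * a + b)) + ((+ 2 * (a + b + c) + (+ 2 * a + b)) + - (+ 2 * a + b))
  ring = solve-∀
reducible (suc k) Q@(a , b , c) pd le | no b≤0 | yes u>0 | no v≤0 with vOf Q ℤP.≟ + 0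
...   | yes v≡0 = 𝐓ᵗ , refl , subst Strict (sym (trans (act-𝐓ᵗ a b c) (cong (λ z → a + b + c , z , c) v≡0)))
          (double-pos (PosDef.a>0 (subst (PosDef _) (act-𝐓ᵗ a b c) (posDef-act 𝐓ᵗ refl pd))) , double-pos (posDef-c pd) , +≤+ z≤n)
...   | no v≢0  = reducible-act {Q} 𝐓ᵗ refl (reducible k (act Q 𝐓ᵗ) (posDef-act 𝐓ᵗ refl pd)
          (subst (_≤ + k) (trans (ring a b c) (cong mOf (sym (act-𝐓ᵗ a b c)))) (decrease (mOf Q) (vOf Q) k (ℤP.≤∧≢⇒< (ℤP.≮⇒≥ v≤0) v≢0) le)))
  where
  ring : ∀ a b c → ((+ 2 * a + b) + ((+ 2 * c + b) + - b)) + + 2 * (+ 2 * c + b) ≡ (+ 2 * (a + b + c) + (+ 2 * c + b)) + ((+ 2 * c + (+ 2 * c + b)) + - (+ 2 * c + b))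
  ring = solve-∀

∑-filter-≢0 : (xs : List A) (f : A → ℤ) → ∑ (filter (λ x → ¬? (f x ℤP.≟ + 0)) xs) f ≡ ∑ xs f
∑-filter-≢0 xs f = trans (∑-filter (λ x → ¬? (f x ℤP.≟ + 0)) xs f) (∑-cong xs pointwise)
  where
  pointwise : ∀ x → 𝟙 (¬? (f x ℤP.≟ + 0)) * f x ≡ f x
  pointwise x with f x ℤP.≟ + 0
  ... | yes eq = sym eq
  ... | no _   = ℤP.*-identityˡ (f x)

≤∣∣ : ∀ x → x ≤ + ∣ x ∣
≤∣∣ (+ n)      = ℤP.≤-refl
≤∣∣ (-[1+ n ]) = ℤ.-≤+

record Reductions (Q : Form) : Set where
  field
    list     : List Mat
    unique   : Unique list
    sound    : ∀ {g} → g ∈ list → det g ≡ + 1 × wt (act Q g) ≢ + 0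
    complete : ∀ {g} → det g ≡ + 1 → wt (act Q g) ≢ + 0 → g ∈ list
    total    : ∑ list (λ g → wt (act Q g)) ≡ + 48

-- One strict reduction g₀ is found by `reducible`; by `reduced-unique` the others are g₀ times one
-- of the twelve matrices, and products of weight 0 are dropped.
reductions : ∀ {N} Q → PosDef N Q → Reductions Q
reductions Q pd with reducible ∣ mOf Q ∣ Q pd (≤∣∣ (mOf Q))
... | g₀ , eq₀ , u>0 , v>0 , w≥0 = record
  { list     = filter nz? gs
  ; unique   = UniqueP.filter⁺ nz? (UniqueP.map⁺ cancel hexMatrices-unique)
  ; sound    = λ g∈ → let g∈gs , ne = ∈P.∈-filter⁻ nz? {xs = gs} g∈ in det₁ g∈gs , ne
  ; complete = λ {g} eq ne → ∈P.∈-filter⁺ nz? (subst (_∈ gs) (undo g) (∈P.∈-map⁺ (g₀ ·_)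
      (reduced-unique (act Q g₀) (adj g₀ · g) (trans (det-· (adj g₀) g) (cong₂ _*_ (trans (det-adj g₀) eq₀) eq)) u>0 v>0 w≥0
        (subst (λ P → wt P ≢ + 0) (sym (trans (act-· Q g₀ (adj g₀ · g)) (cong (act Q) (undo g)))) ne)))) ne
  ; total    = trans (∑-filter-≢0 gs (λ g → wt (act Q g))) (trans (∑-map (g₀ ·_) hexMatrices (λ g → wt (act Q g)))
      (trans (∑-cong hexMatrices (λ h → cong wt (sym (act-· Q g₀ h)))) (hex-total (act Q g₀) u>0 v>0 w≥0)))
  }
  where
  gs = map (g₀ ·_) hexMatrices
  nz? = λ g → ¬? (wt (act Q g) ℤP.≟ + 0)
  undo : ∀ g → g₀ · (adj g₀ · g) ≡ g
  undo g = trans (sym (·-assoc g₀ (adj g₀) g)) (trans (cong (_· g) (adj-inverseʳ g₀ eq₀)) (𝐈-identityˡ g))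
  redo : ∀ h → adj g₀ · (g₀ · h) ≡ h
  redo h = trans (sym (·-assoc (adj g₀) g₀ h)) (trans (cong (_· h) (adj-inverseˡ g₀ eq₀)) (𝐈-identityˡ h))
  cancel : ∀ {h k} → g₀ · h ≡ g₀ · k → h ≡ k
  cancel {h} {k} eq = trans (sym (redo h)) (trans (cong (adj g₀ ·_) eq) (redo k))
  det₁ : ∀ {g} → g ∈ gs → det g ≡ + 1
  det₁ g∈ with h , h∈ , refl ← ∈P.∈-map⁻ (g₀ ·_) g∈ = trans (det-· g₀ h) (cong₂ _*_ eq₀ (All.lookup hexMatrices-det h∈))

-- The list of reduced forms of a discriminant

-- The form with Selling parameters u, v, w; the halves are exact when the three have equal parity.
redForm : Nat³ → Form
redForm (u , v , w) = + ⌊ u +ℕ w /2⌋ , - (+ w) , + ⌊ v +ℕ w /2⌋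

private
  double-half : ∀ u w → sgn u ≡ sgn w → + 2 * + ⌊ u +ℕ w /2⌋ + - (+ w) ≡ + u
  double-half u w eq = begin
    + 2 * + m + - (+ w)     ≡⟨ cong (_+ - (+ w)) (twice (+ m)) ⟩
    (+ m + + m) + - (+ w)   ≡⟨ cong (_+ - (+ w)) (trans (sym (ℤP.pos-+ m m)) (trans (cong +_ (half-even (u +ℕ w) (trans (sgn-+ u w) (trans (cong (_* sgn w) eq) (sgn² w))))) (ℤP.pos-+ u w))) ⟩
    (+ u + + w) + - (+ w)   ≡⟨ cancel (+ u) (+ w) ⟩
    + u ∎
    where
    m = ⌊ u +ℕ w /2⌋
    twice : ∀ x → + 2 * x ≡ x + x
    twice = solve-∀
    cancel : ∀ x y → (x + y) + - y ≡ x
    cancel = solve-∀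

uOf-red : ∀ u v w → SameParity (u , v , w) → uOf (redForm (u , v , w)) ≡ + u
uOf-red u v w (p , _) = double-half u w p

vOf-red : ∀ u v w → SameParity (u , v , w) → vOf (redForm (u , v , w)) ≡ + v
vOf-red u v w (_ , p) = double-half v w p

wOf-red : ∀ u v w → wOf (redForm (u , v , w)) ≡ + w
wOf-red u v w = ℤP.neg-involutive (+ w)

selling : ∀ Q → disc Q ≡ - (uOf Q * vOf Q + vOf Q * wOf Q + wOf Q * uOf Q)
selling (a , b , c) = ring a b c
  where
  ring : ∀ a b c → b * b - + 4 * a * c ≡ - ((+ 2 * a + b) * (+ 2 * c + b) + (+ 2 * c + b) * - b + - b * (+ 2 * a + b))
  ring = solve-∀

pos-e₂ : ∀ u v w → + u * + v + + v * + w + + w * + u ≡ + e₂ (u , v , w)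
pos-e₂ u v w = sym (trans (ℤP.pos-+ (u *ℕ v +ℕ v *ℕ w) (w *ℕ u)) (cong₂ _+_ (trans (ℤP.pos-+ (u *ℕ v) (v *ℕ w)) (cong₂ _+_ (ℤP.pos-* u v) (ℤP.pos-* v w))) (ℤP.pos-* w u)))

disc-red : ∀ t → SameParity t → disc (redForm t) ≡ - (+ e₂ t)
disc-red t@(u , v , w) sp = trans (selling (redForm t)) (cong -_ (trans (cong₂ (λ x y → x * y + y * wOf (redForm t) + wOf (redForm t) * x) (uOf-red u v w sp) (vOf-red u v w sp))
  (trans (cong (λ z → + u * + v + + v * z + z * + u) (wOf-red u v w)) (pos-e₂ u v w))))

wt-red : ∀ t → SameParity t → wt (redForm t) ≡ Ω t
wt-red t@(u , v , w) sp = cong₂ _*_ (cong ς (uOf-red u v w sp)) (cong₂ _*_ (cong ς (vOf-red u v w sp)) (cong ς (wOf-red u v w)))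

ς+≢0 : ∀ n → ς (+ n) ≢ + 0
ς+≢0 zero    ()
ς+≢0 (suc n) ()

Ω≢0 : ∀ t → Ω t ≢ + 0
Ω≢0 (u , v , w) eq with ℤP.i*j≡0⇒i≡0∨j≡0 (ς (+ u)) eq
... | inj₁ p = ς+≢0 u p
... | inj₂ q with ℤP.i*j≡0⇒i≡0∨j≡0 (ς (+ v)) q
...   | inj₁ p = ς+≢0 v p
...   | inj₂ p = ς+≢0 w p

posDef-a : ∀ {N a b c} → 1 ≤ℕ N → disc (a , b , c) ≡ - (+ N) → + 0 ≤ a → PosDef N (a , b , c)
posDef-a {N} {a} {b} {c} N>0 eq a≥0 = posDef N>0 eq (ℤP.≤∧≢⇒< a≥0 nz)
  where
  nz : + 0 ≢ a
  nz refl = ℤP.<⇒≱ (neg N N>0) (subst (+ 0 ≤_) (trans (ring b c) eq) (square-nonneg b))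
    where
    ring : ∀ b c → b * b ≡ b * b - + 4 * + 0 * c
    ring = solve-∀
    neg : ∀ N → 1 ≤ℕ N → - (+ N) < + 0
    neg (suc N) _ = ℤ.-<+

abstract
  red : ℕ → List Form
  red N = map redForm (filter sameParity? (Tri N))

  red-unique : ∀ N → Unique (red N)
  red-unique N = uniq (filter sameParity? (Tri N)) (λ t∈ → proj₂ (∈P.∈-filter⁻ sameParity? {xs = Tri N} t∈)) (UniqueP.filter⁺ sameParity? (Tri-unique N))
    where
    injective : ∀ s t → SameParity s → SameParity t → redForm s ≡ redForm t → s ≡ t
    injective s@(u , v , w) t@(u′ , v′ , w′) sp sp′ eq = cong₂ _,_ (ℤP.+-injective (trans (sym (uOf-red u v w sp)) (trans (cong uOf eq) (uOf-red u′ v′ w′ sp′))))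
      (cong₂ _,_ (ℤP.+-injective (trans (sym (vOf-red u v w sp)) (trans (cong vOf eq) (vOf-red u′ v′ w′ sp′)))) (ℤP.+-injective (trans (sym (wOf-red u v w)) (trans (cong wOf eq) (wOf-red u′ v′ w′)))))
    uniq : ∀ ts → (∀ {t} → t ∈ ts → SameParity t) → Unique ts → Unique (map redForm ts)
    uniq []       sp u        = []
    uniq (t ∷ ts) sp (t∉ ∷ u) = AllP.map⁺ (All.tabulate (λ {s} s∈ eq → All.lookup t∉ s∈ (injective t s (sp (here refl)) (sp (there s∈)) eq))) ∷ uniq ts (sp ∘ there) u

  ∑red : ∀ N → ∑ (red N) wt ≡ h4 N
  ∑red N = trans (∑-map redForm (filter sameParity? (Tri N)) wt) (∑-cong∈ (filter sameParity? (Tri N)) (λ {t} t∈ → wt-red t (proj₂ (∈P.∈-filter⁻ sameParity? {xs = Tri N} t∈))))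

  ∈-red⁻ : ∀ N {Q} → 1 ≤ℕ N → Q ∈ red N → PosDef N Q × wt Q ≢ + 0
  ∈-red⁻ N 1≤N Q∈ with t , t∈ , refl ← ∈P.∈-map⁻ redForm Q∈ with t∈Tri , sp ← ∈P.∈-filter⁻ sameParity? {xs = Tri N} t∈ =
    posDef-a 1≤N (trans (disc-red t sp) (cong (λ m → - (+ m)) (∈-Tri⁻ N t∈Tri))) (+≤+ z≤n) , λ eq → Ω≢0 t (trans (sym (wt-red t sp)) eq)

  -- Nonzero weight forces u, v, w ≥ 0, and all three are congruent to b mod 2, so they form a
  -- triple from which Q is recovered.
  ∈-red⁺ : ∀ N {Q} → 1 ≤ℕ N → disc Q ≡ - (+ N) → wt Q ≢ + 0 → Q ∈ red N
  ∈-red⁺ N {Q@(a , b , c)} 1≤N eq ne with wt≢0 Q ne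
  ... | u≥0 , v≥0 , w≥0 = go (uOf Q) (vOf Q) (wOf Q) refl refl refl u≥0 v≥0 w≥0
    where
    go : ∀ x y z → x ≡ + 2 * a + b → y ≡ + 2 * c + b → z ≡ - b → + 0 ≤ x → + 0 ≤ y → + 0 ≤ z → Q ∈ red N
    go (+ u) (+ v) (+ w) eu ev ew _ _ _ = subst (_∈ red N) Q≡ (∈P.∈-map⁺ redForm (∈P.∈-filter⁺ sameParity? (∈-Tri⁺ N 1≤N e₂≡) sp))
      where
      sp : SameParity (u , v , w)
      sp = trans (cong sgnℤ eu) (trans (sgnℤ-shift {y = b} a (ring a b)) (sym sw)) , trans (cong sgnℤ ev) (trans (sgnℤ-shift {y = b} c (ring c b)) (sym sw))
        where
        ring : ∀ a b → + 2 * a + b ≡ b + (a + a)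
        ring = solve-∀
        sw : sgn w ≡ sgnℤ b
        sw = trans (cong sgnℤ ew) (cong sgn (ℤP.∣-i∣≡∣i∣ b))
      e₂≡ : e₂ (u , v , w) ≡ N
      e₂≡ = ℤP.+-injective (ℤP.neg-injective (trans (cong -_ (trans (sym (pos-e₂ u v w)) (trans (cong₂ (λ x y → x * y + y * + w + + w * x) eu ev) (cong (λ z → uOf Q * vOf Q + vOf Q * z + z * uOf Q) ew)))) (trans (sym (selling Q)) eq)))
      b≡ : - (+ w) ≡ b
      b≡ = trans (cong -_ ew) (ℤP.neg-involutive b)
      halves : ∀ x u → sgn u ≡ sgn w → + u ≡ + 2 * x + b → + ⌊ u +ℕ w /2⌋ ≡ x
      halves x u s e = ℤP.*-cancelˡ-≡ (+ 2) (+ ⌊ u +ℕ w /2⌋) x (trans (add (+ 2 * + ⌊ u +ℕ w /2⌋) (- (+ w))) (trans (cong₂ _-_ (trans (double-half u w s) e) b≡) (sub x b)))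
        where
        add : ∀ x y → x ≡ (x + y) - y
        add = solve-∀
        sub : ∀ x b → (+ 2 * x + b) - b ≡ + 2 * x
        sub = solve-∀
      Q≡ : redForm (u , v , w) ≡ Q
      Q≡ = form≡ (halves a u (proj₁ sp) eu) b≡ (halves c v (proj₂ sp) ev)

-- One matrix in SL₂(ℤ) for every line of F_p², with that line as first column.
line : ℕ → Mat
line j = + 1 , + 0 , + j , + 1

line∞ : Mat
line∞ = + 0 , - + 1 , + 1 , + 0

ℙ¹ : ℕ → List Mat
ℙ¹ p = line∞ ∷ map line (upTo p)

ℙ¹-det : ∀ p {h} → h ∈ ℙ¹ p → det h ≡ + 1
ℙ¹-det p (here refl) = refl
ℙ¹-det p (there h∈) with j , _ , refl ← ∈P.∈-map⁻ line h∈ = refl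

ℙ¹-unique : ∀ p → Unique (ℙ¹ p)
ℙ¹-unique p = All.tabulate (λ h∈ eq → new h∈ (sym eq)) ∷ UniqueP.map⁺ (λ { refl → refl }) (UniqueP.upTo⁺ p)
  where
  new : ∀ {h} → h ∈ map line (upTo p) → h ≢ line∞
  new h∈ eq with j , _ , refl ← ∈P.∈-map⁻ line h∈ = case eq of λ ()

ℙ¹-length : ∀ p → length (ℙ¹ p) ≡ suc p
ℙ¹-length p = cong suc (trans (ListP.length-map line (upTo p)) (ListP.length-upTo p))

-- The lower left entry of adj h · g, for g with first column (x , y).
low : Mat → ℤ → ℤ → ℤ
low (a , b , c , d) x y = - c * x + a * y

-- Arithmetic modulo p and lines over F_p

module Level (p : ℕ) (pp : Prime p) where

  instance
    p-nonZero : NonZero p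
    p-nonZero = prime⇒nonZero pp

  infix 4 p∣_ p∣?_
  p∣_ : ℤ → Set
  p∣ x = + p ∣ₛ x

  p∣?_ : ∀ x → Dec (p∣ x)
  p∣? x = (+ p) ∣ₛ? x

  euclid : ∀ {x y} → p∣ x * y → p∣ x ⊎ p∣ y
  euclid {x} {y} d with euclidsLemma ∣ x ∣ ∣ y ∣ pp (subst (p ℕDiv.∣_) (ℤP.abs-* x y) (∣ₛ⇒∣ d))
  ... | inj₁ q = inj₁ (∣⇒∣ₛ q)
  ... | inj₂ q = inj₂ (∣⇒∣ₛ q)

  residue : ∀ z → Σ ℕ λ j → j <ℕ p × p∣ z - + j
  residue z = z %ℤ p , n%ℕd<d z p , divides (z /ℤ p) (trans (cong (_- + (z %ℤ p)) (a≡a%ℕn+[a/ℕn]*n z p)) (ring (+ (z %ℤ p)) ((z /ℤ p) * + p)))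
    where
    ring : ∀ r q → (r + q) - r ≡ q
    ring = solve-∀

  inverse : ∀ {x} → ¬ p∣ x → Σ ℤ λ t → p∣ x * t - + 1
  inverse {x} ¬d with residue x
  ... | zero  , _   , d = contradiction (subst (p∣_) (ℤP.+-identityʳ x) d) ¬d
  ... | suc r , r<p , d = let t , e = nat (coprime-Bézout (prime⇒coprime pp r<p)) in
      t , subst (p∣_) (ring x (+ suc r) t) (∣ₛ-+ (∣ₛ-*ʳ t d) e)
    where
    ring : ∀ x r t → (x - r) * t + (r * t - + 1) ≡ x * t - + 1
    ring = solve-∀
    nat : Identity 1 p (suc r) → Σ ℤ λ t → p∣ + suc r * t - + 1
    nat (+- a b eq) = - (+ b) , divides (- (+ a)) (trans (r₁ (+ suc r) (+ b)) (trans (cong -_ (trans (sym (trans (ℤP.pos-+ 1 (b *ℕ suc r)) (cong (_+_ (+ 1)) (ℤP.pos-* b (suc r))))) (trans (cong +_ eq) (ℤP.pos-* a p)))) (ℤP.neg-distribˡ-* (+ a) (+ p))))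
      where
      r₁ : ∀ r b → r * - b - + 1 ≡ - (+ 1 + b * r)
      r₁ = solve-∀
    nat (-+ a b eq) = + b , divides (+ a) (trans (r₁ (+ suc r) (+ b)) (trans (cong (_- + 1) (trans (sym (ℤP.pos-* b (suc r))) (trans (cong +_ (sym eq)) (trans (ℤP.pos-+ 1 (a *ℕ p)) (cong (_+_ (+ 1)) (ℤP.pos-* a p)))))) (r₂ (+ a * + p))))
      where
      r₁ : ∀ r b → r * b - + 1 ≡ b * r - + 1
      r₁ = solve-∀
      r₂ : ∀ q → + 1 + q - + 1 ≡ q
      r₂ = solve-∀

  residue-unique : ∀ {i j} → i <ℕ p → j <ℕ p → p∣ + i - + j → i ≡ j
  residue-unique {i} {j} i<p j<p d = ℤP.+-injective (ℤP.i-j≡0⇒i≡j (+ i) (+ j) (ℤP.∣i∣≡0⇒i≡0 (zero-of (∣ₛ⇒∣ d) (ℕP.≤-<-trans (subst (λ z → ∣ z ∣ ≤ℕ i ℕ.⊔ j) (sym (ℤP.m-n≡m⊖n i j)) (ℤP.∣m⊝n∣≤m⊔n i j)) (ℕP.⊔-lub i<p j<p)))))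
    where
    zero-of : ∀ {m} → p ℕDiv.∣ m → m <ℕ p → m ≡ 0
    zero-of {zero}  _ _  = refl
    zero-of {suc m} q lt = contradiction q (ℕDiv.>⇒∤ lt)

  -- Divisibility of `low h x y` says that (x, y) lies on the line of h mod p. If p divides x, this
  -- line is `line∞`; otherwise j is the quotient y / x mod p.
  ℙ¹-exists : ∀ x y → ¬ (p∣ x × p∣ y) → Σ Mat λ h → h ∈ ℙ¹ p × p∣ low h x y
  ℙ¹-exists x y ne with p∣? x
  ... | yes d = line∞ , here refl , subst (p∣_) (ring x y) (∣ₛ-neg d)
    where
    ring : ∀ x y → - x ≡ - + 1 * x + + 0 * y
    ring = solve-∀
  ... | no ¬d = let t , e = inverse ¬d
                    j , j<p , f = residue (y * t) in
    line j , there (∈P.∈-map⁺ line (∈P.∈-upTo⁺ j<p)) , subst (p∣_) (ring x y t (+ j)) (∣ₛ-+ (∣ₛ-*ʳ x f) (∣ₛ-*ʳ (- y) e))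
    where
    ring : ∀ x y t j → (y * t - j) * x + (x * t - + 1) * - y ≡ - j * x + + 1 * y
    ring = solve-∀

  -- Two different lines of F_p² meet only in 0.
  ℙ¹-separates : ∀ x y → ¬ (p∣ x × p∣ y) → ∀ {h h′} → h ∈ ℙ¹ p → h′ ∈ ℙ¹ p → p∣ low h x y → p∣ low h′ x y → h ≡ h′
  ℙ¹-separates x y ne (here refl) (here refl) d d′ = refl
  ℙ¹-separates x y ne (here refl) (there h∈) d d′ with j , _ , refl ← ∈P.∈-map⁻ line h∈ = contradiction (mixed x y j d d′) ne
    where
    mixed : ∀ x y j → p∣ - + 1 * x + + 0 * y → p∣ - (+ j) * x + + 1 * y → p∣ x × p∣ y
    mixed x y j d d′ = subst (p∣_) (r₁ x y) (∣ₛ-neg d) , subst (p∣_) (r₂ x y (+ j)) (∣ₛ-+ d′ (∣ₛ-*ʳ (- (+ j)) d))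
      where
      r₁ : ∀ x y → - (- + 1 * x + + 0 * y) ≡ x
      r₁ = solve-∀
      r₂ : ∀ x y j → (- j * x + + 1 * y) + (- + 1 * x + + 0 * y) * - j ≡ y
      r₂ = solve-∀
  ℙ¹-separates x y ne (there h∈) (here refl) d d′ = sym (ℙ¹-separates x y ne (here refl) (there h∈) d′ d)
  ℙ¹-separates x y ne (there h∈) (there h′∈) d d′
    with i , i∈ , refl ← ∈P.∈-map⁻ line h∈ | j , j∈ , refl ← ∈P.∈-map⁻ line h′∈ = same (euclid (subst (p∣_) (r₁ x y (+ i) (+ j)) (∣ₛ-+ d′ (∣ₛ-neg d))))
    where
    r₁ : ∀ x y i j → (- j * x + + 1 * y) + - (- i * x + + 1 * y) ≡ (i - j) * x
    r₁ = solve-∀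
    r₂ : ∀ x y i → (- i * x + + 1 * y) + x * i ≡ y
    r₂ = solve-∀
    same : p∣ + i - + j ⊎ p∣ x → line i ≡ line j
    same (inj₁ q) = cong line (residue-unique (∈P.∈-upTo⁻ i∈) (∈P.∈-upTo⁻ j∈) q)
    same (inj₂ q) = contradiction (q , subst (p∣_) (r₂ x y (+ i)) (∣ₛ-+ d (∣ₛ-*ʳ (+ i) q))) ne

-- The Hecke correspondence

-- The default d is returned only when no entry qualifies, a case excluded in `pick-spec`.
pick : {P : A → Set} → (∀ x → Dec (P x)) → A → List A → A
pick P? d []       = d
pick P? d (x ∷ xs) with P? x
... | yes _ = x
... | no _  = pick P? d xs

pick-spec : {P : A → Set} (P? : ∀ x → Dec (P x)) (d : A) {xs : List A} {x : A} → x ∈ xs → P x → pick P? d xs ∈ xs × P (pick P? d xs)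
pick-spec P? d {y ∷ xs} x∈ px with P? y
... | yes py = here refl , py
... | no ¬py with x∈
...   | here refl = contradiction px ¬py
...   | there q   = let a , b = pick-spec P? d q px in there a , b

-- The dummy value 0 makes division total, so that quotients can be formed before divisibility is
-- known.
quot : ℤ → ℤ → ℤ
quot k z with k ∣ₛ? z
... | yes (divides q _) = q
... | no _              = + 0

quot-spec : ∀ {k z} → k ∣ₛ z → z ≡ quot k z * k
quot-spec {k} {z} d with k ∣ₛ? z
... | yes (divides q eq) = eq
... | no ¬d              = contradiction d ¬d

scaleF : ℤ → Form → Form
scaleF k (a , b , c) = k * a , k * b , k * c

act-scale : ∀ k Q g → act (scaleF k Q) g ≡ scaleF k (act Q g)
act-scale k (a , b , c) (α , β , γ , δ) = form≡ (diag′ k a b c α γ) (cross k a b c α β γ δ) (diag′ k a b c β δ)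
  where
  diag′ : ∀ k a b c x y → k * a * x * x + k * b * x * y + k * c * y * y ≡ k * (a * x * x + b * x * y + c * y * y)
  diag′ = solve-∀
  cross : ∀ k a b c α β γ δ → + 2 * (k * a) * α * β + k * b * (α * δ + β * γ) + + 2 * (k * c) * γ * δ ≡ k * (+ 2 * a * α * β + b * (α * δ + β * γ) + + 2 * c * γ * δ)
  cross = solve-∀

-- A matrix times its adjugate is the scalar det B, and a quadratic form takes the square of a
-- scalar.
act-·-adj : ∀ Q B → act (act Q B) (adj B) ≡ scaleF (det B * det B) Q
act-·-adj Q@(a , b , c) B@(α , β , γ , δ) = trans (act-· Q B (adj B)) (trans (cong (act Q) scalar) (form≡ (r₁ a b c (det B)) (r₂ a b c (det B)) (r₃ a b c (det B))))
  where
  scalar : B · adj B ≡ (det B , + 0 , + 0 , det B)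
  scalar = mat≡ (s₁ α β γ δ) (s₂ α β) (s₃ γ δ) (s₄ α β γ δ)
    where
    s₁ : ∀ α β γ δ → α * δ + β * - γ ≡ α * δ - β * γ
    s₁ = solve-∀
    s₂ : ∀ α β → α * - β + β * α ≡ + 0
    s₂ = solve-∀
    s₃ : ∀ γ δ → γ * δ + δ * - γ ≡ + 0
    s₃ = solve-∀
    s₄ : ∀ α β γ δ → γ * - β + δ * α ≡ α * δ - β * γ
    s₄ = solve-∀
  r₁ : ∀ a b c d → a * d * d + b * d * + 0 + c * + 0 * + 0 ≡ d * d * a
  r₁ = solve-∀
  r₂ : ∀ a b c d → + 2 * a * d * + 0 + b * (d * d + + 0 * + 0) + + 2 * c * + 0 * d ≡ d * d * b
  r₂ = solve-∀
  r₃ : ∀ a b c d → a * + 0 * + 0 + b * + 0 * d + c * d * d ≡ d * d * c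
  r₃ = solve-∀

scaleF-injective : ∀ k .{{_ : ℤ.NonZero k}} {Q Q′} → scaleF k Q ≡ scaleF k Q′ → Q ≡ Q′
scaleF-injective k {a , b , c} {a′ , b′ , c′} eq = form≡ (ℤP.*-cancelˡ-≡ k a a′ (cong proj₁ eq)) (ℤP.*-cancelˡ-≡ k b b′ (cong (proj₁ ∘ proj₂) eq)) (ℤP.*-cancelˡ-≡ k c c′ (cong (proj₂ ∘ proj₂) eq))

disc-scale : ∀ k Q → disc (scaleF k Q) ≡ k * k * disc Q
disc-scale k (a , b , c) = ring k a b c
  where
  ring : ∀ k a b c → k * b * (k * b) - + 4 * (k * a) * (k * c) ≡ k * k * (b * b - + 4 * a * c)
  ring = solve-∀

posDef? : ∀ N Q → 1 ≤ℕ N → Dec (PosDef N Q)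
posDef? N Q 1≤N with disc Q ℤP.≟ - (+ N) | + 0 ℤP.<? proj₁ Q
... | yes d | yes a = yes (posDef 1≤N d a)
... | no ¬d | _     = no (λ pd → ¬d (PosDef.disc≡ pd))
... | yes _ | no ¬a = no (λ pd → ¬a (PosDef.a>0 pd))

abstract
  -- Empty for a form that is not positive definite, so that the list can be attached to any form.
  reds : ∀ N → 1 ≤ℕ N → Form → List Mat
  reds N 1≤N Q with posDef? N Q 1≤N
  ... | yes pd = Reductions.list (reductions Q pd)
  ... | no _   = []

  reds-spec : ∀ N 1≤N {Q} → PosDef N Q → Σ (Reductions Q) λ R → Reductions.list R ≡ reds N 1≤N Q
  reds-spec N 1≤N {Q} pd with posDef? N Q 1≤N
  ... | yes pd′ = reductions Q pd′ , refl
  ... | no ¬pd  = contradiction pd ¬pd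

  reds-unique : ∀ N 1≤N Q → Unique (reds N 1≤N Q)
  reds-unique N 1≤N Q with posDef? N Q 1≤N
  ... | yes pd = Reductions.unique (reductions Q pd)
  ... | no _   = []

  reds-sound : ∀ N 1≤N {Q g} → PosDef N Q → g ∈ reds N 1≤N Q → det g ≡ + 1 × wt (act Q g) ≢ + 0
  reds-sound N 1≤N pd g∈ with R , refl ← reds-spec N 1≤N pd = Reductions.sound R g∈

  reds-complete : ∀ N 1≤N {Q g} → PosDef N Q → det g ≡ + 1 → wt (act Q g) ≢ + 0 → g ∈ reds N 1≤N Q
  reds-complete N 1≤N pd eq ne with R , refl ← reds-spec N 1≤N pd = Reductions.complete R eq ne

  reds-total : ∀ N 1≤N {Q} → PosDef N Q → ∑ (reds N 1≤N Q) (λ g → wt (act Q g)) ≡ + 48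
  reds-total N 1≤N pd with R , refl ← reds-spec N 1≤N pd = Reductions.total R

module LevelForms (p : ℕ) (pp : Prime p) where
  open Level p pp public

  -- The leading coefficient of Q ∘ h is the value of Q at the first column of h.
  Nₚ : Form → ℤ
  Nₚ Q = ∑ (ℙ¹ p) (λ h → 𝟙 (p∣? proj₁ (act Q h)))

  h4ₚ : ℕ → ℤ
  h4ₚ N = ∑ (red N) (λ Q → wt Q * Nₚ Q)

  p∤1 : ¬ p∣ + 1
  p∤1 d with refl ← ℕDiv.∣1⇒≡1 (∣ₛ⇒∣ d) = ¬prime[1] pp

  instance
    +p-nonZero : ℤ.NonZero (+ p)
    +p-nonZero = ℤ.≢-nonZero (λ eq → ℕ.≢-nonZero⁻¹ p (ℤP.+-injective eq))

    pp-nonZero : ℤ.NonZero (+ p * + p)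
    pp-nonZero = ℤP.i*j≢0 (+ p) (+ p)

  -- The elementary divisors of an integral matrix of determinant p are 1 and p: it is h 𝐃 g for a
  -- unique h in `ℙ¹ p` and a unique g in SL₂(ℤ).
  𝐃 : Mat
  𝐃 = + 1 , + 0 , + 0 , + p

  act-𝐃 : ∀ a b c → act (a , b , c) 𝐃 ≡ (a , + p * b , + p * + p * c)
  act-𝐃 a b c = form≡ (r₁ a b c) (r₂ a b c (+ p)) (r₃ a b c (+ p))
    where
    r₁ : ∀ a b c → a * + 1 * + 1 + b * + 1 * + 0 + c * + 0 * + 0 ≡ a
    r₁ = solve-∀
    r₂ : ∀ a b c p → + 2 * a * + 1 * + 0 + b * (+ 1 * p + + 0 * + 0) + + 2 * c * + 0 * p ≡ p * b
    r₂ = solve-∀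
    r₃ : ∀ a b c p → a * + 0 * + 0 + b * + 0 * p + c * p * p ≡ p * p * c
    r₃ = solve-∀

  det-𝐃 : det 𝐃 ≡ + p
  det-𝐃 = ring (+ p)
    where
    ring : ∀ p → + 1 * p - + 0 * + 0 ≡ p
    ring = solve-∀

  𝐃-· : ∀ α β γ δ → 𝐃 · (α , β , γ , δ) ≡ (α , β , γ * + p , δ * + p)
  𝐃-· α β γ δ = mat≡ (r₁ α γ) (r₁ β δ) (r₂ α γ (+ p)) (r₂ β δ (+ p))
    where
    r₁ : ∀ x y → + 1 * x + + 0 * y ≡ x
    r₁ = solve-∀
    r₂ : ∀ x y p → + 0 * x + p * y ≡ y * p
    r₂ = solve-∀

  -- Both columns lie on the line of h mod p; a matrix of determinant p has rank one mod p.
  Lower : Mat → Mat → Set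
  Lower (α , β , γ , δ) h = p∣ low h α γ × p∣ low h β δ

  lower? : ∀ B h → Dec (Lower B h)
  lower? (α , β , γ , δ) h = (p∣? low h α γ) ×-dec (p∣? low h β δ)

  low-zero : ∀ h {x y} → p∣ x → p∣ y → p∣ low h x y
  low-zero (a , b , c , d) dx dy = ∣ₛ-+ (∣ₛ-*ˡ (- c) dx) (∣ₛ-*ˡ a dy)

  -- Otherwise p² would divide the determinant p.
  nonzero-column : ∀ {α β γ δ} → det (α , β , γ , δ) ≡ + p → p∣ α × p∣ γ → ¬ (p∣ β × p∣ δ)
  nonzero-column {α} {β} {γ} {δ} eq (divides a refl , divides c refl) (divides b refl , divides d refl) =
    p∤1 (divides (a * d - b * c) (ℤP.*-cancelʳ-≡ (+ 1) ((a * d - b * c) * + p) (+ p) (trans (ℤP.*-identityˡ (+ p)) (trans (sym eq) (ring a b c d (+ p))))))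
    where
    ring : ∀ a b c d p → a * p * (d * p) - b * p * (c * p) ≡ (a * d - b * c) * p * p
    ring = solve-∀

  lower-exists : ∀ B → det B ≡ + p → Σ Mat λ h → h ∈ ℙ¹ p × Lower B h
  lower-exists B@(α , β , γ , δ) eq with (p∣? α) ×-dec (p∣? γ)
  ... | yes (dα , dγ) = let h , h∈ , d = ℙ¹-exists β δ (nonzero-column eq (dα , dγ)) in h , h∈ , low-zero h dα dγ , d
  -- The matrix `adj h · B` has determinant p and a lower left entry divisible by p, so p divides
  -- the product of its diagonal entries. If p divided the upper left one, the first column of B
  -- would vanish mod p.
  ... | no ne with h , h∈ , d ← ℙ¹-exists α γ ne = h , h∈ , d , second (euclid (subst (p∣_) (sym detM) (∣ₛ-+ (∣ₛ-*ˡ (proj₁ (proj₂ M)) d) (divides (+ 1) (sym (ℤP.*-identityˡ (+ p)))))))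
    where
    M = adj h · B
    detM : proj₁ M * proj₂ (proj₂ (proj₂ M)) ≡ proj₁ (proj₂ M) * proj₁ (proj₂ (proj₂ M)) + + p
    detM = trans (add (proj₁ M * proj₂ (proj₂ (proj₂ M))) (proj₁ (proj₂ M) * proj₁ (proj₂ (proj₂ M)))) (cong (_+_ (proj₁ (proj₂ M) * proj₁ (proj₂ (proj₂ M)))) (trans (det-· (adj h) B) (trans (cong₂ _*_ (trans (det-adj h) (ℙ¹-det p h∈)) eq) (ℤP.*-identityˡ (+ p)))))
      where
      add : ∀ x y → x ≡ y + (x - y)
      add = solve-∀
    restore : h · M ≡ B
    restore = trans (sym (·-assoc h (adj h) B)) (trans (cong (_· B) (adj-inverseʳ h (ℙ¹-det p h∈))) (𝐈-identityˡ B))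
    second : p∣ proj₁ M ⊎ p∣ proj₂ (proj₂ (proj₂ M)) → p∣ proj₂ (proj₂ (proj₂ M))
    second (inj₂ q) = q
    second (inj₁ q) = contradiction (subst (p∣_) (cong proj₁ restore) (∣ₛ-+ (∣ₛ-*ˡ (proj₁ h) q) (∣ₛ-*ˡ (proj₁ (proj₂ h)) d)) ,
      subst (p∣_) (cong (proj₁ ∘ proj₂ ∘ proj₂) restore) (∣ₛ-+ (∣ₛ-*ˡ (proj₁ (proj₂ (proj₂ h))) q) (∣ₛ-*ˡ (proj₂ (proj₂ (proj₂ h))) d))) ne

  lower-unique : ∀ B → det B ≡ + p → ∀ {h h′} → h ∈ ℙ¹ p → h′ ∈ ℙ¹ p → Lower B h → Lower B h′ → h ≡ h′
  lower-unique B@(α , β , γ , δ) eq h∈ h′∈ (d , e) (d′ , e′) with (p∣? α) ×-dec (p∣? γ)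
  ... | yes z = ℙ¹-separates β δ (nonzero-column eq z) h∈ h′∈ e e′
  ... | no ne = ℙ¹-separates α γ ne h∈ h′∈ d d′

  -- The line is found by search. Multiplying by `adj h` makes the lower row divisible by p, and
  -- dividing it by p leaves g.
  hᶜ gᶜ : Mat → Mat
  hᶜ B = pick (lower? B) 𝐈 (ℙ¹ p)
  gᶜ B = let M = adj (hᶜ B) · B in proj₁ M , proj₁ (proj₂ M) , quot (+ p) (proj₁ (proj₂ (proj₂ M))) , quot (+ p) (proj₂ (proj₂ (proj₂ M)))

  hᶜ-spec : ∀ B → det B ≡ + p → hᶜ B ∈ ℙ¹ p × Lower B (hᶜ B)
  hᶜ-spec B eq = let h , h∈ , l = lower-exists B eq in pick-spec (lower? B) 𝐈 h∈ l

  decomposeᶜ : ∀ B → det B ≡ + p → hᶜ B · (𝐃 · gᶜ B) ≡ B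
  decomposeᶜ B eq = trans (cong (h ·_) (trans (𝐃-· (proj₁ M) (proj₁ (proj₂ M)) (quot (+ p) (proj₁ (proj₂ (proj₂ M)))) (quot (+ p) (proj₂ (proj₂ (proj₂ M)))))
      (mat≡ refl refl (sym (quot-spec (proj₁ (proj₂ spec)))) (sym (quot-spec (proj₂ (proj₂ spec)))))))
    (trans (sym (·-assoc h (adj h) B)) (trans (cong (_· B) (adj-inverseʳ h (ℙ¹-det p (proj₁ spec)))) (𝐈-identityˡ B)))
    where
    h = hᶜ B
    M = adj h · B
    spec = hᶜ-spec B eq

  gᶜ-det : ∀ B → det B ≡ + p → det (gᶜ B) ≡ + 1
  gᶜ-det B eq = ℤP.*-cancelˡ-≡ (+ p) (det (gᶜ B)) (+ 1) (begin
    + p * det (gᶜ B) ≡⟨ cong (_* det (gᶜ B)) (sym det-𝐃) ⟩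
    det 𝐃 * det (gᶜ B) ≡⟨ sym (det-· 𝐃 (gᶜ B)) ⟩
    det (𝐃 · gᶜ B) ≡⟨ sym (trans (cong (_* det (𝐃 · gᶜ B)) (ℙ¹-det p (proj₁ (hᶜ-spec B eq)))) (ℤP.*-identityˡ _)) ⟩
    det (hᶜ B) * det (𝐃 · gᶜ B) ≡⟨ sym (det-· (hᶜ B) (𝐃 · gᶜ B)) ⟩
    det (hᶜ B · (𝐃 · gᶜ B)) ≡⟨ cong det (decomposeᶜ B eq) ⟩
    det B ≡⟨ eq ⟩
    + p ≡⟨ sym (ℤP.*-identityʳ (+ p)) ⟩
    + p * + 1 ∎)

  decomposeᶜ-unique : ∀ h g → h ∈ ℙ¹ p → det g ≡ + 1 → hᶜ (h · (𝐃 · g)) ≡ h × gᶜ (h · (𝐃 · g)) ≡ g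
  decomposeᶜ-unique h g@(α , β , γ , δ) h∈ eq = h≡ , g≡
    where
    X = h · (𝐃 · g)
    detX : det X ≡ + p
    detX = trans (det-· h (𝐃 · g)) (trans (cong₂ _*_ (ℙ¹-det p h∈) (trans (det-· 𝐃 g) (trans (cong₂ _*_ det-𝐃 eq) (ℤP.*-identityʳ (+ p))))) (ℤP.*-identityˡ (+ p)))
    strip : adj h · X ≡ (α , β , γ * + p , δ * + p)
    strip = trans (sym (·-assoc (adj h) h (𝐃 · g))) (trans (cong (_· (𝐃 · g)) (adj-inverseˡ h (ℙ¹-det p h∈))) (trans (𝐈-identityˡ (𝐃 · g)) (𝐃-· α β γ δ)))
    h≡ : hᶜ X ≡ h
    h≡ = lower-unique X detX (proj₁ (hᶜ-spec X detX)) h∈ (proj₂ (hᶜ-spec X detX)) (divides γ (cong (proj₁ ∘ proj₂ ∘ proj₂) strip) , divides δ (cong (proj₂ ∘ proj₂ ∘ proj₂) strip))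
    quot-* : ∀ x → quot (+ p) (x * + p) ≡ x
    quot-* x = ℤP.*-cancelʳ-≡ (quot (+ p) (x * + p)) x (+ p) (sym (quot-spec (divides x refl)))
    g≡ : gᶜ X ≡ g
    g≡ = trans (cong (λ k → let M = adj k · X in (proj₁ M , proj₁ (proj₂ M) , quot (+ p) (proj₁ (proj₂ (proj₂ M))) , quot (+ p) (proj₂ (proj₂ (proj₂ M))))) h≡)
      (trans (cong (λ M → (proj₁ M , proj₁ (proj₂ M) , quot (+ p) (proj₁ (proj₂ (proj₂ M))) , quot (+ p) (proj₂ (proj₂ (proj₂ M))))) strip) (mat≡ refl refl (quot-* γ) (quot-* δ)))

  record Decomposition : Set where
    field
      hOf gOf          : Mat → Mat
      hOf-spec         : ∀ Y → det Y ≡ + p → hOf Y ∈ ℙ¹ p × Lower Y (hOf Y)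
      decompose        : ∀ Y → det Y ≡ + p → hOf Y · (𝐃 · gOf Y) ≡ Y
      gOf-det          : ∀ Y → det Y ≡ + p → det (gOf Y) ≡ + 1
      decompose-unique : ∀ h g → h ∈ ℙ¹ p → det g ≡ + 1 → hOf (h · (𝐃 · g)) ≡ h × gOf (h · (𝐃 · g)) ≡ g

  abstract
    decomposition : Decomposition
    decomposition = record
      { hOf = hᶜ ; gOf = gᶜ ; hOf-spec = hᶜ-spec ; decompose = decomposeᶜ ; gOf-det = gᶜ-det ; decompose-unique = decomposeᶜ-unique }

  open Decomposition decomposition public

-- Both sides count the triples (Q, Q′, X) with Q, Q′ reduced of discriminant -N, -p²N, det X = p and Q ∘ X = Q′.
module HeckeCount (p : ℕ) (pp : Prime p) (N : ℕ) (1≤N : 1 ≤ℕ N) where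
  open LevelForms p pp

  N′ : ℕ
  N′ = p *ℕ p *ℕ N

  1≤N′ : 1 ≤ℕ N′
  1≤N′ = ℕP.*-mono-≤ {1} {p *ℕ p} {1} (ℕP.*-mono-≤ {1} {p} {1} 1≤p 1≤p) 1≤N
    where
    1≤p : 1 ≤ℕ p
    1≤p = ℕ.>-nonZero⁻¹ p

  disc-N′ : + p * + p * - (+ N) ≡ - (+ N′)
  disc-N′ = trans (sym (ℤP.neg-distribʳ-* (+ p * + p) (+ N))) (cong -_ (trans (cong (_* + N) (sym (ℤP.pos-* p p))) (sym (ℤP.pos-* (p *ℕ p) N))))

  -- Since Q′ ∘ h ∘ 𝐃 has the coefficients a, p b, p² c, the condition says that p² divides it; the
  -- quotient is `descent`.
  Descends : Form → Mat → Set
  Descends Q′ h = (+ p * + p) ∣ₛ proj₁ (act Q′ h) × p∣ proj₁ (proj₂ (act Q′ h))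

  descends? : ∀ Q′ h → Dec (Descends Q′ h)
  descends? Q′ h = ((+ p * + p) ∣ₛ? proj₁ (act Q′ h)) ×-dec (p∣? proj₁ (proj₂ (act Q′ h)))

  descent : Form → Mat → Form
  descent Q′ h = quot (+ p * + p) (proj₁ (act Q′ h)) , quot (+ p) (proj₁ (proj₂ (act Q′ h))) , proj₂ (proj₂ (act Q′ h))

  descent-scale : ∀ Q′ h → Descends Q′ h → scaleF (+ p * + p) (descent Q′ h) ≡ act (act Q′ h) 𝐃
  descent-scale Q′ h (d , e) = sym (trans (act-𝐃 a b c) (form≡ (trans (quot-spec d) (ℤP.*-comm (quot (+ p * + p) a) (+ p * + p))) (trans (cong (+ p *_) (quot-spec e)) (ring (+ p) (quot (+ p) b))) refl))
    where
    a = proj₁ (act Q′ h)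
    b = proj₁ (proj₂ (act Q′ h))
    c = proj₂ (proj₂ (act Q′ h))
    ring : ∀ p q → p * (q * p) ≡ p * p * q
    ring = solve-∀

  descent-unique : ∀ Q′ h P → act (act Q′ h) 𝐃 ≡ scaleF (+ p * + p) P → Descends Q′ h × descent Q′ h ≡ P
  descent-unique Q′ h P@(a′ , b′ , c′) eq = ds , scaleF-injective (+ p * + p) (trans (descent-scale Q′ h ds) eq)
    where
    a = proj₁ (act Q′ h)
    b = proj₁ (proj₂ (act Q′ h))
    c = proj₂ (proj₂ (act Q′ h))
    eq′ : (a , + p * b , + p * + p * c) ≡ scaleF (+ p * + p) P
    eq′ = trans (sym (act-𝐃 a b c)) eq
    ds : Descends Q′ h
    ds = divides a′ (trans (cong proj₁ eq′) (ℤP.*-comm (+ p * + p) a′)) ,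
      divides b′ (ℤP.*-cancelˡ-≡ (+ p) b (b′ * + p) (trans (cong (proj₁ ∘ proj₂) eq′) (ring (+ p) b′)))
      where
      ring : ∀ p q → p * p * q ≡ p * (q * p)
      ring = solve-∀

  up : Form → Mat → Form
  up Q h = act (act Q h) 𝐃

  posDef-up : ∀ {Q h} → PosDef N Q → h ∈ ℙ¹ p → PosDef N′ (up Q h)
  posDef-up {Q} {h} pd h∈ = posDef 1≤N′
    (trans (disc-act Q₁ 𝐃) (trans (cong₂ (λ d e → d * d * e) det-𝐃 (PosDef.disc≡ pd₁)) disc-N′))
    (subst (+ 0 <_) (sym (cong proj₁ (act-𝐃 (proj₁ Q₁) (proj₁ (proj₂ Q₁)) (proj₂ (proj₂ Q₁))))) (PosDef.a>0 pd₁))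
    where
    Q₁ = act Q h
    pd₁ : PosDef N Q₁
    pd₁ = posDef-act h (ℙ¹-det p h∈) pd

  posDef-descent : ∀ {Q′ h} → PosDef N′ Q′ → h ∈ ℙ¹ p → Descends Q′ h → PosDef N (descent Q′ h)
  posDef-descent {Q′} {h} pd h∈ ds = posDef 1≤N disc′ a′>0
    where
    pd₁ : PosDef N′ (act Q′ h)
    pd₁ = posDef-act h (ℙ¹-det p h∈) pd
    k = + p * + p
    P = descent Q′ h
    disc′ : disc P ≡ - (+ N)
    disc′ = ℤP.*-cancelˡ-≡ k (disc P) (- (+ N)) (ℤP.*-cancelˡ-≡ k (k * disc P) (k * - (+ N)) (begin
      k * (k * disc P)    ≡⟨ sym (ℤP.*-assoc k k (disc P)) ⟩
      k * k * disc P      ≡⟨ sym (disc-scale k P) ⟩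
      disc (scaleF k P)   ≡⟨ cong disc (descent-scale Q′ h ds) ⟩
      disc (act (act Q′ h) 𝐃) ≡⟨ trans (disc-act (act Q′ h) 𝐃) (cong₂ (λ d e → d * d * e) det-𝐃 (PosDef.disc≡ pd₁)) ⟩
      k * - (+ N′)        ≡⟨ cong (k *_) (sym disc-N′) ⟩
      k * (k * - (+ N))   ∎))
    a′>0 : + 0 < proj₁ P
    a′>0 = *-cancel-pos {k} (subst (+ 0 <_) (ℤP.pos-* p p) (+<+ (ℕP.*-mono-≤ {1} {p} {1} (ℕ.>-nonZero⁻¹ p) (ℕ.>-nonZero⁻¹ p))))
      (subst (+ 0 <_) (trans (quot-spec (proj₁ ds)) (ℤP.*-comm (quot k (proj₁ (act Q′ h))) k)) (PosDef.a>0 pd₁))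

  -- A reduced form with a factored matrix X = h 𝐃 k. Below, k reduces Q ∘ h ∘ 𝐃; above, k reduces
  -- the descent of Q′ along h. The partner on the other level is thereby determined.
  Entry : Set
  Entry = Form × Mat × Mat

  aboveAt : Form → List (Mat × Mat)
  aboveAt Q′ = dpairs (filter (descends? Q′) (ℙ¹ p)) (λ h → reds N 1≤N (descent Q′ h))

  belowAt : Form → List (Mat × Mat)
  belowAt Q = dpairs (ℙ¹ p) (λ h → reds N′ 1≤N′ (up Q h))

  below above : List Entry
  below = dpairs (red N) belowAt
  above = dpairs (red N′) aboveAt

  X : Mat → Mat → Mat
  X h g = h · (𝐃 · g)

  act-X : ∀ Q h g → act Q (X h g) ≡ act (up Q h) g
  act-X Q h g = trans (sym (act-· Q h (𝐃 · g))) (sym (act-· (act Q h) 𝐃 g))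

  det-X : ∀ {h g} → h ∈ ℙ¹ p → det g ≡ + 1 → det (X h g) ≡ + p
  det-X {h} {g} h∈ eq = trans (det-· h (𝐃 · g)) (trans (cong₂ _*_ (ℙ¹-det p h∈) (trans (det-· 𝐃 g) (trans (cong₂ _*_ det-𝐃 eq) (ℤP.*-identityʳ (+ p))))) (ℤP.*-identityˡ (+ p)))

  act-twice : ∀ Q Y → det Y ≡ + p → act (act Q Y) (adj Y) ≡ scaleF (+ p * + p) Q
  act-twice Q Y eq = trans (act-·-adj Q Y) (cong (λ d → scaleF (d * d) Q) eq)

  -- As (Q ∘ X) ∘ adj X = p² Q, passing to the adjugate exchanges the two levels. It again has
  -- determinant p and is factored anew.
  f g : Entry → Entry
  f (Q , h , k)  = act Q (X h k) , hOf (adj (X h k)) , gOf (adj (X h k))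
  g (Q′ , h , k) = act (descent Q′ h) k , hOf (adj (X h k)) , gOf (adj (X h k))

  module Upwards (Q Q′ : Form) (h k h′ k′ Y C : Mat)
    (Y≡ : X h k ≡ Y) (C≡ : adj Y ≡ C) (Q′≡ : act Q Y ≡ Q′) (h′≡ : hOf C ≡ h′) (k′≡ : gOf C ≡ k′)
    (Q∈ : Q ∈ red N) (h∈ : h ∈ ℙ¹ p) (k∈ : k ∈ reds N′ 1≤N′ (up Q h)) where

    pd : PosDef N Q
    pd = proj₁ (∈-red⁻ N {Q} 1≤N Q∈)

    detk : det k ≡ + 1
    detk = proj₁ (reds-sound N′ 1≤N′ {up Q h} {k} (posDef-up {Q} {h} pd h∈) k∈)

    detY : det Y ≡ + p
    detY = trans (cong det (sym Y≡)) (det-X {h} {k} h∈ detk)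

    detC : det C ≡ + p
    detC = trans (cong det (sym C≡)) (trans (det-adj Y) detY)

    h′∈ : h′ ∈ ℙ¹ p
    h′∈ = subst (_∈ ℙ¹ p) h′≡ (proj₁ (hOf-spec C detC))

    detk′ : det k′ ≡ + 1
    detk′ = trans (cong det (sym k′≡)) (gOf-det C detC)

    whole : act (up Q h) k ≡ Q′
    whole = trans (sym (act-X Q h k)) (trans (cong (act Q) Y≡) Q′≡)

    Q′∈ : Q′ ∈ red N′
    Q′∈ = ∈-red⁺ N′ {Q′} 1≤N′
      (trans (cong disc (sym Q′≡)) (trans (disc-act Q Y) (trans (cong₂ (λ d e → d * d * e) detY (PosDef.disc≡ pd)) disc-N′)))
      (subst (λ P → wt P ≢ + 0) whole (proj₂ (reds-sound N′ 1≤N′ {up Q h} {k} (posDef-up {Q} {h} pd h∈) k∈)))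

    factors : X h′ k′ ≡ C
    factors = trans (cong₂ X (sym h′≡) (sym k′≡)) (decompose C detC)

    lifted : act (up Q′ h′) k′ ≡ scaleF (+ p * + p) Q
    lifted = trans (sym (act-X Q′ h′ k′)) (trans (cong (act Q′) factors) (trans (cong₂ act (sym Q′≡) (sym C≡)) (act-twice Q Y detY)))

    -- Cancelling k′ in `lifted` exhibits Q′ ∘ h′ ∘ 𝐃 as p² times an integral form.
    desc : Descends Q′ h′ × descent Q′ h′ ≡ act Q (adj k′)
    desc = descent-unique Q′ h′ (act Q (adj k′)) (trans (sym (act-adj {up Q′ h′} {scaleF (+ p * + p) Q} k′ detk′ lifted)) (act-scale (+ p * + p) Q (adj k′)))

    restored : act (descent Q′ h′) k′ ≡ Q
    restored = trans (cong (λ P → act P k′) (proj₂ desc)) (trans (act-· Q (adj k′) k′) (trans (cong (act Q) (adj-inverseˡ k′ detk′)) (act-𝐈 Q)))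

    k′∈ : k′ ∈ reds N 1≤N (descent Q′ h′)
    k′∈ = reds-complete N 1≤N {descent Q′ h′} {k′} (posDef-descent {Q′} {h′} (proj₁ (∈-red⁻ N′ {Q′} 1≤N′ Q′∈)) h′∈ (proj₁ desc)) detk′
      (subst (λ P → wt P ≢ + 0) (sym restored) (proj₂ (∈-red⁻ N {Q} 1≤N Q∈)))

    member : (Q′ , h′ , k′) ∈ above
    member = ∈-dpairs⁺ {xs = red N′} {ys = aboveAt} {x = Q′} {y = h′ , k′} Q′∈
      (∈-dpairs⁺ {xs = filter (descends? Q′) (ℙ¹ p)} {ys = λ h → reds N 1≤N (descent Q′ h)} {x = h′} {y = k′} (∈P.∈-filter⁺ (descends? Q′) h′∈ (proj₁ desc)) k′∈)

    back : adj (X h′ k′) ≡ X h k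
    back = trans (cong adj (trans factors (sym C≡))) (trans (adj-adj Y) (sym Y≡))

    h-back : hOf (adj (X h′ k′)) ≡ h
    h-back = trans (cong hOf back) (proj₁ (decompose-unique h k h∈ detk))

    k-back : gOf (adj (X h′ k′)) ≡ k
    k-back = trans (cong gOf back) (proj₂ (decompose-unique h k h∈ detk))

  module Downwards (Q′ Q : Form) (h k h₁ k₁ Y : Mat)
    (Q≡ : act (descent Q′ h) k ≡ Q) (Y≡ : adj (X h k) ≡ Y) (h₁≡ : hOf Y ≡ h₁) (k₁≡ : gOf Y ≡ k₁)
    (Q′∈ : Q′ ∈ red N′) (h∈ : h ∈ ℙ¹ p) (ds : Descends Q′ h) (k∈ : k ∈ reds N 1≤N (descent Q′ h)) where

    pd : PosDef N (descent Q′ h)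
    pd = posDef-descent {Q′} {h} (proj₁ (∈-red⁻ N′ {Q′} 1≤N′ Q′∈)) h∈ ds

    detk : det k ≡ + 1
    detk = proj₁ (reds-sound N 1≤N {descent Q′ h} {k} pd k∈)

    pdQ : PosDef N Q
    pdQ = subst (PosDef N) Q≡ (posDef-act {N} {descent Q′ h} k detk pd)

    detX : det (X h k) ≡ + p
    detX = det-X {h} {k} h∈ detk

    detY : det Y ≡ + p
    detY = trans (cong det (sym Y≡)) (trans (det-adj (X h k)) detX)

    h₁∈ : h₁ ∈ ℙ¹ p
    h₁∈ = subst (_∈ ℙ¹ p) h₁≡ (proj₁ (hOf-spec Y detY))

    detk₁ : det k₁ ≡ + 1
    detk₁ = trans (cong det (sym k₁≡)) (gOf-det Y detY)

    factors : X h₁ k₁ ≡ Y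
    factors = trans (cong₂ X (sym h₁≡) (sym k₁≡)) (decompose Y detY)

    scaled : scaleF (+ p * + p) Q ≡ act Q′ (X h k)
    scaled = trans (cong (scaleF (+ p * + p)) (sym Q≡)) (trans (sym (act-scale (+ p * + p) (descent Q′ h) k))
      (trans (cong (λ P → act P k) (descent-scale Q′ h ds)) (sym (act-X Q′ h k))))

    -- Both sides agree after multiplication by p², as Y is the adjugate of a matrix of determinant
    -- p.
    restored : act Q Y ≡ Q′
    restored = scaleF-injective (+ p * + p) {act Q Y} {Q′} (trans (sym (act-scale (+ p * + p) Q Y))
      (trans (cong₂ act scaled (sym Y≡)) (act-twice Q′ (X h k) detX)))

    whole : act (up Q h₁) k₁ ≡ Q′
    whole = trans (sym (act-X Q h₁ k₁)) (trans (cong (act Q) factors) restored)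

    Q∈ : Q ∈ red N
    Q∈ = ∈-red⁺ N {Q} 1≤N (PosDef.disc≡ pdQ) (subst (λ P → wt P ≢ + 0) Q≡ (proj₂ (reds-sound N 1≤N {descent Q′ h} {k} pd k∈)))

    k₁∈ : k₁ ∈ reds N′ 1≤N′ (up Q h₁)
    k₁∈ = reds-complete N′ 1≤N′ {up Q h₁} {k₁} (posDef-up {Q} {h₁} pdQ h₁∈) detk₁ (subst (λ P → wt P ≢ + 0) (sym whole) (proj₂ (∈-red⁻ N′ {Q′} 1≤N′ Q′∈)))

    member : (Q , h₁ , k₁) ∈ below
    member = ∈-dpairs⁺ {xs = red N} {ys = belowAt} {x = Q} {y = h₁ , k₁} Q∈
      (∈-dpairs⁺ {xs = ℙ¹ p} {ys = λ h → reds N′ 1≤N′ (up Q h)} {x = h₁} {y = k₁} h₁∈ k₁∈)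

    back : adj (X h₁ k₁) ≡ X h k
    back = trans (cong adj (trans factors (sym Y≡))) (adj-adj (X h k))

    Q-back : act Q (X h₁ k₁) ≡ Q′
    Q-back = trans (act-X Q h₁ k₁) whole

    h-back : hOf (adj (X h₁ k₁)) ≡ h
    h-back = trans (cong hOf back) (proj₁ (decompose-unique h k h∈ detk))

    k-back : gOf (adj (X h₁ k₁)) ≡ k
    k-back = trans (cong gOf back) (proj₂ (decompose-unique h k h∈ detk))

  vBelow vAbove : Entry → ℤ
  vBelow (Q , h , k)  = wt Q * wt (act (up Q h) k)
  vAbove (Q′ , h , k) = wt Q′ * wt (act (descent Q′ h) k)

  module FromBelow (Q : Form) (h k : Mat) (e∈ : (Q , h , k) ∈ below) where
    Q∈ : Q ∈ red N
    Q∈ = proj₁ (∈-dpairs⁻ {xs = red N} {ys = belowAt} {x = Q} {y = h , k} e∈)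
    hk∈ : (h , k) ∈ belowAt Q
    hk∈ = proj₂ (∈-dpairs⁻ {xs = red N} {ys = belowAt} {x = Q} {y = h , k} e∈)
    h∈ : h ∈ ℙ¹ p
    h∈ = proj₁ (∈-dpairs⁻ {xs = ℙ¹ p} {ys = λ h → reds N′ 1≤N′ (up Q h)} {x = h} {y = k} hk∈)
    k∈ : k ∈ reds N′ 1≤N′ (up Q h)
    k∈ = proj₂ (∈-dpairs⁻ {xs = ℙ¹ p} {ys = λ h → reds N′ 1≤N′ (up Q h)} {x = h} {y = k} hk∈)
    open Upwards Q (act Q (X h k)) h k (hOf (adj (X h k))) (gOf (adj (X h k))) (X h k) (adj (X h k)) refl refl refl refl refl Q∈ h∈ k∈ public

  module FromAbove (Q′ : Form) (h k : Mat) (e∈ : (Q′ , h , k) ∈ above) where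
    Q′∈ : Q′ ∈ red N′
    Q′∈ = proj₁ (∈-dpairs⁻ {xs = red N′} {ys = aboveAt} {x = Q′} {y = h , k} e∈)
    hk∈ : (h , k) ∈ aboveAt Q′
    hk∈ = proj₂ (∈-dpairs⁻ {xs = red N′} {ys = aboveAt} {x = Q′} {y = h , k} e∈)
    hf∈ : h ∈ filter (descends? Q′) (ℙ¹ p)
    hf∈ = proj₁ (∈-dpairs⁻ {xs = filter (descends? Q′) (ℙ¹ p)} {ys = λ h → reds N 1≤N (descent Q′ h)} {x = h} {y = k} hk∈)
    h∈ : h ∈ ℙ¹ p
    h∈ = proj₁ (∈P.∈-filter⁻ (descends? Q′) {xs = ℙ¹ p} hf∈)
    ds : Descends Q′ h
    ds = proj₂ (∈P.∈-filter⁻ (descends? Q′) {xs = ℙ¹ p} hf∈)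
    k∈ : k ∈ reds N 1≤N (descent Q′ h)
    k∈ = proj₂ (∈-dpairs⁻ {xs = filter (descends? Q′) (ℙ¹ p)} {ys = λ h → reds N 1≤N (descent Q′ h)} {x = h} {y = k} hk∈)
    open Downwards Q′ (act (descent Q′ h) k) h k (hOf (adj (X h k))) (gOf (adj (X h k))) (adj (X h k)) refl refl refl refl Q′∈ h∈ ds k∈ public

  double-count : ∑ below vBelow ≡ ∑ above vAbove
  double-count = ∑-bij
    (dpairs-unique (red-unique N) (λ {Q} _ → dpairs-unique (ℙ¹-unique p) (λ {h} _ → reds-unique N′ 1≤N′ (up Q h))))
    (dpairs-unique (red-unique N′) (λ {Q′} _ → dpairs-unique (UniqueP.filter⁺ (descends? Q′) (ℙ¹-unique p)) (λ {h} _ → reds-unique N 1≤N (descent Q′ h))))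
    f g to from weights
    where
    to : ∀ {e} → e ∈ below → f e ∈ above × g (f e) ≡ e
    to {Q , h , k} e∈ = FromBelow.member Q h k e∈ , cong₂ _,_ (FromBelow.restored Q h k e∈) (cong₂ _,_ (FromBelow.h-back Q h k e∈) (FromBelow.k-back Q h k e∈))
    from : ∀ {e} → e ∈ above → g e ∈ below × f (g e) ≡ e
    from {Q′ , h , k} e∈ = FromAbove.member Q′ h k e∈ , cong₂ _,_ (FromAbove.Q-back Q′ h k e∈) (cong₂ _,_ (FromAbove.h-back Q′ h k e∈) (FromAbove.k-back Q′ h k e∈))
    weights : ∀ {e} → e ∈ below → vBelow e ≡ vAbove (f e)
    weights {Q , h , k} e∈ = trans (ℤP.*-comm (wt Q) (wt (act (up Q h) k))) (cong₂ _*_ (cong wt (FromBelow.whole Q h k e∈)) (cong wt (sym (FromBelow.restored Q h k e∈))))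

  -- For each Q and each of the p + 1 lines the inner sum is the total weight 48 of all reductions
  -- of one form.
  ∑below : ∑ below vBelow ≡ + 48 * (+ suc p * h4 N)
  ∑below = begin
    ∑ below vBelow
      ≡⟨ trans (∑-dpairs (red N) belowAt vBelow) (∑-cong (red N) (λ Q → ∑-dpairs (ℙ¹ p) (λ h → reds N′ 1≤N′ (up Q h)) (λ e → vBelow (Q , e)))) ⟩
    ∑ (red N) (λ Q → ∑ (ℙ¹ p) (λ h → ∑ (reds N′ 1≤N′ (up Q h)) (λ k → wt Q * wt (act (up Q h) k))))
      ≡⟨ ∑-cong∈ (red N) (λ {Q} Q∈ → trans (∑-cong∈ (ℙ¹ p) (λ {h} h∈ → trans (∑-*ˡ (wt Q) (reds N′ 1≤N′ (up Q h)) (λ k → wt (act (up Q h) k))) (cong (wt Q *_) (reds-total N′ 1≤N′ (posDef-up (proj₁ (∈-red⁻ N 1≤N Q∈)) h∈)))))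
           (trans (∑-const (wt Q * + 48) (ℙ¹ p)) (trans (cong (λ l → + l * (wt Q * + 48)) (ℙ¹-length p)) (ring (+ suc p) (wt Q))))) ⟩
    ∑ (red N) (λ Q → + 48 * + suc p * wt Q)
      ≡⟨ trans (∑-*ˡ (+ 48 * + suc p) (red N) wt) (trans (cong (+ 48 * + suc p *_) (∑red N)) (ℤP.*-assoc (+ 48) (+ suc p) (h4 N))) ⟩
    + 48 * (+ suc p * h4 N) ∎
    where
    ring : ∀ s w → s * (w * + 48) ≡ + 48 * s * w
    ring = solve-∀

  Kₚ : Form → ℤ
  Kₚ Q′ = ∑ (ℙ¹ p) (λ h → 𝟙 (descends? Q′ h))

  ∑above : ∑ above vAbove ≡ + 48 * ∑ (red N′) (λ Q′ → wt Q′ * Kₚ Q′)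
  ∑above = begin
    ∑ above vAbove
      ≡⟨ trans (∑-dpairs (red N′) aboveAt vAbove) (∑-cong (red N′) (λ Q′ → ∑-dpairs (filter (descends? Q′) (ℙ¹ p)) (λ h → reds N 1≤N (descent Q′ h)) (λ e → vAbove (Q′ , e)))) ⟩
    ∑ (red N′) (λ Q′ → ∑ (filter (descends? Q′) (ℙ¹ p)) (λ h → ∑ (reds N 1≤N (descent Q′ h)) (λ k → wt Q′ * wt (act (descent Q′ h) k))))
      ≡⟨ ∑-cong∈ (red N′) (λ {Q′} Q′∈ → trans (∑-cong∈ (filter (descends? Q′) (ℙ¹ p)) (λ {h} hf∈ → let h∈ , ds = ∈P.∈-filter⁻ (descends? Q′) {xs = ℙ¹ p} hf∈ in
             trans (∑-*ˡ (wt Q′) (reds N 1≤N (descent Q′ h)) (λ k → wt (act (descent Q′ h) k))) (cong (wt Q′ *_) (reds-total N 1≤N (posDef-descent (proj₁ (∈-red⁻ N′ 1≤N′ Q′∈)) h∈ ds)))))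
           (trans (∑-filter (descends? Q′) (ℙ¹ p) (λ _ → wt Q′ * + 48)) (trans (∑-*ʳ (wt Q′ * + 48) (ℙ¹ p) (λ h → 𝟙 (descends? Q′ h))) (ring (Kₚ Q′) (wt Q′))))) ⟩
    ∑ (red N′) (λ Q′ → + 48 * (wt Q′ * Kₚ Q′))
      ≡⟨ ∑-*ˡ (+ 48) (red N′) (λ Q′ → wt Q′ * Kₚ Q′) ⟩
    + 48 * ∑ (red N′) (λ Q′ → wt Q′ * Kₚ Q′) ∎
    where
    ring : ∀ s w → s * (w * + 48) ≡ + 48 * (w * s)
    ring = solve-∀

  ∑wK : + suc p * h4 N ≡ ∑ (red N′) (λ Q′ → wt Q′ * Kₚ Q′)
  ∑wK = ℤP.*-cancelˡ-≡ (+ 48) (+ suc p * h4 N) (∑ (red N′) (λ Q′ → wt Q′ * Kₚ Q′)) (trans (sym ∑below) (trans double-count ∑above))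

ς-scale : ∀ p .{{_ : NonZero p}} x → ς (+ p * x) ≡ ς x
ς-scale (suc p) (+ 0)      = cong ς (ℤP.*-zeroʳ (+ suc p))
ς-scale (suc p) (+[1+ n ]) = refl
ς-scale (suc p) (-[1+ n ]) = refl

wt-scale : ∀ p .{{_ : NonZero p}} Q → wt (scaleF (+ p) Q) ≡ wt Q
wt-scale p (a , b , c) = cong₂ _*_ (trans (cong ς (r₁ (+ p) a b)) (ς-scale p (+ 2 * a + b)))
  (cong₂ _*_ (trans (cong ς (r₁ (+ p) c b)) (ς-scale p (+ 2 * c + b))) (trans (cong ς (r₂ (+ p) b)) (ς-scale p (- b))))
  where
  r₁ : ∀ p x y → + 2 * (p * x) + p * y ≡ p * (+ 2 * x + y)
  r₁ = solve-∀
  r₂ : ∀ p y → - (p * y) ≡ p * - y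
  r₂ = solve-∀

-- Forms primitive or divisible at p, and the Hecke relation

module Hecke (p : ℕ) (pp : Prime p) (p≢2 : p ≢ 2) (N : ℕ) (1≤N : 1 ≤ℕ N) where
  open LevelForms p pp
  open HeckeCount p pp N 1≤N

  -- Here p ≠ 2 enters: 2 and 4 are invertible mod p when squares are completed.
  p∤2 : ¬ p∣ + 2
  p∤2 d = small-prime p pp p≢2 (ℕDiv.∣⇒≤ (∣ₛ⇒∣ d))
    where
    small-prime : ∀ p → Prime p → p ≢ 2 → ¬ (p ≤ℕ 2)
    small-prime 0 pp _ _ = ¬prime[0] pp
    small-prime 1 pp _ _ = ¬prime[1] pp
    small-prime 2 _ ne _ = ne refl
    small-prime (suc (suc (suc p))) _ _ (s≤s (s≤s ()))

  p∤4* : ∀ {x} → ¬ p∣ x → ¬ p∣ + 4 * x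
  p∤4* {x} ne d with euclid {+ 2} {+ 2 * x} (subst (p∣_) (ring x) d)
    where
    ring : ∀ x → + 4 * x ≡ + 2 * (+ 2 * x)
    ring = solve-∀
  ... | inj₁ q = p∤2 q
  ... | inj₂ q with euclid {+ 2} {x} q
  ...   | inj₁ r = p∤2 r
  ...   | inj₂ r = ne r

  p∣square : ∀ {x} → p∣ x * x → p∣ x
  p∣square d with euclid d
  ... | inj₁ q = q
  ... | inj₂ q = q

  AllDiv : Form → Set
  AllDiv (a , b , c) = p∣ a × p∣ b × p∣ c

  allDiv? : ∀ Q → Dec (AllDiv Q)
  allDiv? (a , b , c) = (p∣? a) ×-dec ((p∣? b) ×-dec (p∣? c))

  AllDiv-act : ∀ Q g → AllDiv Q → AllDiv (act Q g)
  AllDiv-act (a , b , c) (α , β , γ , δ) (da , db , dc) =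
    ∣ₛ-+ (∣ₛ-+ (∣ₛ-*ʳ α (∣ₛ-*ʳ α da)) (∣ₛ-*ʳ γ (∣ₛ-*ʳ α db))) (∣ₛ-*ʳ γ (∣ₛ-*ʳ γ dc)) ,
    ∣ₛ-+ (∣ₛ-+ (∣ₛ-*ʳ β (∣ₛ-*ʳ α (∣ₛ-*ˡ (+ 2) da))) (∣ₛ-*ʳ (α * δ + β * γ) db)) (∣ₛ-*ʳ δ (∣ₛ-*ʳ γ (∣ₛ-*ˡ (+ 2) dc))) ,
    ∣ₛ-+ (∣ₛ-+ (∣ₛ-*ʳ β (∣ₛ-*ʳ β da)) (∣ₛ-*ʳ δ (∣ₛ-*ʳ β db))) (∣ₛ-*ʳ δ (∣ₛ-*ʳ δ dc))

  weaken : ∀ {z} → (+ p * + p) ∣ₛ z → p∣ z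
  weaken (divides q refl) = divides (q * + p) (sym (ℤP.*-assoc q (+ p) (+ p)))

  -- With p dividing a and b, the form is c y² mod p.
  isotropic : ∀ Q M → p∣ proj₁ (act Q M) → p∣ proj₁ Q → p∣ proj₁ (proj₂ Q) → ¬ p∣ proj₂ (proj₂ Q) → p∣ proj₁ (proj₂ (proj₂ M))
  isotropic (a , b , c) (x , _ , y , _) d da db nc = last (euclid {c} (subst (p∣_) (ring a b c x y) (∣ₛ-+ d (∣ₛ-neg (∣ₛ-+ (∣ₛ-*ʳ (x * x) da) (∣ₛ-*ʳ (x * y) db))))))
    where
    ring : ∀ a b c x y → (a * x * x + b * x * y + c * y * y) + - (a * (x * x) + b * (x * y)) ≡ c * (y * y)
    ring = solve-∀
    last : p∣ c ⊎ p∣ y * y → p∣ y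
    last (inj₁ dc) = contradiction dc nc
    last (inj₂ q)  = p∣square q

  -- A primitive form with discriminant divisible by p² has exactly one zero mod p, and descends there.
  module Primitive (Q′ : Form) (pd : PosDef N′ Q′) (prim : ¬ AllDiv Q′) where

    prim-act : ∀ {h} → h ∈ ℙ¹ p → ¬ AllDiv (act Q′ h)
    prim-act {h} h∈ d = prim (subst AllDiv (act-adj {Q′} h (ℙ¹-det p h∈) refl) (AllDiv-act (act Q′ h) (adj h) d))

    disc-p : ∀ {a b c} → disc (a , b , c) ≡ - (+ N′) → b * b ≡ + 4 * a * c + - (+ p * + p * + N)
    disc-p {a} {b} {c} eq = trans (add (b * b) (+ 4 * a * c)) (cong (_+_ (+ 4 * a * c)) (trans eq (cong -_ (trans (ℤP.pos-* (p *ℕ p) N) (cong (_* + N) (ℤP.pos-* p p))))))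
      where
      add : ∀ x y → x ≡ y + (x - y)
      add = solve-∀

    middle : ∀ {a b c} → disc (a , b , c) ≡ - (+ N′) → p∣ a → p∣ b
    middle {a} {b} {c} eq da = p∣square (subst (p∣_) (sym (disc-p {a} {b} {c} eq)) (∣ₛ-+ (∣ₛ-*ʳ c (∣ₛ-*ˡ (+ 4) da)) (∣ₛ-neg (divides (+ p * + N) (ring (+ p) (+ N))))))
      where
      ring : ∀ p n → p * p * n ≡ p * n * p
      ring = solve-∀

    -- For a = x p and b = y p the equation b² = 4ac - p²N makes 4 c x p divisible by p², and 4c is
    -- prime to p.
    squared : ∀ a b c → disc (a , b , c) ≡ - (+ N′) → p∣ a → p∣ b → ¬ p∣ c → (+ p * + p) ∣ₛ a
    squared a b c eq (divides x refl) (divides y refl) nc with euclid {+ 4 * c} {x} (divides (y * y + + N) (ℤP.*-cancelʳ-≡ (+ 4 * c * x) ((y * y + + N) * + p) (+ p) (trans (r₁ c x (+ p)) (trans (sub (y * + p * (y * + p)) (+ 4 * (x * + p) * c) (+ p * + p * + N) (disc-p {x * + p} {y * + p} {c} eq)) (r₂ y (+ p) (+ N))))))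
      where
      r₁ : ∀ c x p → + 4 * c * x * p ≡ + 4 * (x * p) * c
      r₁ = solve-∀
      r₂ : ∀ y p n → y * p * (y * p) + p * p * n ≡ (y * y + n) * p * p
      r₂ = solve-∀
      sub : ∀ s t n → s ≡ t + - n → t ≡ s + n
      sub s t n refl = back t n
        where
        back : ∀ t n → t ≡ t + - n + n
        back = solve-∀
    ... | inj₁ q = contradiction q (p∤4* nc)
    ... | inj₂ (divides z refl) = divides z (ℤP.*-assoc z (+ p) (+ p))

    zero⇒descends : ∀ {h} → h ∈ ℙ¹ p → p∣ proj₁ (act Q′ h) → Descends Q′ h
    zero⇒descends {h} h∈ da = squared (proj₁ Q₁) (proj₁ (proj₂ Q₁)) (proj₂ (proj₂ Q₁)) eq da db (λ dc → prim-act h∈ (da , db , dc)) , db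
      where
      Q₁ = act Q′ h
      eq = trans (disc-act₁ Q′ h (ℙ¹-det p h∈)) (PosDef.disc≡ pd)
      db = middle {proj₁ Q₁} {proj₁ (proj₂ Q₁)} {proj₂ (proj₂ Q₁)} eq da

    -- If p divides c, then (0 : 1) is a zero. Otherwise 4c Q(X, Y) = (2cY + bX)² + p²N X² shows a
    -- double zero mod p at (2c : -b).
    zero-exists : Σ Mat λ h → h ∈ ℙ¹ p × p∣ proj₁ (act Q′ h)
    zero-exists = go Q′ (PosDef.disc≡ pd)
      where
      go : ∀ Q → disc Q ≡ - (+ N′) → Σ Mat λ h → h ∈ ℙ¹ p × p∣ proj₁ (act Q h)
      go (a , b , c) eq with p∣? c
      ... | yes dc = line∞ , here refl , subst (p∣_) (ring a b c) dc
        where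
        ring : ∀ a b c → c ≡ a * + 0 * + 0 + b * + 0 * + 1 + c * + 1 * + 1
        ring = solve-∀
      ... | no nc = finish (ℙ¹-exists (+ 2 * c) (- b) (λ d → p∤2c (proj₁ d)))
        where
        p∤2c : ¬ p∣ + 2 * c
        p∤2c d with euclid {+ 2} {c} d
        ... | inj₁ q = p∤2 q
        ... | inj₂ q = nc q
        finish : (Σ Mat λ h → h ∈ ℙ¹ p × p∣ low h (+ 2 * c) (- b)) → Σ Mat λ h → h ∈ ℙ¹ p × p∣ proj₁ (act (a , b , c) h)
        finish (_ , here refl , d) = contradiction (subst (p∣_) (ring c b) (∣ₛ-neg d)) p∤2c
          where
          ring : ∀ c b → - (- + 1 * (+ 2 * c) + + 0 * - b) ≡ + 2 * c
          ring = solve-∀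
        finish (_ , there h∈ , d) with j , _ , refl ← ∈P.∈-map⁻ line h∈ = line j , there h∈ , value (euclid {+ 4 * c} (subst (p∣_) (sym (complete-square (disc-p {a} {b} {c} eq))) (∣ₛ-+ (∣ₛ-*ʳ (- (+ j) * (+ 2 * c) + + 1 * - b) d) (divides (+ p * + N) (ring (+ p) (+ N))))))
          where
          v = a * + 1 * + 1 + b * + 1 * + j + c * + j * + j
          ring : ∀ p n → p * p * n ≡ p * n * p
          ring = solve-∀
          complete-square : b * b ≡ + 4 * a * c + - (+ p * + p * + N) → + 4 * c * v ≡ (- (+ j) * (+ 2 * c) + + 1 * - b) * (- (+ j) * (+ 2 * c) + + 1 * - b) + + p * + p * + N
          complete-square e = trans (r₁ a b c (+ j)) (trans (cong (λ s → (- (+ j) * (+ 2 * c) + + 1 * - b) * (- (+ j) * (+ 2 * c) + + 1 * - b) + (+ 4 * a * c - s)) e) (r₂ ((- (+ j) * (+ 2 * c) + + 1 * - b) * (- (+ j) * (+ 2 * c) + + 1 * - b)) (+ 4 * a * c) (+ p * + p * + N)))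
            where
            r₁ : ∀ a b c j → + 4 * c * (a * + 1 * + 1 + b * + 1 * j + c * j * j) ≡ (- j * (+ 2 * c) + + 1 * - b) * (- j * (+ 2 * c) + + 1 * - b) + (+ 4 * a * c - b * b)
            r₁ = solve-∀
            r₂ : ∀ s t n → s + (t - (t + - n)) ≡ s + n
            r₂ = solve-∀
          value : p∣ + 4 * c ⊎ p∣ v → p∣ v
          value (inj₁ q) = contradiction q (p∤4* nc)
          value (inj₂ q) = q

    -- Once the descending zero is moved to (1 : 0), the form is c y² mod p with c prime to p, so
    -- `isotropic` locates every zero.
    zero-unique : ∀ {h h′} → h ∈ ℙ¹ p → h′ ∈ ℙ¹ p → Descends Q′ h → p∣ proj₁ (act Q′ h′) → h ≡ h′
    zero-unique {h} {h′@(α , β , γ , δ)} h∈ h′∈ (da , db) d′ = ℙ¹-separates α γ column h∈ h′∈ isolated (divides (+ 0) (cancel α γ))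
      where
      cancel : ∀ x y → - y * x + x * y ≡ + 0
      cancel = solve-∀
      column : ¬ (p∣ α × p∣ γ)
      column (dα , dγ) = p∤1 (subst (p∣_) (ℙ¹-det p h′∈) (∣ₛ-+ (∣ₛ-*ʳ δ dα) (∣ₛ-neg (∣ₛ-*ˡ β dγ))))
      back : act (act Q′ h) (adj h · h′) ≡ act Q′ h′
      back = trans (act-· Q′ h (adj h · h′)) (cong (act Q′) (trans (sym (·-assoc h (adj h) h′)) (trans (cong (_· h′) (adj-inverseʳ h (ℙ¹-det p h∈))) (𝐈-identityˡ h′))))
      isolated : p∣ low h α γ
      isolated = isotropic (act Q′ h) (adj h · h′) (subst (λ P → p∣ proj₁ P) (sym back) d′) (weaken da) db (λ dc → prim-act {h} h∈ (weaken da , db , dc))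

    K≡1 : Kₚ Q′ ≡ + 1
    K≡1 = trans
      (∑-single {xs = ℙ¹ p} {x₀ = h} {f = λ h → 𝟙 (descends? Q′ h)} (ℙ¹-unique p) h∈
        (λ {h′} h′∈ ne → 𝟙-no (descends? Q′ h′) (λ ds′ → ne (sym (zero-unique {h} {h′} h∈ h′∈ ds (weaken (proj₁ ds′)))))))
      (𝟙-yes (descends? Q′ h) ds)
      where
      h : Mat
      h = proj₁ zero-exists
      h∈ : h ∈ ℙ¹ p
      h∈ = proj₁ (proj₂ zero-exists)
      ds : Descends Q′ h
      ds = zero⇒descends {h} h∈ (proj₂ (proj₂ zero-exists))

  -- p² divides p a exactly when p divides a, and the middle coefficient of a multiple of p
  -- satisfies its condition.
  K-scale : ∀ Q → Kₚ (scaleF (+ p) Q) ≡ Nₚ Q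
  K-scale Q = ∑-cong (ℙ¹ p) (λ h → 𝟙-cong (descends? (scaleF (+ p) Q) h) (p∣? proj₁ (act Q h)) (to′ h) (from′ h))
    where
    to′ : ∀ h → Descends (scaleF (+ p) Q) h → p∣ proj₁ (act Q h)
    to′ h (divides q eq , _) = divides q (ℤP.*-cancelˡ-≡ (+ p) (proj₁ (act Q h)) (q * + p) (trans (sym (cong proj₁ (act-scale (+ p) Q h))) (trans eq (ring q (+ p)))))
      where
      ring : ∀ q p → q * (p * p) ≡ p * (q * p)
      ring = solve-∀
    from′ : ∀ h → p∣ proj₁ (act Q h) → Descends (scaleF (+ p) Q) h
    from′ h (divides q eq) = divides q (trans (cong proj₁ (act-scale (+ p) Q h)) (trans (cong (+ p *_) eq) (ring q (+ p)))) ,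
      divides (proj₁ (proj₂ (act Q h))) (trans (cong (proj₁ ∘ proj₂) (act-scale (+ p) Q h)) (ℤP.*-comm (+ p) (proj₁ (proj₂ (act Q h)))))
      where
      ring : ∀ q p → p * (q * p) ≡ q * (p * p)
      ring = solve-∀

  quotF : Form → Form
  quotF (a , b , c) = quot (+ p) a , quot (+ p) b , quot (+ p) c

  scale-quot : ∀ Q → AllDiv Q → scaleF (+ p) (quotF Q) ≡ Q
  scale-quot (a , b , c) (da , db , dc) = form≡ (mul da) (mul db) (mul dc)
    where
    mul : ∀ {z} → p∣ z → + p * quot (+ p) z ≡ z
    mul {z} d = trans (ℤP.*-comm (+ p) (quot (+ p) z)) (sym (quot-spec d))

  -- Dividing by p takes the reduced forms of discriminant -p²N that are divisible by p to all
  -- reduced forms of discriminant -N, because `wt` is unchanged by scaling.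
  ∑imprimitive : ∀ (φ ψ : Form → ℤ) → (∀ Q → φ (scaleF (+ p) Q) ≡ ψ Q) → ∑ (filter allDiv? (red N′)) φ ≡ ∑ (red N) ψ
  ∑imprimitive φ ψ eq = sym (∑-bij (red-unique N) (UniqueP.filter⁺ allDiv? (red-unique N′)) (scaleF (+ p)) quotF to′ from′ (λ {Q} _ → sym (eq Q)))
    where
    allDiv-scale : ∀ Q → AllDiv (scaleF (+ p) Q)
    allDiv-scale (a , b , c) = divides a (ℤP.*-comm (+ p) a) , divides b (ℤP.*-comm (+ p) b) , divides c (ℤP.*-comm (+ p) c)
    to′ : ∀ {Q} → Q ∈ red N → scaleF (+ p) Q ∈ filter allDiv? (red N′) × quotF (scaleF (+ p) Q) ≡ Q
    to′ {Q} Q∈ with pd , w ← ∈-red⁻ N 1≤N Q∈ =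
      ∈P.∈-filter⁺ allDiv? (∈-red⁺ N′ 1≤N′ (trans (disc-scale (+ p) Q) (trans (cong (+ p * + p *_) (PosDef.disc≡ pd)) disc-N′)) (λ e → w (trans (sym (wt-scale p Q)) e))) (allDiv-scale Q) ,
      scaleF-injective (+ p) (scale-quot (scaleF (+ p) Q) (allDiv-scale Q))
    from′ : ∀ {Q′} → Q′ ∈ filter allDiv? (red N′) → quotF Q′ ∈ red N × scaleF (+ p) (quotF Q′) ≡ Q′
    from′ {Q′} Q′∈ with Q′∈red , ad ← ∈P.∈-filter⁻ allDiv? {xs = red N′} Q′∈ with pd , w ← ∈-red⁻ N′ 1≤N′ Q′∈red =
      ∈-red⁺ N 1≤N (ℤP.*-cancelˡ-≡ (+ p * + p) (disc (quotF Q′)) (- (+ N)) (trans (sym (disc-scale (+ p) (quotF Q′))) (trans (cong disc (scale-quot Q′ ad)) (trans (PosDef.disc≡ pd) (sym disc-N′)))))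
        (λ e → w (trans (cong wt (sym (scale-quot Q′ ad))) (trans (wt-scale p (quotF Q′)) e))) ,
      scale-quot Q′ ad

  -- A primitive form descends along one line and p Q along `Nₚ Q` lines, so `∑wK` reads (p + 1)
  -- `h4 N` = `h4 N′` - `h4 N` + `h4ₚ N`.
  hecke : h4ₚ N ≡ (+ p + + 2) * h4 N - h4 N′
  hecke = solve-for (trans (cong (_* h4 N) (sym (ℤP.pos-+ 1 p))) (begin
    + suc p * h4 N
      ≡⟨ ∑wK ⟩
    ∑ (red N′) (λ Q′ → wt Q′ * Kₚ Q′)
      ≡⟨ ∑-cong∈ (red N′) (λ {Q′} Q′∈ → pointwise Q′ (proj₁ (∈-red⁻ N′ 1≤N′ Q′∈))) ⟩
    ∑ (red N′) (λ Q′ → wt Q′ + 𝟙 (allDiv? Q′) * (wt Q′ * Kₚ Q′ + - wt Q′))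
      ≡⟨ trans (∑-+ (red N′) wt (λ Q′ → 𝟙 (allDiv? Q′) * (wt Q′ * Kₚ Q′ + - wt Q′))) (cong₂ _+_ (∑red N′) (sym (∑-filter allDiv? (red N′) (λ Q′ → wt Q′ * Kₚ Q′ + - wt Q′)))) ⟩
    h4 N′ + ∑ (filter allDiv? (red N′)) (λ Q′ → wt Q′ * Kₚ Q′ + - wt Q′)
      ≡⟨ cong (_+_ (h4 N′)) (trans (∑imprimitive (λ Q′ → wt Q′ * Kₚ Q′ + - wt Q′) (λ Q → wt Q * Nₚ Q + - wt Q) (λ Q → cong₂ (λ x k → x * k + - x) (wt-scale p Q) (K-scale Q)))
           (trans (∑-+ (red N) (λ Q → wt Q * Nₚ Q) (λ Q → - wt Q)) (cong (_+_ (h4ₚ N)) (trans (∑-neg (red N) wt) (cong -_ (∑red N)))))) ⟩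
    h4 N′ + (h4ₚ N + - h4 N) ∎))
    where
    solve-for : (+ 1 + + p) * h4 N ≡ h4 N′ + (h4ₚ N + - h4 N) → h4ₚ N ≡ (+ p + + 2) * h4 N - h4 N′
    solve-for eq = trans (r₁ (h4ₚ N) (h4 N) (h4 N′)) (trans (cong (λ z → z + h4 N - h4 N′) (sym eq)) (r₂ (+ p) (h4 N) (h4 N′)))
      where
      r₁ : ∀ a b c → a ≡ (c + (a + - b)) + b - c
      r₁ = solve-∀
      r₂ : ∀ p b c → (+ 1 + p) * b + b - c ≡ (p + + 2) * b - c
      r₂ = solve-∀
    pointwise : ∀ Q′ → PosDef N′ Q′ → wt Q′ * Kₚ Q′ ≡ wt Q′ + 𝟙 (allDiv? Q′) * (wt Q′ * Kₚ Q′ + - wt Q′)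
    pointwise Q′ pd with allDiv? Q′
    ... | yes _  = r (wt Q′) (wt Q′ * Kₚ Q′)
      where
      r : ∀ a b → b ≡ a + + 1 * (b + - a)
      r = solve-∀
    ... | no prim = trans (cong (wt Q′ *_) (Primitive.K≡1 Q′ pd prim)) (r (wt Q′) (wt Q′ * Kₚ Q′))
      where
      r : ∀ a b → a * + 1 ≡ a + + 0 * (b + - a)
      r = solve-∀

-- Orbits of Γ₀(p)

sg : Bool → ℤ
sg true  = + 1
sg false = - + 1

sg-scale² : ∀ s Q → scaleF (sg s) (scaleF (sg s) Q) ≡ Q
sg-scale² true  (a , b , c) = form≡ (r a) (r b) (r c)
  where
  r : ∀ x → + 1 * (+ 1 * x) ≡ x
  r = solve-∀
sg-scale² false (a , b , c) = form≡ (r a) (r b) (r c)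
  where
  r : ∀ x → - + 1 * (- + 1 * x) ≡ x
  r = solve-∀

disc-sg : ∀ s Q → disc (scaleF (sg s) Q) ≡ disc Q
disc-sg true  Q = trans (disc-scale (+ 1) Q) (ℤP.*-identityˡ (disc Q))
disc-sg false Q = trans (disc-scale (- + 1) Q) (ℤP.*-identityˡ (disc Q))

-- A form of negative discriminant is definite, and its leading coefficient tells the sign; negative
-- definite forms are negated before they are reduced.
signOf : Form → Bool
signOf (a , _ , _) with + 0 ℤP.<? a
... | yes _ = true
... | no _  = false

signOf-posDef : ∀ {N} Q → 1 ≤ℕ N → disc Q ≡ - (+ N) → PosDef N (scaleF (sg (signOf Q)) Q)
signOf-posDef {N} Q@(a , b , c) 1≤N eq with + 0 ℤP.<? a
... | yes a>0 = posDef-a 1≤N (trans (disc-sg true Q) eq) (subst (+ 0 ≤_) (sym (ℤP.*-identityˡ a)) (ℤP.<⇒≤ a>0))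
... | no a≯0  = posDef-a 1≤N (trans (disc-sg false Q) eq) (subst (+ 0 ≤_) (sym (ℤP.-1*i≡-i a)) (ℤP.neg-mono-≤ (ℤP.≮⇒≥ a≯0)))

signOf-unique : ∀ {N} s Q → PosDef N (scaleF (sg s) Q) → signOf Q ≡ s
signOf-unique true  (a , b , c) pd with + 0 ℤP.<? a
... | yes _   = refl
... | no a≯0  = contradiction (subst (+ 0 <_) (ℤP.*-identityˡ a) (PosDef.a>0 pd)) a≯0
signOf-unique false (a , b , c) pd with + 0 ℤP.<? a
... | no _    = refl
... | yes a>0 = contradiction (subst (+ 0 <_) (ℤP.-1*i≡-i a) (PosDef.a>0 pd)) (ℤP.≤⇒≯ (ℤP.<⇒≤ (ℤP.neg-mono-< a>0)))

toₛ : ∀ p x → + p ∣ x → + p ∣ₛ x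
toₛ p x = ∣⇒∣ₛ {+ p} {x}

fromₛ : ∀ p x → + p ∣ₛ x → + p ∣ x
fromₛ p x = ∣ₛ⇒∣ {+ p} {x}

InΓ₀-low : ∀ p g → InΓ₀ p g → + p ∣ₛ proj₁ (proj₂ (proj₂ g))
InΓ₀-low p (α , β , γ , δ) (_ , d) = toₛ p γ d

InΓ₀-· : ∀ {p} g h → InΓ₀ p g → InΓ₀ p h → InΓ₀ p (g · h)
InΓ₀-· {p} g@(α , β , γ , δ) h@(α′ , β′ , γ′ , δ′) (eq , d) (eq′ , d′) =
  trans (det-· g h) (cong₂ _*_ eq eq′) , fromₛ p (γ * α′ + δ * γ′) (∣ₛ-+ {+ p} {γ * α′} {δ * γ′} (∣ₛ-*ʳ α′ (toₛ p γ d)) (∣ₛ-*ˡ δ (toₛ p γ′ d′)))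

InΓ₀-adj : ∀ {p} g → InΓ₀ p g → InΓ₀ p (adj g)
InΓ₀-adj {p} g@(α , β , γ , δ) (eq , d) = trans (det-adj g) eq , fromₛ p (- γ) (∣ₛ-neg (toₛ p γ d))

InQ-lead : ∀ p D Q → InQ p D Q → + p ∣ₛ proj₁ Q
InQ-lead p D (a , b , c) (d , _) = toₛ p a d

InQ-act : ∀ {p D} Q g → InQ p D Q → InΓ₀ p g → InQ p D (act Q g)
InQ-act {p} Q@(a , b , c) g@(α , β , γ , δ) (d , eq) (det₁ , dγ) =
  fromₛ p (a * α * α + b * α * γ + c * γ * γ)
    (∣ₛ-+ {+ p} {a * α * α + b * α * γ} {c * γ * γ}
      (∣ₛ-+ {+ p} {a * α * α} {b * α * γ} (∣ₛ-*ʳ α (∣ₛ-*ʳ α (toₛ p a d))) (∣ₛ-*ˡ (b * α) (toₛ p γ dγ))) (∣ₛ-*ˡ (c * γ) (toₛ p γ dγ))) ,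
  trans (disc-act₁ Q g det₁) eq

Equiv-sym : ∀ {p Q Q′} → Equiv p Q Q′ → Equiv p Q′ Q
Equiv-sym {Q = Q} (g , g∈ , eq) = adj g , InΓ₀-adj g g∈ , act-adj {Q} g (proj₁ g∈) eq

Equiv-trans : ∀ {p Q Q′ Q″} → Equiv p Q Q′ → Equiv p Q′ Q″ → Equiv p Q Q″
Equiv-trans {Q = Q} (g , g∈ , refl) (h , h∈ , refl) = g · h , InΓ₀-· g h g∈ h∈ , sym (act-· Q g h)

∑-fin : ∀ {n} (f : Fin n → ℤ) j → (∀ i → i ≢ j → f i ≡ + 0) → ∑ (allFin n) f ≡ f j
∑-fin {n} f j z = ∑-single {f = f} (UniqueP.allFin⁺ n) (∈P.∈-allFin j) (λ {i} _ → z i)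

module Orbits (p : ℕ) (pp : Prime p) (N : ℕ) (1≤N : 1 ≤ℕ N) (L : List (Form × List Mat)) (rs : IsRepSystem p (- (+ N)) L) where
  open LevelForms p pp

  Index : Set
  Index = Fin (length L)

  rep : Index → Form
  rep j = proj₁ (lookup L j)

  stab : Index → List Mat
  stab j = proj₂ (lookup L j)

  private
    inQ      = proj₁ rs
    cover    = proj₁ (proj₂ rs)
    distinct = proj₁ (proj₂ (proj₂ rs))
    isStab   = proj₂ (proj₂ (proj₂ rs))

  -- A sign, a reduced form and a line on which that form vanishes mod p. These are the conditions
  -- under which `formOf` has level p, so the data are distributed among the orbits.
  Datum : Set
  Datum = Bool × Form × Mat

  zero? : (x : Form × Mat) → Dec (p∣ proj₁ (act (proj₁ x) (proj₂ x)))
  zero? (Q , h) = p∣? proj₁ (act Q h)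

  data₀ : List (Form × Mat)
  data₀ = filter zero? (dpairs (red N) (λ _ → ℙ¹ p))

  data± : List Datum
  data± = dpairs (true ∷ false ∷ []) (λ _ → data₀)

  data±-unique : Unique data±
  data±-unique = dpairs-unique (((λ ()) ∷ []) ∷ [] ∷ []) (λ _ → UniqueP.filter⁺ zero? (dpairs-unique (red-unique N) (λ _ → ℙ¹-unique p)))

  weight : Datum → ℤ
  weight (_ , Q , _) = wt Q

  formOf : Datum → Form
  formOf (s , Q , h) = scaleF (sg s) (act Q h)

  ∈-data⁻ : ∀ {s Q h} → (s , Q , h) ∈ data± → Q ∈ red N × h ∈ ℙ¹ p × p∣ proj₁ (act Q h)
  ∈-data⁻ {s} {Q} {h} y∈ with _ , y∈₀ ← ∈-dpairs⁻ {xs = true ∷ false ∷ []} {ys = λ _ → data₀} y∈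
    with y∈box , z ← ∈P.∈-filter⁻ zero? {xs = dpairs (red N) (λ _ → ℙ¹ p)} y∈₀
    with Q∈ , h∈ ← ∈-dpairs⁻ {xs = red N} {ys = λ _ → ℙ¹ p} y∈box = Q∈ , h∈ , z

  ∈-data⁺ : ∀ {s Q h} → Q ∈ red N → h ∈ ℙ¹ p → p∣ proj₁ (act Q h) → (s , Q , h) ∈ data±
  ∈-data⁺ {s} Q∈ h∈ z = ∈-dpairs⁺ {ys = λ _ → data₀} (both s) (∈P.∈-filter⁺ zero? (∈-dpairs⁺ {ys = λ _ → ℙ¹ p} Q∈ h∈) z)
    where
    both : ∀ s → s ∈ true ∷ false ∷ []
    both true  = here refl
    both false = there (here refl)

  formOf-inQ : ∀ {y} → y ∈ data± → InQ p (- (+ N)) (formOf y)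
  formOf-inQ {s , Q , h} y∈ with Q∈ , h∈ , z ← ∈-data⁻ {s} {Q} {h} y∈ =
    fromₛ p (sg s * proj₁ (act Q h)) (∣ₛ-*ˡ (sg s) z) , trans (disc-sg s (act Q h)) (trans (disc-act₁ Q h (ℙ¹-det p h∈)) (PosDef.disc≡ (proj₁ (∈-red⁻ N 1≤N Q∈))))

  Belongs : Index → Datum → Set
  Belongs j y = Equiv p (formOf y) (rep j)

  abstract
    -- `cover` yields a representative equivalent to the form and `distinct` makes it the only one,
    -- so comparing indices decides. Outside the forms of level p there can be no equivalence to
    -- `rep j`.
    belongs? : ∀ j y → Dec (Belongs j y)
    belongs? j y with (p∣? proj₁ (formOf y)) ×-dec (disc (formOf y) ℤP.≟ - (+ N))
    ... | no ¬q = no (λ { (k , k∈ , eq) → ¬q (let d , e = subst (InQ p (- (+ N))) (act-adj {formOf y} k (proj₁ k∈) eq) (InQ-act (rep j) (adj k) (inQ j) (InΓ₀-adj k k∈)) in InQ-lead p (- (+ N)) (formOf y) (d , e) , e) })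
    ... | yes (d , e) with cover (formOf y) (fromₛ p (proj₁ (formOf y)) d , e)
    ...   | i , eqv with i FinP.≟ j
    ...     | yes refl = yes eqv
    ...     | no ne    = no (λ eqv′ → ne (distinct i j (Equiv-trans {p} {rep i} {formOf y} {rep j} (Equiv-sym {p} {formOf y} {rep i} eqv) eqv′)))

  module At (j : Index) where

    Q₀ P₀ : Form
    Q₀ = rep j
    P₀ = scaleF (sg (signOf Q₀)) Q₀

    pd : PosDef N P₀
    pd = signOf-posDef Q₀ 1≤N (proj₂ (inQ j))

    members : List Datum
    members = filter (belongs? j) data±

    chosen : ∀ y → Dec (Belongs j y) → Mat
    chosen y (yes (k , _)) = k
    chosen y (no _)        = 𝐈

    chosen-spec : ∀ y (d : Dec (Belongs j y)) → Belongs j y → InΓ₀ p (chosen y d) × act (formOf y) (chosen y d) ≡ Q₀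
    chosen-spec y (yes (k , k∈ , eq)) b = k∈ , eq
    chosen-spec y (no ¬b)             b = contradiction b ¬b

    kOf : Datum → Mat
    kOf y = chosen y (belongs? j y)

    kOf-spec : ∀ y → Belongs j y → InΓ₀ p (kOf y) × act (formOf y) (kOf y) ≡ Q₀
    kOf-spec y = chosen-spec y (belongs? j y)

    -- For a datum of the orbit this is one matrix with Q ∘ t = ± Q₀; the others of the form h · k
    -- with k in Γ₀(p) differ from it by the stabilizer.
    tOf : Datum → Mat
    tOf y@(_ , _ , h) = h · kOf y

    hLow : Mat → Mat
    hLow (α , _ , γ , _) = pick (λ h → p∣? low h α γ) 𝐈 (ℙ¹ p)

    column : ∀ α β γ δ → det (α , β , γ , δ) ≡ + 1 → ¬ (p∣ α × p∣ γ)
    column α β γ δ eq (dα , dγ) = p∤1 (subst (p∣_) eq (∣ₛ-+ (∣ₛ-*ʳ δ dα) (∣ₛ-neg (∣ₛ-*ˡ β dγ))))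

    hLow-spec : ∀ M → det M ≡ + 1 → hLow M ∈ ℙ¹ p × p∣ proj₁ (proj₂ (proj₂ (adj (hLow M) · M)))
    hLow-spec M@(α , β , γ , δ) eq = let h , h∈ , d = ℙ¹-exists α γ (column α β γ δ eq) in pick-spec (λ h → p∣? low h α γ) 𝐈 h∈ d

    hLow-unique : ∀ {h} M → det M ≡ + 1 → h ∈ ℙ¹ p → p∣ proj₁ (proj₂ (proj₂ (adj h · M))) → hLow M ≡ h
    hLow-unique M@(α , β , γ , δ) eq h∈ d = ℙ¹-separates α γ (column α β γ δ eq) (proj₁ (hLow-spec M eq)) h∈ (proj₂ (hLow-spec M eq)) d

    -- Orbit and stabilizer: σ fixes P₀ and the inverse of t then leads to Q, so the product is a
    -- reduction of P₀.
    f : Datum × Mat → Mat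
    f (y , σ) = σ · adj (tOf y)

    -- A reduction m of P₀ determines the reduced form P₀ ∘ m, and the line is spanned mod p by the
    -- first column of the inverse of m.
    datum : Mat → Datum
    datum m = signOf Q₀ , act P₀ m , hLow (adj m)

    g : Mat → Datum × Mat
    g m = datum m , m · tOf (datum m)

    source : List (Datum × Mat)
    source = dpairs members (λ _ → stab j)

    stab-spec : ∀ {σ} → σ ∈ stab j → InΓ₀ p σ × act Q₀ σ ≡ Q₀
    stab-spec {σ} = Equivalence.to (proj₂ (isStab j) σ)

    module Into (s : Bool) (Q F : Form) (h σ k t m : Mat)
      (F≡ : formOf (s , Q , h) ≡ F) (k≡ : kOf (s , Q , h) ≡ k) (t≡ : h · k ≡ t) (m≡ : σ · adj t ≡ m)
      (y∈ : (s , Q , h) ∈ data±) (b : Belongs j (s , Q , h)) (σ∈ : σ ∈ stab j) where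

      Q∈ : Q ∈ red N
      Q∈ = proj₁ (∈-data⁻ {s} {Q} {h} y∈)

      h∈ : h ∈ ℙ¹ p
      h∈ = proj₁ (proj₂ (∈-data⁻ {s} {Q} {h} y∈))

      k∈ : InΓ₀ p k
      k∈ = subst (InΓ₀ p) k≡ (proj₁ (kOf-spec (s , Q , h) b))

      eqk : act F k ≡ Q₀
      eqk = trans (cong₂ act (sym F≡) (sym k≡)) (proj₂ (kOf-spec (s , Q , h) b))

      σ∈Γ : InΓ₀ p σ
      σ∈Γ = proj₁ (stab-spec σ∈)

      det-t : det t ≡ + 1
      det-t = trans (cong det (sym t≡)) (trans (det-· h k) (cong₂ _*_ (ℙ¹-det p h∈) (proj₁ k∈)))

      det-m : det m ≡ + 1
      det-m = trans (cong det (sym m≡)) (trans (det-· σ (adj t)) (cong₂ _*_ (proj₁ σ∈Γ) (trans (det-adj t) det-t)))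

      signed : scaleF (sg s) Q₀ ≡ act Q t
      signed = trans (cong (scaleF (sg s)) (sym eqk)) (trans (sym (act-scale (sg s) F k))
        (trans (cong (λ P → act P k) (trans (cong (scaleF (sg s)) (sym F≡)) (sg-scale² s (act Q h)))) (trans (act-· Q h k) (cong (act Q) t≡))))

      s≡ : signOf Q₀ ≡ s
      s≡ = signOf-unique {N} s Q₀ (subst (PosDef N) (sym signed) (posDef-act {N} {Q} t det-t (proj₁ (∈-red⁻ N {Q} 1≤N Q∈))))

      P₀≡ : P₀ ≡ act Q t
      P₀≡ = trans (cong (λ s → scaleF (sg s) Q₀) s≡) signed

      stable : act P₀ σ ≡ P₀
      stable = trans (act-scale (sg (signOf Q₀)) Q₀ σ) (cong (scaleF (sg (signOf Q₀))) (proj₂ (stab-spec σ∈)))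

      act-m : act P₀ m ≡ Q
      act-m = trans (cong (act P₀) (sym m≡)) (trans (sym (act-· P₀ σ (adj t))) (trans (cong (λ P → act P (adj t)) stable) (act-adj {Q} {P₀} t det-t (sym P₀≡))))

      member : m ∈ reds N 1≤N P₀
      member = reds-complete N 1≤N {P₀} {m} pd det-m (subst (λ P → wt P ≢ + 0) (sym act-m) (proj₂ (∈-red⁻ N {Q} 1≤N Q∈)))

      -- The right-hand side lies in Γ₀(p), which identifies h as the line of the first column of
      -- `adj m`.
      adj-m : adj h · adj m ≡ k · adj σ
      adj-m = trans (cong (λ z → adj h · adj z) (sym m≡)) (trans (cong (adj h ·_) (trans (adj-· σ (adj t)) (cong (_· adj σ) (trans (adj-adj t) (sym t≡)))))
        (trans (cong (adj h ·_) (·-assoc h k (adj σ))) (trans (sym (·-assoc (adj h) h (k · adj σ))) (trans (cong (_· (k · adj σ)) (adj-inverseˡ h (ℙ¹-det p h∈))) (𝐈-identityˡ (k · adj σ))))))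

      h≡ : hLow (adj m) ≡ h
      h≡ = hLow-unique {h} (adj m) (trans (det-adj m) det-m) h∈ (subst (λ M → p∣ proj₁ (proj₂ (proj₂ M))) (sym adj-m) (InΓ₀-low p (k · adj σ) (InΓ₀-· {p} k (adj σ) k∈ (InΓ₀-adj {p} σ σ∈Γ))))

      y≡ : datum m ≡ (s , Q , h)
      y≡ = cong₂ _,_ s≡ (cong₂ _,_ act-m h≡)

      σ-back : m · t ≡ σ
      σ-back = trans (cong (_· t) (sym m≡)) (trans (·-assoc σ (adj t) t) (trans (cong (σ ·_) (adj-inverseˡ t det-t)) (𝐈-identityʳ σ)))

    module OutOf (m : Mat) (s : Bool) (Q F P : Form) (h k t κ : Mat)
      (s≡ : signOf Q₀ ≡ s) (P≡ : P₀ ≡ P) (Q≡ : act P₀ m ≡ Q) (h≡ : hLow (adj m) ≡ h)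
      (F≡ : formOf (s , Q , h) ≡ F) (k≡ : kOf (s , Q , h) ≡ k) (t≡ : h · k ≡ t) (κ≡ : adj h · adj m ≡ κ)
      (m∈ : m ∈ reds N 1≤N P₀) where

      det-m : det m ≡ + 1
      det-m = proj₁ (reds-sound N 1≤N {P₀} {m} pd m∈)

      det-adjm : det (adj m) ≡ + 1
      det-adjm = trans (det-adj m) det-m

      h∈ : h ∈ ℙ¹ p
      h∈ = subst (_∈ ℙ¹ p) h≡ (proj₁ (hLow-spec (adj m) det-adjm))

      lowered : p∣ proj₁ (proj₂ (proj₂ (adj h · adj m)))
      lowered = subst (λ h → p∣ proj₁ (proj₂ (proj₂ (adj h · adj m)))) h≡ (proj₂ (hLow-spec (adj m) det-adjm))

      κ∈ : InΓ₀ p κ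
      κ∈ = subst (InΓ₀ p) κ≡ (trans (det-· (adj h) (adj m)) (cong₂ _*_ (trans (det-adj h) (ℙ¹-det p h∈)) det-adjm) , fromₛ p (proj₁ (proj₂ (proj₂ (adj h · adj m)))) lowered)

      adjκ : adj κ ≡ m · h
      adjκ = trans (cong adj (sym κ≡)) (trans (adj-· (adj h) (adj m)) (cong₂ _·_ (adj-adj m) (adj-adj h)))

      P-signed : P ≡ scaleF (sg s) Q₀
      P-signed = trans (sym P≡) (cong (λ s → scaleF (sg s) Q₀) s≡)

      act-Q : act Q h ≡ scaleF (sg s) (act Q₀ (m · h))
      act-Q = trans (cong (λ R → act R h) (sym Q≡)) (trans (act-· P₀ m h) (trans (cong (λ R → act R (m · h)) (trans P≡ P-signed)) (act-scale (sg s) Q₀ (m · h))))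

      F-value : F ≡ act Q₀ (m · h)
      F-value = trans (sym F≡) (trans (cong (scaleF (sg s)) act-Q) (sg-scale² s (act Q₀ (m · h))))

      F-κ : act Q₀ (adj κ) ≡ F
      F-κ = trans (cong (act Q₀) adjκ) (sym F-value)

      -- The choice of h makes the lower left entry of κ divisible by p, so the inverse of κ is an
      -- equivalence in Γ₀(p) from Q₀ to the form of the datum.
      b : Belongs j (s , Q , h)
      b = subst (λ R → Equiv p R Q₀) (sym F≡) (Equiv-sym {p} {Q₀} {F} (adj κ , InΓ₀-adj {p} κ κ∈ , F-κ))

      zero-y : p∣ proj₁ (act Q h)
      zero-y = subst (λ R → p∣ proj₁ R) (trans (cong (scaleF (sg s)) F-value) (sym act-Q))
        (∣ₛ-*ˡ (sg s) (InQ-lead p (- (+ N)) F (subst (InQ p (- (+ N))) F-κ (InQ-act {p} {D = - (+ N)} Q₀ (adj κ) (inQ j) (InΓ₀-adj {p} κ κ∈)))))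

      Q∈ : Q ∈ red N
      Q∈ = ∈-red⁺ N {Q} 1≤N (trans (cong disc (sym Q≡)) (trans (disc-act₁ P₀ m det-m) (PosDef.disc≡ pd))) (subst (λ R → wt R ≢ + 0) Q≡ (proj₂ (reds-sound N 1≤N {P₀} {m} pd m∈)))

      y∈ : (s , Q , h) ∈ data±
      y∈ = ∈-data⁺ {s} {Q} {h} Q∈ h∈ zero-y

      k∈ : InΓ₀ p k
      k∈ = subst (InΓ₀ p) k≡ (proj₁ (kOf-spec (s , Q , h) b))

      eqk : act F k ≡ Q₀
      eqk = trans (cong₂ act (sym F≡) (sym k≡)) (proj₂ (kOf-spec (s , Q , h) b))

      det-t : det t ≡ + 1
      det-t = trans (cong det (sym t≡)) (trans (det-· h k) (cong₂ _*_ (ℙ¹-det p h∈) (proj₁ k∈)))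

      regroup : (m · h) · k ≡ m · t
      regroup = trans (·-assoc m h k) (cong (m ·_) t≡)

      σ∈Γ : InΓ₀ p (m · t)
      σ∈Γ = subst (InΓ₀ p) (trans (cong (_· k) adjκ) regroup) (InΓ₀-· {p} (adj κ) k (InΓ₀-adj {p} κ κ∈) k∈)

      stabilises : act Q₀ (m · t) ≡ Q₀
      stabilises = trans (cong (act Q₀) (sym regroup)) (trans (sym (act-· Q₀ (m · h) k)) (trans (cong (λ R → act R k) (sym F-value)) eqk))

      σ∈ : m · t ∈ stab j
      σ∈ = Equivalence.from (proj₂ (isStab j) (m · t)) (σ∈Γ , stabilises)

      member : ((s , Q , h) , m · t) ∈ source
      member = ∈-dpairs⁺ {xs = members} {ys = λ _ → stab j} {x = s , Q , h} {y = m · t} (∈P.∈-filter⁺ (belongs? j) y∈ b) σ∈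

      m-back : (m · t) · adj t ≡ m
      m-back = trans (·-assoc m t (adj t)) (trans (cong (m ·_) (adj-inverseʳ t det-t)) (𝐈-identityʳ m))

    module IntoAt (s : Bool) (Q : Form) (h σ : Mat) (x∈ : ((s , Q , h) , σ) ∈ source) where
      y∈members : (s , Q , h) ∈ members
      y∈members = proj₁ (∈-dpairs⁻ {xs = members} {ys = λ _ → stab j} {x = s , Q , h} {y = σ} x∈)
      open Into s Q (formOf (s , Q , h)) h σ (kOf (s , Q , h)) (tOf (s , Q , h)) (f ((s , Q , h) , σ)) refl refl refl refl
        (proj₁ (∈P.∈-filter⁻ (belongs? j) {xs = data±} y∈members)) (proj₂ (∈P.∈-filter⁻ (belongs? j) {xs = data±} y∈members))
        (proj₂ (∈-dpairs⁻ {xs = members} {ys = λ _ → stab j} {x = s , Q , h} {y = σ} x∈)) public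

    module OutOfAt (m : Mat) (m∈ : m ∈ reds N 1≤N P₀) where
      open OutOf m (signOf Q₀) (act P₀ m) (formOf (datum m)) P₀ (hLow (adj m)) (kOf (datum m)) (tOf (datum m)) (adj (hLow (adj m)) · adj m)
        refl refl refl refl refl refl refl refl m∈ public

    to : ∀ {x} → x ∈ source → f x ∈ reds N 1≤N P₀ × g (f x) ≡ x
    to {(s , Q , h) , σ} x∈ = IntoAt.member s Q h σ x∈ ,
      cong₂ _,_ (IntoAt.y≡ s Q h σ x∈) (trans (cong (λ y → f ((s , Q , h) , σ) · tOf y) (IntoAt.y≡ s Q h σ x∈)) (IntoAt.σ-back s Q h σ x∈))

    from : ∀ {m} → m ∈ reds N 1≤N P₀ → g m ∈ source × f (g m) ≡ m
    from {m} m∈ = OutOfAt.member m m∈ , OutOfAt.m-back m m∈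

    weights : ∀ {x} → x ∈ source → weight (proj₁ x) ≡ wt (act P₀ (f x))
    weights {(s , Q , h) , σ} x∈ = cong wt (sym (IntoAt.act-m s Q h σ x∈))

    -- The reductions of P₀ have total weight 48, and they are fibred over the data of the orbit
    -- with fibres of the size of the stabilizer.
    orbit-weight : + length (stab j) * ∑ members weight ≡ + 48
    orbit-weight = begin
      + length (stab j) * ∑ members weight
        ≡⟨ sym (∑-*ˡ (+ length (stab j)) members weight) ⟩
      ∑ members (λ y → + length (stab j) * weight y)
        ≡⟨ ∑-cong members (λ y → sym (∑-const (weight y) (stab j))) ⟩
      ∑ members (λ y → ∑ (stab j) (λ _ → weight y))
        ≡⟨ sym (∑-dpairs members (λ _ → stab j) (λ x → weight (proj₁ x))) ⟩
      ∑ source (λ x → weight (proj₁ x))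
        ≡⟨ ∑-bij (dpairs-unique (UniqueP.filter⁺ (belongs? j) data±-unique) (λ _ → proj₁ (isStab j))) (reds-unique N 1≤N P₀) f g to from weights ⟩
      ∑ (reds N 1≤N P₀) (λ m → wt (act P₀ m))
        ≡⟨ reds-total N 1≤N pd ⟩
      + 48 ∎

  share : Index → ℤ
  share j = ∑ (At.members j) weight

  -- Every datum lies in exactly one orbit, and the two signs double the sum over pairs (Q, h).
  ∑share : ∑ (allFin (length L)) share ≡ + 2 * h4ₚ N
  ∑share = begin
    ∑ (allFin (length L)) share
      ≡⟨ ∑-cong (allFin (length L)) (λ j → ∑-filter (belongs? j) data± weight) ⟩
    ∑ (allFin (length L)) (λ j → ∑ data± (λ y → 𝟙 (belongs? j y) * weight y))
      ≡⟨ ∑-swap (allFin (length L)) data± (λ j y → 𝟙 (belongs? j y) * weight y) ⟩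
    ∑ data± (λ y → ∑ (allFin (length L)) (λ j → 𝟙 (belongs? j y) * weight y))
      ≡⟨ ∑-cong∈ data± (λ {y} y∈ → once y y∈) ⟩
    ∑ data± weight
      ≡⟨ ∑-dpairs (true ∷ false ∷ []) (λ _ → data₀) weight ⟩
    D + (D + + 0)
      ≡⟨ ring D ⟩
    + 2 * D
      ≡⟨ cong (+ 2 *_) (trans (∑-filter zero? (dpairs (red N) (λ _ → ℙ¹ p)) (λ x → wt (proj₁ x))) (trans (∑-dpairs (red N) (λ _ → ℙ¹ p) (λ x → 𝟙 (zero? x) * wt (proj₁ x)))
           (∑-cong (red N) (λ Q → trans (∑-*ʳ (wt Q) (ℙ¹ p) (λ h → 𝟙 (p∣? proj₁ (act Q h)))) (ℤP.*-comm (Nₚ Q) (wt Q)))))) ⟩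
    + 2 * h4ₚ N ∎
    where
    D = ∑ data₀ (λ x → wt (proj₁ x))
    ring : ∀ d → d + (d + + 0) ≡ + 2 * d
    ring = solve-∀
    once : ∀ y → y ∈ data± → ∑ (allFin (length L)) (λ j → 𝟙 (belongs? j y) * weight y) ≡ weight y
    once y y∈ = trans
      (∑-fin (λ j → 𝟙 (belongs? j y) * weight y) i (λ j ne → cong (_* weight y) (𝟙-no (belongs? j y) (λ eqv′ → ne (same j eqv′)))))
      (trans (cong (_* weight y) (𝟙-yes (belongs? i y) eqv)) (ℤP.*-identityˡ (weight y)))
      where
      i : Index
      i = proj₁ (cover (formOf y) (formOf-inQ {y} y∈))
      eqv : Belongs i y
      eqv = proj₂ (cover (formOf y) (formOf-inQ {y} y∈))
      same : ∀ j → Belongs j y → j ≡ i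
      same j eqv′ = distinct j i (Equiv-trans {p} {rep j} {formOf y} {rep i} (Equiv-sym {p} {formOf y} {rep j} eqv′) eqv)

-- Rational weight sums from integral class sums

ι : ℤ → ℚ
ι i = i / 1

private
  toℚᵘ-/ : ∀ i k → ℚ.toℚᵘ (i / suc k) ℚᵘ.≃ ℚᵘ.mkℚᵘ i k
  toℚᵘ-/ i k = ℚP.toℚᵘ-fromℚᵘ (ℚᵘ.mkℚᵘ i k)

ι-+ : ∀ i j → ι i +ℚ ι j ≡ ι (i + j)
ι-+ i j = ℚP.toℚᵘ-injective (ℚᵘP.≃-trans (ℚP.toℚᵘ-homo-+ (ι i) (ι j)) (ℚᵘP.≃-trans (ℚᵘP.+-cong (toℚᵘ-/ i 0) (toℚᵘ-/ j 0)) (ℚᵘP.≃-trans (ℚᵘ.*≡* (ring i j)) (ℚᵘP.≃-sym (toℚᵘ-/ (i + j) 0)))))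
  where
  ring : ∀ i j → (i * + 1 + j * + 1) * + 1 ≡ (i + j) * + 1
  ring = solve-∀

ι-* : ∀ i j → ι i *ℚ ι j ≡ ι (i * j)
ι-* i j = ℚP.toℚᵘ-injective (ℚᵘP.≃-trans (ℚP.toℚᵘ-homo-* (ι i) (ι j)) (ℚᵘP.≃-trans (ℚᵘP.*-cong (toℚᵘ-/ i 0) (toℚᵘ-/ j 0)) (ℚᵘP.≃-sym (toℚᵘ-/ (i * j) 0))))

ι-neg : ∀ i → ℚ.- ι i ≡ ι (- i)
ι-neg i = begin
  ℚ.- ι i                           ≡⟨ sym (ℚP.+-identityʳ (ℚ.- ι i)) ⟩
  ℚ.- ι i +ℚ ι (+ 0)                ≡⟨ cong (ℚ.- ι i +ℚ_) (sym (trans (ι-+ i (- i)) (cong ι (ℤP.+-inverseʳ i)))) ⟩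
  ℚ.- ι i +ℚ (ι i +ℚ ι (- i))       ≡⟨ sym (ℚP.+-assoc (ℚ.- ι i) (ι i) (ι (- i))) ⟩
  (ℚ.- ι i +ℚ ι i) +ℚ ι (- i)       ≡⟨ cong (_+ℚ ι (- i)) (ℚP.+-inverseˡ (ι i)) ⟩
  ι (+ 0) +ℚ ι (- i)                ≡⟨ ℚP.+-identityˡ (ι (- i)) ⟩
  ι (- i)                           ∎

-- 24 · 2 / s is 48 / s. The equation also excludes s = 0, where `inv` takes a dummy value.
ι-share : ∀ s y → + s * y ≡ + 48 → ι (+ 24) *ℚ (ι (+ 2) *ℚ inv s) ≡ ι y
ι-share zero    y eq = contradiction eq (λ ())
ι-share (suc k) y eq = ℚP.toℚᵘ-injective (ℚᵘP.≃-trans (ℚP.toℚᵘ-homo-* (ι (+ 24)) (ι (+ 2) *ℚ inv (suc k)))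
  (ℚᵘP.≃-trans (ℚᵘP.*-cong (toℚᵘ-/ (+ 24) 0) (ℚᵘP.≃-trans (ℚP.toℚᵘ-homo-* (ι (+ 2)) (inv (suc k))) (ℚᵘP.*-cong (toℚᵘ-/ (+ 2) 0) (toℚᵘ-/ (+ 1) k))))
    (ℚᵘP.≃-trans (ℚᵘ.*≡* cross) (ℚᵘP.≃-sym (toℚᵘ-/ y 0)))))
  where
  cross : + 48 * + 1 ≡ y * + (1 *ℕ (1 *ℕ suc k))
  cross = trans (sym eq) (trans (ℤP.*-comm (+ suc k) y) (cong (λ m → y * + m) (sym (trans (ℕP.*-identityˡ (1 *ℕ suc k)) (ℕP.*-identityˡ (suc k))))))

weightSum-shares : (L : List (Form × List Mat)) (Y : Fin (length L) → ℤ) → (∀ j → + length (proj₂ (lookup L j)) * Y j ≡ + 48) →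
  ι (+ 24) *ℚ weightSum L ≡ ι (∑ (allFin (length L)) Y)
weightSum-shares []            Y eq = ℚP.*-zeroʳ (ι (+ 24))
weightSum-shares ((Q , S) ∷ L) Y eq = begin
  ι (+ 24) *ℚ (ι (+ 2) *ℚ inv (length S) +ℚ weightSum L)
    ≡⟨ ℚP.*-distribˡ-+ (ι (+ 24)) (ι (+ 2) *ℚ inv (length S)) (weightSum L) ⟩
  ι (+ 24) *ℚ (ι (+ 2) *ℚ inv (length S)) +ℚ ι (+ 24) *ℚ weightSum L
    ≡⟨ cong₂ _+ℚ_ (ι-share (length S) (Y fzero) (eq fzero)) (weightSum-shares L (Y ∘ fsuc) (eq ∘ fsuc)) ⟩
  ι (Y fzero) +ℚ ι (∑ (allFin (length L)) (Y ∘ fsuc))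
    ≡⟨ ι-+ (Y fzero) (∑ (allFin (length L)) (Y ∘ fsuc)) ⟩
  ι (Y fzero + ∑ (allFin (length L)) (Y ∘ fsuc))
    ≡⟨ cong (λ s → ι (Y fzero + s)) (trans (sym (∑-map fsuc (allFin (length L)) Y)) (cong (λ l → ∑ l Y) (ListP.map-tabulate (λ i → i) fsuc))) ⟩
  ι (∑ (allFin (suc (length L))) Y) ∎

weightSum-h4ₚ : ∀ p (pp : Prime p) N → 1 ≤ℕ N → ∀ L → IsRepSystem p (- (+ N)) L → ι (+ 24) *ℚ weightSum L ≡ ι (+ 2 * LevelForms.h4ₚ p pp N)
weightSum-h4ₚ p pp N 1≤N L rs = trans (weightSum-shares L share (λ j → At.orbit-weight j)) (cong ι ∑share)
  where
  open Orbits p pp N 1≤N L rs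

half : ∀ W h → ι (+ 24) *ℚ W ≡ ι (+ 2 * h) → ι (+ 12) *ℚ W ≡ ι h
half W h eq = begin
  -- The rational number 12 is read as the product of 1/2 and 24, which evaluates.
  ι (+ 12) *ℚ W                  ≡⟨ ℚP.*-assoc (+ 1 / 2) (ι (+ 24)) W ⟩
  (+ 1 / 2) *ℚ (ι (+ 24) *ℚ W)   ≡⟨ cong ((+ 1 / 2) *ℚ_) (trans eq (sym (ι-* (+ 2) h))) ⟩
  (+ 1 / 2) *ℚ (ι (+ 2) *ℚ ι h)  ≡⟨ sym (ℚP.*-assoc (+ 1 / 2) (ι (+ 2)) (ι h)) ⟩
  ι (+ 1) *ℚ ι h                 ≡⟨ ℚP.*-identityˡ (ι h) ⟩
  ι h ∎

theorem1p1 : (p : ℕ) → Prime p → p ≢ 2 → (n : ℕ) → 0 <ℕ n → (n % 4 ≡ 0 ⊎ n % 4 ≡ 3) →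
    (L₁ : List (Form × List Mat)) → IsRepSystem p (- (+ (4 *ℕ n))) L₁ →
    (L₂ : List (Form × List Mat)) → IsRepSystem p (- (+ n)) L₂ →
    ((+ 12) / 1) *ℚ weightSum L₁ -ℚ ((+ 24) / 1) *ℚ weightSum L₂
    ≡ (+ (4 *ℕ r3 n) - + 2 * (+ r3 (p ^ 2 *ℕ n) - + p * + r3 n)) / 1
theorem1p1 p pp p≢2 n 0<n _ L₁ rs₁ L₂ rs₂ = begin
  ι (+ 12) *ℚ weightSum L₁ -ℚ ι (+ 24) *ℚ weightSum L₂
    ≡⟨ cong₂ _-ℚ_ (half (weightSum L₁) (h4ₚ (4 *ℕ n)) (weightSum-h4ₚ p pp (4 *ℕ n) 0<4n L₁ rs₁)) (weightSum-h4ₚ p pp n 0<n L₂ rs₂) ⟩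
  ι (h4ₚ (4 *ℕ n)) -ℚ ι (+ 2 * h4ₚ n)
    ≡⟨ trans (cong (ι (h4ₚ (4 *ℕ n)) +ℚ_) (ι-neg (+ 2 * h4ₚ n))) (ι-+ (h4ₚ (4 *ℕ n)) (- (+ 2 * h4ₚ n))) ⟩
  ι (h4ₚ (4 *ℕ n) - + 2 * h4ₚ n)
    ≡⟨ cong ι integers ⟩
  ι (+ (4 *ℕ r3 n) - + 2 * (+ r3 (p ^ 2 *ℕ n) - + p * + r3 n)) ∎
  where
  open LevelForms p pp using (h4ₚ)
  0<4n : 1 ≤ℕ 4 *ℕ n
  0<4n = ℕP.≤-trans 0<n (ℕP.m≤m+n n _)
  m = p *ℕ p *ℕ n
  0<m : 1 ≤ℕ m
  0<m = HeckeCount.1≤N′ p pp n 0<n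
  m≡ : p ^ 2 *ℕ n ≡ m
  m≡ = cong (λ k → p *ℕ k *ℕ n) (ℕP.*-identityʳ p)
  -- The Hecke relation at 4n produces p²(4n); rewritten as 4(p²n) it fits Gauss's formula at p²n.
  4m : p *ℕ p *ℕ (4 *ℕ n) ≡ 4 *ℕ m
  4m = ring (p *ℕ p) n
    where
    ring : ∀ k n → k *ℕ (4 *ℕ n) ≡ 4 *ℕ (k *ℕ n)
    ring = ℕ-solve-∀
  integers : h4ₚ (4 *ℕ n) - + 2 * h4ₚ n ≡ + (4 *ℕ r3 n) - + 2 * (+ r3 (p ^ 2 *ℕ n) - + p * + r3 n)
  integers = begin
    h4ₚ (4 *ℕ n) - + 2 * h4ₚ n
      ≡⟨ cong₂ (λ x y → x - + 2 * y) (Hecke.hecke p pp p≢2 (4 *ℕ n) 0<4n) (Hecke.hecke p pp p≢2 n 0<n) ⟩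
    ((+ p + + 2) * h4 (4 *ℕ n) - h4 (p *ℕ p *ℕ (4 *ℕ n))) - + 2 * ((+ p + + 2) * h4 n - h4 m)
      ≡⟨ cong (λ k → ((+ p + + 2) * h4 (4 *ℕ n) - h4 k) - + 2 * ((+ p + + 2) * h4 n - h4 m)) 4m ⟩
    ((+ p + + 2) * h4 (4 *ℕ n) - h4 (4 *ℕ m)) - + 2 * ((+ p + + 2) * h4 n - h4 m)
      ≡⟨ regroup (+ p) (h4 (4 *ℕ n)) (h4 n) (h4 (4 *ℕ m)) (h4 m) ⟩
    (+ p + + 2) * (h4 (4 *ℕ n) - + 2 * h4 n) - (h4 (4 *ℕ m) - + 2 * h4 m)
      ≡⟨ cong₂ (λ x y → (+ p + + 2) * x - y) (gauss n 0<n) (gauss m 0<m) ⟩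
    (+ p + + 2) * (+ 2 * + r3 n) - + 2 * + r3 m
      ≡⟨ finish (+ p) (+ r3 n) (+ r3 m) ⟩
    + 4 * + r3 n - + 2 * (+ r3 m - + p * + r3 n)
      ≡⟨ cong₂ (λ x k → x - + 2 * (+ r3 k - + p * + r3 n)) (sym (ℤP.pos-* 4 (r3 n))) (sym m≡) ⟩
    + (4 *ℕ r3 n) - + 2 * (+ r3 (p ^ 2 *ℕ n) - + p * + r3 n) ∎
    where
    regroup : ∀ p a b c d → ((p + + 2) * a - c) - + 2 * ((p + + 2) * b - d) ≡ (p + + 2) * (a - + 2 * b) - (c - + 2 * d)
    regroup = solve-∀
    finish : ∀ p r r′ → (p + + 2) * (+ 2 * r) - + 2 * r′ ≡ + 4 * r - + 2 * (r′ - p * r)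
    finish = solve-∀
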